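{- Let $2\leq m<n$ be integers. Then $$\textup{res}(\Psi_m(x),\Psi_n(x))=\textup{res}(\Phi_m(x),\Phi_n(x)).$$
   Context: $\Phi_n(x)$ is the $n$-th cyclotomic polynomial and $\textup{res}(f,g)$ denotes the resultant of polynomials $f$ and $g$. The Fibonacci polynomials are defined by $F_1(x)=1$, $F_2(x)=x$, and $F_n(x)=xF_{n-1}(x)+F_{n-2}(x)$ for $n\geq 3$. For $n\geq 2$, the $n$-th fibotomic polynomial $\Psi_n(x)$ is the product of the monic irreducible factors (in $\mathbb{Z}[x]$) of $F_n(x)$ which are not factors of $F_k(x)$ for any $k<n$; equivalently $\Psi_n(x)=\prod_{1\le s\le n,\ \gcd(s,n)=1}\left(x-2i\cos\frac{\pi s}{n}\right)$. -}

module Defs where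

open import Data.Nat as ℕ using (ℕ; zero; suc; _∸_; _≤?_)
open import Data.Nat.Divisibility using (_∣?_)
open import Data.Integer as ℤ using (ℤ; +_; -_; -1ℤ; 0ℤ; 1ℤ)
open import Data.Fin using (Fin; toℕ; punchIn) renaming (zero to fzero; suc to fsuc)
open import Data.List using (List; []; _∷_; length; reverse; foldr; map; upTo; filter; _++_; lookup)
open import Data.Product using (Σ; _×_; ∃)
open import Data.Sum using (_⊎_)
open import Data.Bool using (if_then_else_)
open import Relation.Nullary using (¬_; does; yes; no)
open import Relation.Binary.PropositionalEquality using (_≡_)

-- Polynomials in ℤ[x] as coefficient lists, lowest degree first.
-- Trailing zeros are allowed; polynomials are compared after `norm`.

Poly : Set
Poly = List ℤ

norm : Poly → Poly
norm [] = []
norm (a ∷ as) with norm as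
... | [] = if does (a ℤ.≟ 0ℤ) then [] else (a ∷ [])
... | r@(_ ∷ _) = a ∷ r

infix 4 _≈_
_≈_ : Poly → Poly → Set
f ≈ g = norm f ≡ norm g

coeff : Poly → ℕ → ℤ
coeff [] _ = 0ℤ
coeff (a ∷ _) zero = a
coeff (_ ∷ as) (suc i) = coeff as i

-- degree (degree of the zero polynomial is taken to be 0)
deg : Poly → ℕ
deg f = length (norm f) ∸ 1

-- leading coefficient (0 for the zero polynomial)
lead : Poly → ℤ
lead f = coeff f (deg f)

Monic : Poly → Set
Monic f = lead f ≡ 1ℤ

infixl 6 _+ₚ_ _-ₚ_
infixl 7 _*ₚ_

_+ₚ_ : Poly → Poly → Poly
[] +ₚ g = g
(a ∷ f) +ₚ [] = a ∷ f
(a ∷ f) +ₚ (b ∷ g) = (a ℤ.+ b) ∷ (f +ₚ g)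

negₚ : Poly → Poly
negₚ = map (λ a → ℤ.- a)

_-ₚ_ : Poly → Poly → Poly
f -ₚ g = f +ₚ negₚ g

_*ₚ_ : Poly → Poly → Poly
[] *ₚ g = []
(a ∷ f) *ₚ g = map (a ℤ.*_) g +ₚ (0ℤ ∷ (f *ₚ g))

oneₚ : Poly
oneₚ = 1ℤ ∷ []

X : Poly
X = 0ℤ ∷ 1ℤ ∷ []

prodₚ : List Poly → Poly
prodₚ = foldr _*ₚ_ oneₚ

Xpow : ℕ → Poly
Xpow zero = oneₚ
Xpow (suc n) = 0ℤ ∷ Xpow n

infix 4 _∣ₚ_
_∣ₚ_ : Poly → Poly → Set
q ∣ₚ p = Σ Poly (λ r → p ≈ q *ₚ r)

IsUnit : Poly → Set
IsUnit a = (a ≈ oneₚ) ⊎ (a ≈ (-1ℤ ∷ []))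

Irreducible : Poly → Set
Irreducible q = ¬ (q ≈ []) × ¬ IsUnit q ×
  (∀ a b → q ≈ a *ₚ b → IsUnit a ⊎ IsUnit b)

private
  subPrefix : List ℤ → List ℤ → List ℤ
  subPrefix [] ys = ys
  subPrefix (x ∷ xs) [] = ℤ.- x ∷ subPrefix xs []
  subPrefix (x ∷ xs) (y ∷ ys) = (y ℤ.- x) ∷ subPrefix xs ys

  -- gs: divisor coefficients (highest first) without the leading 1;
  -- r: current dividend (highest first); result: quotient (highest first)
  longDiv : List ℤ → ℕ → List ℤ → List ℤ
  longDiv gs zero r = []
  longDiv gs (suc k) [] = []
  longDiv gs (suc k) (c ∷ r) = c ∷ longDiv gs k (subPrefix (map (c ℤ.*_) gs) r)

-- quotient of f by a monic g (meaningful when g is monic)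
divMonic : Poly → Poly → Poly
divMonic f g with reverse (norm g)
... | [] = []
... | _ ∷ gs = reverse (longDiv gs (length fr ∸ length gs) fr)
  where fr = reverse (norm f)

-- Cyclotomic polynomials, via x^n - 1 = ∏_{d ∣ n} Φ_d, i.e.
-- Φ_n = (x^n - 1) / ∏_{d ∣ n, d < n} Φ_d   (n ≥ 1).

-- cycloList k = [Φ_1, …, Φ_k]
cycloList : ℕ → List Poly
cycloList zero = []
cycloList (suc k) = prev ++ (divMonic (Xpow (suc k) -ₚ oneₚ) (prodₚ (divisorsΦ prev)) ∷ [])
  where
  prev = cycloList k
  divisorsΦ : List Poly → List Poly
  divisorsΦ ps = go 1 ps
    where
    go : ℕ → List Poly → List Poly
    go d [] = []
    go d (p ∷ ps) = if does (d ∣? suc k) then p ∷ go (suc d) ps else go (suc d) ps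

-- Φ n = n-th cyclotomic polynomial (n ≥ 1); Φ 0 = 1 is an unused dummy
Φ : ℕ → Poly
Φ zero = oneₚ
Φ (suc k) = last (cycloList (suc k))
  where
  last : List Poly → Poly
  last [] = oneₚ
  last (p ∷ []) = p
  last (_ ∷ q ∷ ps) = last (q ∷ ps)

Fib : ℕ → Poly
Fib zero = []
Fib (suc zero) = oneₚ
Fib (suc (suc n)) = X *ₚ Fib (suc n) +ₚ Fib n

-- P is the n-th fibotomic polynomial: P is monic and is the product of the
-- monic irreducible factors of F_n that divide no F_k with 1 ≤ k < n
-- (each such factor occurring exactly once).
IsFibotomic : ℕ → Poly → Set
IsFibotomic n P = Monic P ×
  (∀ q → Monic q → Irreducible q →
     (q ∣ₚ P → (q ∣ₚ Fib n) × (∀ k → 1 ℕ.≤ k → k ℕ.< n → ¬ (q ∣ₚ Fib k))) ×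
     ((q ∣ₚ Fib n) → (∀ k → 1 ℕ.≤ k → k ℕ.< n → ¬ (q ∣ₚ Fib k)) → q ∣ₚ P) ×
     ¬ (q *ₚ q ∣ₚ P))

det : (n : ℕ) → (Fin n → Fin n → ℤ) → ℤ
det zero M = 1ℤ
det (suc n) M = go (suc n) λ j → j
  where
  sign : ℕ → ℤ
  sign zero = 1ℤ
  sign (suc k) = ℤ.- sign k
  term : Fin (suc n) → ℤ
  term j = sign (toℕ j) ℤ.* M fzero j ℤ.* det n (λ r c → M (fsuc r) (punchIn j c))
  go : (k : ℕ) → (Fin k → Fin (suc n)) → ℤ
  go zero _ = 0ℤ
  go (suc k) js = term (js fzero) ℤ.+ go k (λ i → js (fsuc i))

-- Sylvester matrix of f (degree p) and g (degree q): (p+q)×(p+q);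
-- rows 0..q-1 hold shifted coefficients of f (highest first),
-- rows q..q+p-1 hold shifted coefficients of g.
-- entry in column j of a row holding the coefficients of h (degree d),
-- highest first, shifted right by s places
rowEntry : Poly → ℕ → ℕ → ℕ → ℤ
rowEntry h d s j =
  if does (s ≤? j) then (if does ((j ∸ s) ≤? d) then coeff h (d ∸ (j ∸ s)) else 0ℤ) else 0ℤ

sylvester : Poly → Poly → (i j : ℕ) → ℤ
sylvester f g i j with i ℕ.<? deg g
... | yes _ = rowEntry f (deg f) i j
... | no _ = rowEntry g (deg g) (i ∸ deg g) j

res : Poly → Poly → ℤ
res f g = det (deg f ℕ.+ deg g) (λ i j → sylvester f g (toℕ i) (toℕ j))

{-# OPTIONS --safe #-}

-- Both families are the new factors Ψₙ = Uₙ / ∏_{d ∣ n, d < n} Ψ_d of a Lucas sequence U₀ = 0, U₁ = 1,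
-- Uₙ₊₂ = P Uₙ₊₁ − Q Uₙ in ℤ[x]: the Fibonacci polynomials have (P, Q) = (x, −1), and (xⁿ − 1)/(x − 1) has
-- (P, Q) = (x + 1, x). For monic f, res(f, g) is the norm of g in ℤ[x]/(f), hence multiplicative in g. Modulo Ψ_m,
-- the addition formula gives Uₙ ≡ U_{m+1}^⌊n/m⌋ U_{n mod m} and U_{km}/U_m ≡ k U_{m+1}^{k−1}, and moreover
-- U_{m+1} ≡ −Q U_{m−1}, where −Q has norm 1 in both cases. Together with the symmetry of the resultant these
-- congruences determine res(Ψ_m, Ψₙ) by induction on n, by the same recursion for both sequences. That the
-- quotients Ψₙ exist follows from the same congruences, since they make the Ψ_d pairwise coprime over ℚ; and a
-- fibotomic polynomial in the sense of the definition equals Ψₙ since both are squarefree with the same monic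
-- irreducible factors.
module Submission where

open import Defs
open import Algebra using (CommutativeRing)
open import Data.Bool using (Bool; true; false; if_then_else_; _∧_; not)
open import Data.Empty using (⊥-elim)
open import Data.Fin using (Fin; toℕ; punchIn) renaming (zero to fzero; suc to fsuc)
import Data.Fin.Properties as Fin
open import Data.Integer using (ℤ; -[1+_]; 0ℤ; 1ℤ; -1ℤ; _+_; _*_; -_; _-_)
import Data.Integer as ℤ
import Data.Integer.Divisibility.Signed as ℤ∣
import Data.Integer.Properties as ℤ
open import Data.Integer.Tactic.RingSolver using (solve-∀)
open import Data.List using (List; []; _∷_; map; foldr; _++_; length; downFrom; tabulate; applyUpTo; reverse; _∷ʳ_; initLast; _∷ʳ′_)
import Data.List.Properties as List
open import Data.List.Properties using (length-map; map-++; map-∘; length-downFrom; ++-identityʳ)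
open import Data.List.Relation.Binary.Pointwise as Pointwise using (Pointwise; []; _∷_)
open import Data.List.Relation.Unary.All as All using (All; []; _∷_)
import Data.List.Relation.Unary.All.Properties as All
open import Data.Maybe using (Maybe; just; nothing)
open import Data.Nat using (_≤_; _<_)
open import Data.Nat as ℕ using (ℕ; zero; suc; z≤n; s≤s)
open import Data.Nat.Divisibility as ℕ∣ using (_∣_; _∣?_; divides)
open import Data.Nat.DivMod using (_%_; _/_; m≡m%n+[m/n]*n; m%n<n)
open import Data.Nat.ListAction using () renaming (product to listProduct)
open import Data.Nat.Primality as Primality using (Prime)
open import Data.Nat.Primality.Factorisation using (factorise)
import Data.Nat.Properties as ℕ
open import Data.Product using (Σ; _×_; _,_; proj₁; proj₂)
open import Data.Sum as Sum using (_⊎_; inj₁; inj₂)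
open import Function using (_∘_; id)
open import Level using (0ℓ)
open import Relation.Binary using (Setoid)
open import Relation.Binary.Definitions using (tri<; tri≈; tri>)
open import Relation.Binary.PropositionalEquality
import Relation.Binary.Reasoning.Setoid as SetoidReasoning
open import Relation.Nullary using (Dec; ¬_; yes; no; does)
open import Relation.Nullary.Decidable using (dec-true; dec-false; _⊎-dec_; decidable-stable)
open import Tactic.Cong using (cong!)
import Tactic.RingSolver as Ring
open import Tactic.RingSolver.Core.AlmostCommutativeRing using (AlmostCommutativeRing; fromCommutativeRing)

-- The ring of polynomials

-- There are no roots in ℤ[x] to take products over, so the resultant is treated as the determinant
-- of multiplication modulo a monic polynomial, and determinants as alternating forms whose rows are
-- polynomials. The norm of a new factor is isolated only by cancelling the norms of the old ones.
-- This requires those norms to be nonzero, which is why coprimality is proved alongside existence.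
-- The recursion closes because `U (m+1)`, whose factors may have index above m, is traded for
-- `U (m-1)`, all of whose factors have index below m. The index 1 is exceptional: the Lucas factor
-- there is 1, whereas the cyclotomic polynomial is x - 1, and this is where the bound 2 ≤ m enters.
-- Irreducible factors are found only up to double negation; that is harmless, since the goal is an
-- equality of integers.

infix 4 _≋_
record _≋_ (f g : Poly) : Set where
  constructor mk≋
  field at : ∀ i → coeff f i ≡ coeff g i
open _≋_ public

≋-refl : ∀ {f} → f ≋ f
≋-refl .at i = refl

≋-reflexive : ∀ {f g} → f ≡ g → f ≋ g
≋-reflexive refl = ≋-refl

≋-sym : ∀ {f g} → f ≋ g → g ≋ f
≋-sym p .at i = sym (p .at i)

≋-trans : ∀ {f g h} → f ≋ g → g ≋ h → f ≋ h
≋-trans p q .at i = trans (p .at i) (q .at i)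

infixr 7 _•_
_•_ : ℤ → Poly → Poly
c • f = map (c *_) f

coeff-+ : ∀ f g i → coeff (f +ₚ g) i ≡ coeff f i + coeff g i
coeff-+ [] g i = sym (ℤ.+-identityˡ _)
coeff-+ (a ∷ f) [] i = sym (ℤ.+-identityʳ _)
coeff-+ (a ∷ f) (b ∷ g) zero = refl
coeff-+ (a ∷ f) (b ∷ g) (suc i) = coeff-+ f g i

coeff-• : ∀ c f i → coeff (c • f) i ≡ c * coeff f i
coeff-• c [] i = sym (ℤ.*-zeroʳ c)
coeff-• c (a ∷ f) zero = refl
coeff-• c (a ∷ f) (suc i) = coeff-• c f i

coeff-neg : ∀ f i → coeff (negₚ f) i ≡ - coeff f i
coeff-neg [] i = refl
coeff-neg (a ∷ f) zero = refl
coeff-neg (a ∷ f) (suc i) = coeff-neg f i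

coeff-- : ∀ f g i → coeff (f -ₚ g) i ≡ coeff f i - coeff g i
coeff-- f g i = trans (coeff-+ f (negₚ g) i) (cong (coeff f i +_) (coeff-neg g i))

∷-cong : ∀ {a b f g} → a ≡ b → f ≋ g → a ∷ f ≋ b ∷ g
∷-cong p q .at zero = p
∷-cong p q .at (suc i) = q .at i

≋-tail : ∀ {a b f g} → a ∷ f ≋ b ∷ g → f ≋ g
≋-tail p .at i = p .at (suc i)

0∷[] : 0ℤ ∷ [] ≋ []
0∷[] .at zero = refl
0∷[] .at (suc i) = refl

+-cong : ∀ {f f′ g g′} → f ≋ f′ → g ≋ g′ → f +ₚ g ≋ f′ +ₚ g′
+-cong {f} {f′} {g} {g′} p q .at i = begin
  coeff (f +ₚ g) i ≡⟨ coeff-+ f g i ⟩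
  coeff f i + coeff g i ≡⟨ cong₂ _+_ (p .at i) (q .at i) ⟩
  coeff f′ i + coeff g′ i ≡⟨ coeff-+ f′ g′ i ⟨
  coeff (f′ +ₚ g′) i ∎
  where open ≡-Reasoning

•-cong : ∀ {c d f g} → c ≡ d → f ≋ g → c • f ≋ d • g
•-cong {c} {d} {f} {g} p q .at i =
  trans (coeff-• c f i) (trans (cong₂ _*_ p (q .at i)) (sym (coeff-• d g i)))

neg-cong : ∀ {f g} → f ≋ g → negₚ f ≋ negₚ g
neg-cong {f} {g} p .at i =
  trans (coeff-neg f i) (trans (cong -_ (p .at i)) (sym (coeff-neg g i)))

+-assoc : ∀ f g h → (f +ₚ g) +ₚ h ≋ f +ₚ (g +ₚ h)
+-assoc f g h .at i rewrite coeff-+ (f +ₚ g) h i | coeff-+ f g i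
  | coeff-+ f (g +ₚ h) i | coeff-+ g h i = ℤ.+-assoc (coeff f i) (coeff g i) (coeff h i)

+-comm : ∀ f g → f +ₚ g ≋ g +ₚ f
+-comm f g .at i rewrite coeff-+ f g i | coeff-+ g f i = ℤ.+-comm (coeff f i) (coeff g i)

+-identityʳ : ∀ f → f +ₚ [] ≋ f
+-identityʳ f .at i = trans (coeff-+ f [] i) (ℤ.+-identityʳ _)

neg-inverseʳ : ∀ f → f +ₚ negₚ f ≋ []
neg-inverseʳ f .at i = trans (coeff-- f f i) (ℤ.+-inverseʳ (coeff f i))

≋-setoid : Setoid 0ℓ 0ℓ
≋-setoid = record
  { Carrier = Poly ; _≈_ = _≋_
  ; isEquivalence = record { refl = ≋-refl ; sym = ≋-sym ; trans = ≋-trans } }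

module ≋-Reasoning = SetoidReasoning ≋-setoid

+-swap : ∀ f g h → f +ₚ (g +ₚ h) ≋ g +ₚ (f +ₚ h)
+-swap f g h .at i rewrite coeff-+ f (g +ₚ h) i | coeff-+ g h i
  | coeff-+ g (f +ₚ h) i | coeff-+ f h i = lem (coeff f i) (coeff g i) (coeff h i)
  where
  lem : ∀ x y z → x + (y + z) ≡ y + (x + z)
  lem = solve-∀

+-interchange : ∀ e f g h → (e +ₚ f) +ₚ (g +ₚ h) ≋ (e +ₚ g) +ₚ (f +ₚ h)
+-interchange e f g h .at i
  rewrite coeff-+ (e +ₚ f) (g +ₚ h) i | coeff-+ e f i | coeff-+ g h i
  | coeff-+ (e +ₚ g) (f +ₚ h) i | coeff-+ e g i | coeff-+ f h i =
  lem (coeff e i) (coeff f i) (coeff g i) (coeff h i)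
  where
  lem : ∀ w x y z → (w + x) + (y + z) ≡ (w + y) + (x + z)
  lem = solve-∀

•-distribˡ : ∀ c f g → c • (f +ₚ g) ≋ c • f +ₚ c • g
•-distribˡ c f g .at i rewrite coeff-• c (f +ₚ g) i | coeff-+ f g i
  | coeff-+ (c • f) (c • g) i | coeff-• c f i | coeff-• c g i =
  ℤ.*-distribˡ-+ c (coeff f i) (coeff g i)

•-assoc : ∀ c d f → (c * d) • f ≋ c • d • f
•-assoc c d f .at i rewrite coeff-• (c * d) f i
  | coeff-• c (d • f) i | coeff-• d f i = ℤ.*-assoc c d (coeff f i)

0• : ∀ f → 0ℤ • f ≋ []
0• f .at i = coeff-• 0ℤ f i

1• : ∀ f → 1ℤ • f ≋ f
1• f .at i = trans (coeff-• 1ℤ f i) (ℤ.*-identityˡ _)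

•-shift : ∀ c f → c • (0ℤ ∷ f) ≋ 0ℤ ∷ c • f
•-shift c f = ∷-cong (ℤ.*-zeroʳ c) ≋-refl

*-congʳ : ∀ f {g g′} → g ≋ g′ → f *ₚ g ≋ f *ₚ g′
*-congʳ [] p = ≋-refl
*-congʳ (a ∷ f) p = +-cong (•-cong {c = a} refl p) (∷-cong refl (*-congʳ f p))

*-zeroˡ : ∀ {f} g → f ≋ [] → f *ₚ g ≋ []
*-zeroˡ {[]} g p = ≋-refl
*-zeroˡ {a ∷ f} g p =
  ≋-trans (+-cong (≋-trans (•-cong {c = a} {f = g} (p .at 0) ≋-refl) (0• g)) (∷-cong refl (*-zeroˡ {f} g (mk≋ λ i → p .at (suc i)))))
    0∷[]

*-congˡ : ∀ {f f′} g → f ≋ f′ → f *ₚ g ≋ f′ *ₚ g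
*-congˡ {[]} {f′} g p = ≋-sym (*-zeroˡ {f′} g (≋-sym p))
*-congˡ {a ∷ f} {[]} g p = *-zeroˡ {a ∷ f} g p
*-congˡ {a ∷ f} {b ∷ f′} g p =
  +-cong (•-cong {c = a} {f = g} (p .at 0) ≋-refl) (∷-cong refl (*-congˡ g (≋-tail p)))

*-cong : ∀ {f f′ g g′} → f ≋ f′ → g ≋ g′ → f *ₚ g ≋ f′ *ₚ g′
*-cong {f′ = f′} {g} p q = ≋-trans (*-congˡ g p) (*-congʳ f′ q)

*-zeroʳ : ∀ f → f *ₚ [] ≋ []
*-zeroʳ [] = ≋-refl
*-zeroʳ (a ∷ f) = ≋-trans (∷-cong refl (*-zeroʳ f)) 0∷[]

*-∷ʳ : ∀ f b g → f *ₚ (b ∷ g) ≋ b • f +ₚ (0ℤ ∷ f *ₚ g)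
*-∷ʳ [] b g = ≋-sym 0∷[]
*-∷ʳ (a ∷ f) b g = ∷-cong (cong (_+ 0ℤ) (ℤ.*-comm a b))
  (≋-trans (+-cong (≋-refl {a • g}) (*-∷ʳ f b g)) (+-swap (a • g) (b • f) (0ℤ ∷ f *ₚ g)))

*-comm : ∀ f g → f *ₚ g ≋ g *ₚ f
*-comm [] g = ≋-sym (*-zeroʳ g)
*-comm (a ∷ f) g =
  ≋-trans (+-cong ≋-refl (∷-cong refl (*-comm f g))) (≋-sym (*-∷ʳ g a f))

*-distribˡ : ∀ f g h → f *ₚ (g +ₚ h) ≋ f *ₚ g +ₚ f *ₚ h
*-distribˡ [] g h = ≋-refl
*-distribˡ (a ∷ f) g h = ≋-trans
  (+-cong (•-distribˡ a g h) (∷-cong refl (*-distribˡ f g h)))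
  (+-interchange (a • g) (a • h) (0ℤ ∷ f *ₚ g) (0ℤ ∷ f *ₚ h))

*-distribʳ : ∀ f g h → (g +ₚ h) *ₚ f ≋ g *ₚ f +ₚ h *ₚ f
*-distribʳ f g h = ≋-trans (*-comm (g +ₚ h) f)
  (≋-trans (*-distribˡ f g h) (+-cong (*-comm f g) (*-comm f h)))

•-*ˡ : ∀ c f g → (c • f) *ₚ g ≋ c • (f *ₚ g)
•-*ˡ c [] g = ≋-refl
•-*ˡ c (a ∷ f) g = ≋-trans
  (+-cong (•-assoc c a g) (≋-trans (∷-cong refl (•-*ˡ c f g)) (≋-sym (•-shift c (f *ₚ g)))))
  (≋-sym (•-distribˡ c (a • g) (0ℤ ∷ f *ₚ g)))

shift-* : ∀ f g → (0ℤ ∷ f) *ₚ g ≋ 0ℤ ∷ f *ₚ g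
shift-* f g = +-cong {g′ = 0ℤ ∷ f *ₚ g} (0• g) ≋-refl

*-assoc : ∀ f g h → (f *ₚ g) *ₚ h ≋ f *ₚ (g *ₚ h)
*-assoc [] g h = ≋-refl
*-assoc (a ∷ f) g h = ≋-trans (*-distribʳ h (a • g) (0ℤ ∷ f *ₚ g))
  (+-cong (•-*ˡ a g h) (≋-trans (shift-* (f *ₚ g) h) (∷-cong refl (*-assoc f g h))))

*-identityˡ : ∀ f → oneₚ *ₚ f ≋ f
*-identityˡ f = ≋-trans (+-cong (1• f) 0∷[]) (+-identityʳ f)

norm-cong : ∀ {f g} → f ≋ g → norm f ≡ norm g
norm-sound : ∀ f → norm f ≋ f
norm-sound [] = ≋-refl
norm-sound (a ∷ f) with norm f | norm-sound f
... | [] | p with a ℤ.≟ 0ℤ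
...   | yes refl = ≋-trans (≋-sym 0∷[]) (∷-cong refl p)
...   | no _ = ∷-cong refl p
norm-sound (a ∷ f) | _ ∷ _ | p = ∷-cong refl p

norm-zero : ∀ f → f ≋ [] → norm f ≡ []
norm-zero [] p = refl
norm-zero (a ∷ f) p with norm f | norm-zero f (mk≋ λ i → p .at (suc i))
... | [] | refl with a ℤ.≟ 0ℤ
...   | yes _ = refl
...   | no a≢0 = ⊥-elim (a≢0 (p .at 0))

norm-cong {[]} {g} p = sym (norm-zero g (≋-sym p))
norm-cong {a ∷ f} {[]} p = norm-zero (a ∷ f) p
norm-cong {a ∷ f} {b ∷ g} p with p .at 0
... | refl with norm f | norm g | norm-cong (≋-tail p)
... | _ | _ | refl = refl

≈⇒≋ : ∀ {f g} → f ≈ g → f ≋ g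
≈⇒≋ {f} {g} p = ≋-trans (≋-sym (norm-sound f)) (subst (_≋ g) (sym p) (norm-sound g))

isZero : ∀ f → Maybe ([] ≋ f)
isZero f with norm f | norm-sound f
... | [] | p = just p
... | _ ∷ _ | _ = nothing

polyRing : CommutativeRing 0ℓ 0ℓ
polyRing = record
  { Carrier = Poly ; _≈_ = _≋_ ; _+_ = _+ₚ_ ; _*_ = _*ₚ_ ; -_ = negₚ ; 0# = [] ; 1# = oneₚ
  ; isCommutativeRing = record
    { isRing = record
      { +-isAbelianGroup = record
        { isGroup = record
          { isMonoid = record
            { isSemigroup = record
              { isMagma = record
                { isEquivalence = record { refl = ≋-refl ; sym = ≋-sym ; trans = ≋-trans }
                ; ∙-cong = +-cong }
              ; assoc = +-assoc }
            ; identity = (λ _ → ≋-refl) , +-identityʳ }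
          ; inverse = (λ f → ≋-trans (+-comm (negₚ f) f) (neg-inverseʳ f)) , neg-inverseʳ
          ; ⁻¹-cong = neg-cong }
        ; comm = +-comm }
      ; *-cong = *-cong
      ; *-assoc = *-assoc
      ; *-identity = *-identityˡ , (λ f → ≋-trans (*-comm f oneₚ) (*-identityˡ f))
      ; distrib = *-distribˡ , *-distribʳ }
    ; *-comm = *-comm } }

polyACR : AlmostCommutativeRing 0ℓ 0ℓ
polyACR = fromCommutativeRing polyRing isZero

-- Alternating forms and determinants

-- Contraction of φ with a, so that Det below is the expansion along the first column. The same operator over the
-- list of columns is the expansion along the first row.
∂ : {A : Set} → (A → ℤ) → (List A → ℤ) → List A → ℤ
∂ a φ [] = 0ℤ
∂ a φ (r ∷ rs) = a r * φ rs - ∂ a (λ t → φ (r ∷ t)) rs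

∂-cong-on : {A : Set} (P : A → Set) (a : A → ℤ) {φ ψ : List A → ℤ} (rs : List A) →
  (∀ t → All P t → suc (length t) ≡ length rs → φ t ≡ ψ t) → All P rs → ∂ a φ rs ≡ ∂ a ψ rs
∂-cong-on P a [] h [] = refl
∂-cong-on P a (r ∷ rs) h (p ∷ ps) = cong₂ (λ x y → a r * x - y) (h rs ps refl)
  (∂-cong-on P a rs (λ t q e → h (r ∷ t) (p ∷ q) (cong suc e)) ps)

∂-cong : {A : Set} (a : A → ℤ) {φ ψ : List A → ℤ} → (∀ t → φ t ≡ ψ t) → ∀ rs → ∂ a φ rs ≡ ∂ a ψ rs
∂-cong a h [] = refl
∂-cong a h (r ∷ rs) = cong₂ (λ x y → a r * x - y) (h rs) (∂-cong a (λ t → h (r ∷ t)) rs)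

∂-linear : {A : Set} (a : A → ℤ) (c : ℤ) (φ ψ : List A → ℤ) → ∀ rs →
  ∂ a (λ t → c * φ t + ψ t) rs ≡ c * ∂ a φ rs + ∂ a ψ rs
∂-linear a c φ ψ [] = lem c
  where
  lem : ∀ c → 0ℤ ≡ c * 0ℤ + 0ℤ
  lem = solve-∀
∂-linear a c φ ψ (r ∷ rs) = trans
  (cong (λ u → a r * (c * φ rs + ψ rs) - u) (∂-linear a c (λ t → φ (r ∷ t)) (λ t → ψ (r ∷ t)) rs))
  (lem (a r) c (φ rs) (ψ rs) _ _)
  where
  lem : ∀ ar c x y u v → ar * (c * x + y) - (c * u + v) ≡ c * (ar * x - u) + (ar * y - v)
  lem = solve-∀

∂-zero : {A : Set} (a : A → ℤ) {φ : List A → ℤ} → (∀ t → φ t ≡ 0ℤ) → ∀ rs → ∂ a φ rs ≡ 0ℤ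
∂-zero a h [] = refl
∂-zero a h (r ∷ rs) = trans (cong₂ (λ x y → a r * x - y) (h rs) (∂-zero a (λ t → h (r ∷ t)) rs)) (lem (a r))
  where
  lem : ∀ x → x * 0ℤ - 0ℤ ≡ 0ℤ
  lem = solve-∀

∂-vanish : {A : Set} (a : A → ℤ) (φ : List A → ℤ) {rs : List A} → All (λ r → a r ≡ 0ℤ) rs → ∂ a φ rs ≡ 0ℤ
∂-vanish a φ [] = refl
∂-vanish a φ {r ∷ rs} (p ∷ ps) =
  cong₂ _-_ (trans (cong (_* φ rs) p) (ℤ.*-zeroˡ (φ rs))) (∂-vanish a (λ t → φ (r ∷ t)) ps)

-- Deleting a row and deleting a column are independent, so the double sum may be taken in either
-- order. This turns the first-column expansion that defines `Det` into the first-row expansion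
-- `Det-first-row`.
∂-commute : {A B : Set} (a : A → ℤ) (b : B → ℤ) (Φ : List A → List B → ℤ) → ∀ rs cs →
  ∂ a (λ t → ∂ b (Φ t) cs) rs ≡ ∂ b (λ s → ∂ a (λ t → Φ t s) rs) cs
∂-commute a b Φ rs [] = ∂-zero a (λ _ → refl) rs
∂-commute a b Φ rs (c ∷ cs) = trans
  (∂-cong a (λ t → lem₁ (b c * Φ t cs) (∂ b (λ s → Φ t (c ∷ s)) cs)) rs)
  (trans (∂-linear a -1ℤ (λ t → ∂ b (λ s → Φ t (c ∷ s)) cs) (λ t → b c * Φ t cs) rs)
    (trans (cong₂ (λ x y → -1ℤ * x + y) (∂-commute a b (λ t s → Φ t (c ∷ s)) rs cs)
        (trans (∂-cong a (λ t → sym (ℤ.+-identityʳ (b c * Φ t cs))) rs)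
          (trans (∂-linear a (b c) (λ t → Φ t cs) (λ _ → 0ℤ) rs)
            (cong (λ u → b c * ∂ a (λ t → Φ t cs) rs + u) (∂-zero a (λ _ → refl) rs)))))
      (lem₂ (b c * ∂ a (λ t → Φ t cs) rs) _)))
  where
  lem₁ : ∀ x y → x - y ≡ -1ℤ * y + x
  lem₁ = solve-∀
  lem₂ : ∀ x y → -1ℤ * y + (x + 0ℤ) ≡ x - y
  lem₂ = solve-∀

-- The forms live on lists of every length, so that fixing the first row (`alternating-∷`) gives a
-- form of the same kind and inductions over the rows go through. Vanishing is asked for adjacent
-- equal rows; `swap` recovers the sign rule.
record Alternating (φ : List Poly → ℤ) : Set where
  field
    cong≋ : ∀ {rs ss} → Pointwise _≋_ rs ss → φ rs ≡ φ ss
    linear : ∀ as c x y bs → φ (as ++ (c • x +ₚ y) ∷ bs) ≡ c * φ (as ++ x ∷ bs) + φ (as ++ y ∷ bs)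
    repeat : ∀ as x bs → φ (as ++ x ∷ x ∷ bs) ≡ 0ℤ

  head-cong : ∀ {x y} bs → x ≋ y → φ (x ∷ bs) ≡ φ (y ∷ bs)
  head-cong bs p = cong≋ (p ∷ Pointwise.refl ≋-refl)

  zero-row : ∀ as bs → φ (as ++ [] ∷ bs) ≡ 0ℤ
  zero-row as bs = lem _ (linear as 1ℤ [] [] bs)
    where
    lem : ∀ z → z ≡ 1ℤ * z + z → z ≡ 0ℤ
    double : ∀ z → z ≡ 1ℤ * z + z - z
    double = solve-∀
    lem z e = trans (double z) (trans (cong (_- z) (sym e)) (ℤ.+-inverseʳ z))

  swap : ∀ x y bs → φ (x ∷ y ∷ bs) ≡ - φ (y ∷ x ∷ bs)
  swap x y bs = lem (φ (x ∷ x ∷ bs)) (φ (x ∷ y ∷ bs)) (φ (y ∷ x ∷ bs)) (φ (y ∷ y ∷ bs))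
    (repeat [] x bs) (repeat [] y bs)
    (trans (sym (trans (linear [] 1ℤ x y (s ∷ bs)) (cong₂ (λ u v → 1ℤ * u + v) (linear (x ∷ []) 1ℤ x y bs) (linear (y ∷ []) 1ℤ x y bs))))
      (repeat [] s bs))
    where
    s = 1ℤ • x +ₚ y
    id₁ : ∀ xx xy yx yy → xy ≡ (1ℤ * (1ℤ * xx + xy) + (1ℤ * yx + yy)) - xx - yy - yx
    id₁ = solve-∀
    id₂ : ∀ yx → 0ℤ - 0ℤ - 0ℤ - yx ≡ - yx
    id₂ = solve-∀
    lem : ∀ xx xy yx yy → xx ≡ 0ℤ → yy ≡ 0ℤ → 1ℤ * (1ℤ * xx + xy) + (1ℤ * yx + yy) ≡ 0ℤ → xy ≡ - yx
    lem xx xy yx yy p q r = trans (id₁ xx xy yx yy)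
      (trans (cong₂ (λ u v → u - v - yy - yx) r p) (trans (cong (λ u → 0ℤ - 0ℤ - u - yx) q) (id₂ yx)))

open Alternating

alternating-∷ : ∀ {φ} → Alternating φ → ∀ e → Alternating (λ t → φ (e ∷ t))
alternating-∷ A e .cong≋ p = cong≋ A (≋-refl ∷ p)
alternating-∷ A e .linear as = linear A (e ∷ as)
alternating-∷ A e .repeat as = repeat A (e ∷ as)

record Linear (a : Poly → ℤ) : Set where
  field
    congᵃ : ∀ {x y} → x ≋ y → a x ≡ a y
    linearᵃ : ∀ c x y → a (c • x +ₚ y) ≡ c * a x + a y

open Linear

coeff-linear : ∀ n → Linear (λ f → coeff f n)
coeff-linear n .congᵃ p = p .at n
coeff-linear n .linearᵃ c x y = trans (coeff-+ (c • x) y n) (cong (_+ coeff y n) (coeff-• c x n))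

-- In the `repeat` case the two terms that delete one of the equal rows cancel, and every other term
-- keeps both rows, still adjacent.
∂-alternating : ∀ {a φ} → Linear a → Alternating φ → Alternating (∂ a φ)
∂-alternating L A .cong≋ [] = refl
∂-alternating L A .cong≋ {r ∷ rs} {s ∷ ss} (p ∷ ps) = cong₂ _-_ (cong₂ _*_ (congᵃ L p) (cong≋ A ps))
  (trans (∂-alternating L (alternating-∷ A r) .cong≋ ps) (∂-cong _ (λ t → head-cong A t p) ss))
∂-alternating {a} {φ} L A .linear [] c x y bs = trans
  (cong₂ (λ u v → u * φ bs - v) (linearᵃ L c x y)
    (trans (∂-cong a (λ t → linear A [] c x y t) bs) (∂-linear a c (λ t → φ (x ∷ t)) (λ t → φ (y ∷ t)) bs)))
  (lem c (a x) (a y) (φ bs) _ _)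
  where
  lem : ∀ c ax ay b u v → (c * ax + ay) * b - (c * u + v) ≡ c * (ax * b - u) + (ay * b - v)
  lem = solve-∀
∂-alternating {a} {φ} L A .linear (r ∷ as) c x y bs = trans
  (cong₂ (λ u v → a r * u - v) (linear A as c x y bs) (∂-alternating L (alternating-∷ A r) .linear as c x y bs))
  (lem c (a r) (φ (as ++ x ∷ bs)) (φ (as ++ y ∷ bs)) _ _)
  where
  lem : ∀ c ar p q u v → ar * (c * p + q) - (c * u + v) ≡ c * (ar * p - u) + (ar * q - v)
  lem = solve-∀
∂-alternating {a} {φ} L A .repeat [] x bs = trans
  (cong (λ u → a x * φ (x ∷ bs) - (a x * φ (x ∷ bs) - u)) (∂-zero a (repeat A [] x) bs))
  (lem (a x * φ (x ∷ bs)))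
  where
  lem : ∀ u → u - (u - 0ℤ) ≡ 0ℤ
  lem = solve-∀
∂-alternating {a} {φ} L A .repeat (r ∷ as) x bs = trans
  (cong₂ (λ u v → a r * u - v) (repeat A as x bs) (∂-alternating L (alternating-∷ A r) .repeat as x bs))
  (lem (a r))
  where
  lem : ∀ u → u * 0ℤ - 0ℤ ≡ 0ℤ
  lem = solve-∀

-- The columns are exponents and the rows polynomials, so a minor merely shortens the two lists.
-- Lists of different lengths give 0, which keeps `Det cs` alternating in every length.
Det : List ℕ → List Poly → ℤ
Det [] [] = 1ℤ
Det [] (_ ∷ _) = 0ℤ
Det (c ∷ cs) = ∂ (λ r → coeff r c) (Det cs)

Det-alternating : ∀ cs → Alternating (Det cs)
Det-alternating [] .cong≋ [] = refl
Det-alternating [] .cong≋ (_ ∷ _) = refl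
Det-alternating [] .linear [] c x y bs = lem c
  where
  lem : ∀ c → 0ℤ ≡ c * 0ℤ + 0ℤ
  lem = solve-∀
Det-alternating [] .linear (_ ∷ _) c x y bs = lem c
  where
  lem : ∀ c → 0ℤ ≡ c * 0ℤ + 0ℤ
  lem = solve-∀
Det-alternating [] .repeat [] x bs = refl
Det-alternating [] .repeat (_ ∷ _) x bs = refl
Det-alternating (c ∷ cs) = ∂-alternating (coeff-linear c) (Det-alternating cs)

Det-first-row : ∀ cs r rs → Det cs (r ∷ rs) ≡ ∂ (coeff r) (λ s → Det s rs) cs
Det-first-row [] r rs = refl
Det-first-row (c ∷ cs) r rs = cong (λ u → coeff r c * Det cs rs - u)
  (trans (∂-cong (λ f → coeff f c) (λ t → Det-first-row cs r t) rs)
    (∂-commute (λ f → coeff f c) (coeff r) (λ t s → Det s t) rs cs))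

subtract-add : ∀ h f → h ≋ f +ₚ (h -ₚ f)
subtract-add h f .at i = trans (lem (coeff h i) (coeff f i))
  (trans (cong (λ u → coeff f i + u) (sym (coeff-- h f i))) (sym (coeff-+ f (h -ₚ f) i)))
  where
  lem : ∀ x y → x ≡ y + (x - y)
  lem = solve-∀

-- Every row h is replaced by h − a(h) e; the terms in which e occurs twice vanish.
expansion : ∀ {φ a} → Alternating φ → Linear a → ∀ e hs →
  φ hs ≡ φ (map (λ h → h -ₚ a h • e) hs) + ∂ a (λ t → φ (e ∷ t)) hs
expansion A L e [] = sym (ℤ.+-identityʳ _)
expansion {φ} {a} A L e (h ∷ hs) = begin
  φ (h ∷ hs) ≡⟨ head-cong A hs (split h) ⟩
  φ (a h • e +ₚ h′ ∷ hs) ≡⟨ linear A [] (a h) e h′ hs ⟩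
  a h * φ (e ∷ hs) + φ (h′ ∷ hs) ≡⟨ cong (λ u → a h * φ (e ∷ hs) + u) (expansion (alternating-∷ A h′) L e hs) ⟩
  a h * φ (e ∷ hs) + (φ (h′ ∷ map reduce hs) + ∂ a (λ t → φ (h′ ∷ e ∷ t)) hs)
    ≡⟨ cong (λ u → a h * φ (e ∷ hs) + (φ (h′ ∷ map reduce hs) + u)) (trans (∂-cong a flip hs)
         (trans (∂-linear a -1ℤ (λ t → φ (e ∷ h ∷ t)) (λ _ → 0ℤ) hs)
           (cong (λ u → -1ℤ * ∂ a (λ t → φ (e ∷ h ∷ t)) hs + u) (∂-zero a (λ _ → refl) hs)))) ⟩
  a h * φ (e ∷ hs) + (φ (h′ ∷ map reduce hs) + (-1ℤ * ∂ a (λ t → φ (e ∷ h ∷ t)) hs + 0ℤ))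
    ≡⟨ lem (a h * φ (e ∷ hs)) (φ (h′ ∷ map reduce hs)) _ ⟩
  φ (h′ ∷ map reduce hs) + (a h * φ (e ∷ hs) - ∂ a (λ t → φ (e ∷ h ∷ t)) hs) ∎
  where
  open ≡-Reasoning
  reduce = λ h → h -ₚ a h • e
  split = λ h → subtract-add h (a h • e)
  h′ = reduce h
  lem : ∀ x y z → x + (y + (-1ℤ * z + 0ℤ)) ≡ y + (x - z)
  lem = solve-∀
  lem₂ : ∀ c x → - x ≡ -1ℤ * (c * 0ℤ + x) + 0ℤ
  lem₂ = solve-∀
  flip : ∀ t → φ (h′ ∷ e ∷ t) ≡ -1ℤ * φ (e ∷ h ∷ t) + 0ℤ
  flip t = trans (swap A h′ e t) (trans (lem₂ (a h) (φ (e ∷ h′ ∷ t)))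
    (cong (λ u → -1ℤ * u + 0ℤ) (sym (trans (cong≋ A (≋-refl ∷ split h ∷ Pointwise.refl ≋-refl))
      (trans (linear A (e ∷ []) (a h) e h′ t) (cong (λ u → a h * u + φ (e ∷ h′ ∷ t)) (repeat A [] e t)))))))

-- With `e` itself a row, each correction term of `expansion` contains `e` twice.
row-operations : ∀ {φ a} → Alternating φ → Linear a → ∀ e hs →
  φ (e ∷ hs) ≡ φ (e ∷ map (λ h → h -ₚ a h • e) hs)
row-operations {φ} {a} A L e hs = trans (expansion (alternating-∷ A e) L e hs)
  (trans (cong (λ u → φ (e ∷ map _ hs) + u) (∂-zero a (λ t → repeat A [] e t) hs)) (ℤ.+-identityʳ _))

Deg< : ℕ → Poly → Set
Deg< n f = ∀ i → n ℕ.≤ i → coeff f i ≡ 0ℤ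

coeff-Xpow-≡ : ∀ n → coeff (Xpow n) n ≡ 1ℤ
coeff-Xpow-≡ zero = refl
coeff-Xpow-≡ (suc n) = coeff-Xpow-≡ n

Deg<-Xpow : ∀ n → Deg< (suc n) (Xpow n)
Deg<-Xpow zero (suc i) (s≤s p) = refl
Deg<-Xpow (suc n) (suc i) (s≤s p) = Deg<-Xpow n i p

Deg<-zero : ∀ {f} → Deg< 0 f → f ≋ []
Deg<-zero p .at i = p i z≤n

coeff-reduce : ∀ h c e i → coeff (h -ₚ c • e) i ≡ coeff h i - c * coeff e i
coeff-reduce h c e i = trans (coeff-- h (c • e) i) (cong (λ u → coeff h i - u) (coeff-• c e i))

cancel-leading : ∀ {e n h} → coeff e n ≡ 1ℤ → coeff (h -ₚ coeff h n • e) n ≡ 0ℤ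
cancel-leading {e} {n} {h} p = trans (coeff-reduce h (coeff h n) e n)
  (trans (cong (λ u → coeff h n - coeff h n * u) p) (lem (coeff h n)))
  where
  lem : ∀ x → x - x * 1ℤ ≡ 0ℤ
  lem = solve-∀

Deg<-reduce : ∀ {e n h} → coeff e n ≡ 1ℤ → Deg< (suc n) e → Deg< (suc n) h → Deg< n (h -ₚ coeff h n • e)
Deg<-reduce {e} {n} {h} p d q i n≤i with ℕ.m≤n⇒m<n∨m≡n n≤i
... | inj₁ n<i = trans (coeff-reduce h (coeff h n) e i)
  (trans (cong₂ (λ u v → u - coeff h n * v) (q i n<i) (d i n<i)) (lem (coeff h n)))
  where
  lem : ∀ x → 0ℤ - x * 0ℤ ≡ 0ℤ
  lem = solve-∀
... | inj₂ refl = cancel-leading {e} {n} {h} p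

coeff-Xpow-< : ∀ n i → i ℕ.< n → coeff (Xpow n) i ≡ 0ℤ
coeff-Xpow-< (suc n) zero _ = refl
coeff-Xpow-< (suc n) (suc i) (s≤s l) = coeff-Xpow-< n i l

-- Induction on the dimension. Expanding by `Xpow n` lowers the degree bound of all rows; a
-- correction term loses one row to `Xpow n`, but the remaining rows can be reduced as well, so it
-- is again overdetermined.
overdetermined : ∀ n {φ} → Alternating φ → ∀ hs → All (Deg< n) hs → n ℕ.< length hs → φ hs ≡ 0ℤ
overdetermined zero A (h ∷ hs) (p ∷ _) _ = trans (head-cong A hs (Deg<-zero p)) (zero-row A [] hs)
overdetermined (suc n) {φ} A hs ps l = trans (expansion A (coeff-linear n) e hs)
  (cong₂ _+_ (vanish A hs ps (ℕ.<-trans (ℕ.n<1+n n) l))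
    (trans (∂-cong-on (Deg< (suc n)) (λ f → coeff f n) {ψ = λ _ → 0ℤ} hs
      (λ t qs q → trans (row-operations A (coeff-linear n) e t)
        (vanish (alternating-∷ A e) t qs (ℕ.s≤s⁻¹ (subst (suc (suc n) ℕ.≤_) (sym q) l)))) ps)
      (∂-zero (λ f → coeff f n) (λ _ → refl) hs)))
  where
  e = Xpow n
  vanish : ∀ {ψ} → Alternating ψ → ∀ t → All (Deg< (suc n)) t → n ℕ.< length t → ψ (map (λ h → h -ₚ coeff h n • e) t) ≡ 0ℤ
  vanish B t qs l = overdetermined n B _
    (All.map⁺ (All.map (λ {h} → Deg<-reduce {e} {n} {h} (coeff-Xpow-≡ n) (Deg<-Xpow n)) qs))
    (subst (n ℕ.<_) (sym (length-map _ t)) l)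

basis : ℕ → List Poly
basis n = map Xpow (downFrom n)

-- Applied to the reduction by `Xpow n`, which changes only the coefficient at `n`, outside the
-- columns of the minor.
Det-lower : ∀ n (f : Poly → Poly) → (∀ h i → i ℕ.< n → coeff (f h) i ≡ coeff h i) →
  ∀ t → Det (downFrom n) (map f t) ≡ Det (downFrom n) t
Det-lower zero f h [] = refl
Det-lower zero f h (_ ∷ _) = refl
Det-lower (suc n) f h = go _ _ (Det-lower n f λ g i l → h g i (ℕ.m<n⇒m<1+n l))
  where
  go : (φ ψ : List Poly → ℤ) → (∀ t → φ (map f t) ≡ ψ t) → ∀ t →
    ∂ (λ r → coeff r n) φ (map f t) ≡ ∂ (λ r → coeff r n) ψ t
  go φ ψ q [] = refl
  go φ ψ q (r ∷ t) = cong₂ _-_ (cong₂ _*_ (h r n (ℕ.n<1+n n)) (q t)) (go _ _ (λ s → q (r ∷ s)) t)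

-- The correction terms of `expansion` by `Xpow n` reproduce the first-column expansion of `Det`,
-- and the form with all rows reduced vanishes because `suc n` rows of degree below `n` are too
-- many. Multiplicativity of the norm rests on this.
alternating-unique : ∀ n {φ} → Alternating φ → ∀ hs → All (Deg< n) hs → length hs ≡ n →
  φ hs ≡ Det (downFrom n) hs * φ (basis n)
alternating-unique zero A [] _ _ = sym (ℤ.*-identityˡ _)
alternating-unique (suc n) {φ} A hs ps l = begin
  φ hs ≡⟨ expansion A (coeff-linear n) e hs ⟩
  φ (map reduce hs) + ∂ (λ f → coeff f n) (λ t → φ (e ∷ t)) hs
    ≡⟨ cong₂ _+_ (overdetermined n A (map reduce hs) (reduced ps) (subst (n ℕ.<_) (sym (trans (length-map reduce hs) l)) (ℕ.n<1+n n)))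
         (∂-cong-on (Deg< (suc n)) (λ f → coeff f n) hs minor ps) ⟩
  0ℤ + ∂ (λ f → coeff f n) (λ t → φ (basis (suc n)) * Det (downFrom n) t + 0ℤ) hs
    ≡⟨ cong (0ℤ +_) (∂-linear (λ f → coeff f n) (φ (basis (suc n))) (Det (downFrom n)) (λ _ → 0ℤ) hs) ⟩
  0ℤ + (φ (basis (suc n)) * Det (downFrom (suc n)) hs + ∂ (λ f → coeff f n) (λ _ → 0ℤ) hs)
    ≡⟨ cong (λ u → 0ℤ + (φ (basis (suc n)) * Det (downFrom (suc n)) hs + u)) (∂-zero (λ f → coeff f n) (λ _ → refl) hs) ⟩
  0ℤ + (φ (basis (suc n)) * Det (downFrom (suc n)) hs + 0ℤ) ≡⟨ lem (φ (basis (suc n))) _ ⟩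
  Det (downFrom (suc n)) hs * φ (basis (suc n)) ∎
  where
  open ≡-Reasoning
  e = Xpow n
  reduce = λ h → h -ₚ coeff h n • e
  lem : ∀ x y → 0ℤ + (x * y + 0ℤ) ≡ y * x
  lem = solve-∀
  lem₂ : ∀ x y → x * y ≡ y * x + 0ℤ
  lem₂ = solve-∀
  lem₃ : ∀ x y → x - y * 0ℤ ≡ x
  lem₃ = solve-∀
  reduced : ∀ {t} → All (Deg< (suc n)) t → All (Deg< n) (map reduce t)
  reduced qs = All.map⁺ (All.map (λ {h} → Deg<-reduce {e} {n} {h} (coeff-Xpow-≡ n) (Deg<-Xpow n)) qs)
  unchanged : ∀ h i → i ℕ.< n → coeff (reduce h) i ≡ coeff h i
  unchanged h i i<n = trans (coeff-reduce h (coeff h n) e i)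
    (trans (cong (λ u → coeff h i - coeff h n * u) (coeff-Xpow-< n i i<n)) (lem₃ (coeff h i) (coeff h n)))
  minor : ∀ t → All (Deg< (suc n)) t → suc (length t) ≡ length hs →
    φ (e ∷ t) ≡ φ (basis (suc n)) * Det (downFrom n) t + 0ℤ
  minor t qs k = trans (row-operations A (coeff-linear n) e t)
    (trans (alternating-unique n (alternating-∷ A e) (map reduce t) (reduced qs)
        (trans (length-map reduce t) (ℕ.suc-injective (trans k l))))
      (trans (cong (_* φ (basis (suc n))) (Det-lower n reduce unchanged t))
        (lem₂ (Det (downFrom n) t) (φ (basis (suc n))))))

-- Row operations clear the top column except for the entry 1 of `e`.
Det-leading : ∀ {e} n hs → coeff e n ≡ 1ℤ →
  Det (downFrom (suc n)) (e ∷ hs) ≡ Det (downFrom n) (map (λ h → h -ₚ coeff h n • e) hs)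
Det-leading {e} n hs p = begin
  Det (downFrom (suc n)) (e ∷ hs) ≡⟨ row-operations (Det-alternating (downFrom (suc n))) (coeff-linear n) e hs ⟩
  coeff e n * Det (downFrom n) (map reduce hs) - ∂ (λ f → coeff f n) (λ t → Det (downFrom n) (e ∷ t)) (map reduce hs)
    ≡⟨ cong₂ (λ u v → u * Det (downFrom n) (map reduce hs) - v) p
         (∂-vanish (λ f → coeff f n) _ (All.map⁺ (All.universal (λ h → cancel-leading {e} {n} {h} p) hs))) ⟩
  1ℤ * Det (downFrom n) (map reduce hs) - 0ℤ ≡⟨ lem _ ⟩
  Det (downFrom n) (map reduce hs) ∎
  where
  open ≡-Reasoning
  reduce = λ h → h -ₚ coeff h n • e
  lem : ∀ x → 1ℤ * x - 0ℤ ≡ x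
  lem = solve-∀

Det-basis : ∀ n → Det (downFrom n) (basis n) ≡ 1ℤ
Det-basis zero = refl
Det-basis (suc n) = trans (cong₂ (λ u v → u * Det (downFrom n) (basis n) - v) (coeff-Xpow-≡ n)
    (∂-vanish (λ f → coeff f n) _ (vanish n ℕ.≤-refl)))
  (trans (cong (λ u → 1ℤ * u - 0ℤ) (Det-basis n)) refl)
  where
  vanish : ∀ k → k ℕ.≤ n → All (λ r → coeff r n ≡ 0ℤ) (basis k)
  vanish zero _ = []
  vanish (suc k) l = Deg<-Xpow k n l ∷ vanish k (ℕ.<⇒≤ l)

scale-rows : ∀ {φ} → Alternating φ → ∀ c hs → φ (map (c •_) hs) ≡ c ℤ.^ length hs * φ hs
scale-rows A c [] = sym (ℤ.*-identityˡ _)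
scale-rows {φ} A c (h ∷ hs) = begin
  φ (c • h ∷ map (c •_) hs) ≡⟨ head-cong A _ (≋-sym (+-identityʳ (c • h))) ⟩
  φ (c • h +ₚ [] ∷ map (c •_) hs) ≡⟨ linear A [] c h [] (map (c •_) hs) ⟩
  c * φ (h ∷ map (c •_) hs) + φ ([] ∷ map (c •_) hs)
    ≡⟨ cong₂ (λ u v → c * u + v) (scale-rows (alternating-∷ A h) c hs) (zero-row A [] (map (c •_) hs)) ⟩
  c * (c ℤ.^ length hs * φ (h ∷ hs)) + 0ℤ ≡⟨ lem c _ _ ⟩
  c * c ℤ.^ length hs * φ (h ∷ hs) ∎
  where
  open ≡-Reasoning
  lem : ∀ c x y → c * (x * y) + 0ℤ ≡ c * x * y
  lem = solve-∀

move-row : ∀ {φ} → Alternating φ → ∀ x ys zs → φ (x ∷ ys ++ zs) ≡ -1ℤ ℤ.^ length ys * φ (ys ++ x ∷ zs)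
move-row A x [] zs = sym (ℤ.*-identityˡ _)
move-row {φ} A x (y ∷ ys) zs = trans (swap A x y (ys ++ zs))
  (trans (cong -_ (move-row (alternating-∷ A y) x ys zs)) (lem (-1ℤ ℤ.^ length ys) _))
  where
  lem : ∀ x y → - (x * y) ≡ -1ℤ * x * y
  lem = solve-∀

swap-blocks : ∀ {φ} → Alternating φ → ∀ xs ys →
  φ (xs ++ ys) ≡ -1ℤ ℤ.^ (length xs ℕ.* length ys) * φ (ys ++ xs)
swap-blocks {φ} A [] ys = trans (cong φ (sym (++-identityʳ ys))) (sym (ℤ.*-identityˡ _))
swap-blocks {φ} A (x ∷ xs) ys = begin
  φ (x ∷ xs ++ ys) ≡⟨ swap-blocks (alternating-∷ A x) xs ys ⟩
  -1ℤ ℤ.^ (length xs ℕ.* length ys) * φ (x ∷ ys ++ xs)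
    ≡⟨ cong (-1ℤ ℤ.^ (length xs ℕ.* length ys) *_) (move-row A x ys xs) ⟩
  -1ℤ ℤ.^ (length xs ℕ.* length ys) * (-1ℤ ℤ.^ length ys * φ (ys ++ x ∷ xs))
    ≡⟨ lem (-1ℤ ℤ.^ (length xs ℕ.* length ys)) (-1ℤ ℤ.^ length ys) (φ (ys ++ x ∷ xs)) ⟩
  -1ℤ ℤ.^ length ys * -1ℤ ℤ.^ (length xs ℕ.* length ys) * φ (ys ++ x ∷ xs)
    ≡⟨ cong (_* φ (ys ++ x ∷ xs)) (ℤ.^-distribˡ-+-* -1ℤ (length ys) (length xs ℕ.* length ys)) ⟨
  -1ℤ ℤ.^ (length ys ℕ.+ length xs ℕ.* length ys) * φ (ys ++ x ∷ xs) ∎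
  where
  open ≡-Reasoning
  lem : ∀ x y z → x * (y * z) ≡ y * x * z
  lem = solve-∀

-- The first-row expansion of `det`

reveal : {A : Set} → A → ℕ → A
reveal x _ = x

Matrix : ℕ → Set
Matrix n = Fin n → Fin n → ℤ

minor : ∀ {n} → Matrix (suc n) → Fin (suc n) → Matrix n
minor M j r c = M (fsuc r) (punchIn j c)

prepend : ∀ {n m} → (Fin n → Fin (suc m)) → Fin (suc n) → Fin (suc m)
prepend js fzero = fzero
prepend js (fsuc i) = js i

-- The local functions of det, Φ and divMonic have no names outside Defs; below each is recovered as the solution of
-- a metavariable in an equation in which it occurs. An instance with independent arguments is only available through
-- anti-unification (cong!) of two instances: for go, of one with n and one with suc n remaining columns. The
-- contradictory hypothesis n ≡ suc n keeps cong from reducing, so that its function argument can be read off.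
mutual
  go₀ : (n : ℕ) → Matrix (suc n) → (Fin n → Fin (suc n)) → ℤ
  go₀ = _

  go₀-spec : ∀ n M → det (suc n) M ≡
    1ℤ * M fzero fzero * det n (λ r c → M (fsuc r) (fsuc c)) + go₀ n M fsuc
  go₀-spec n M with (λ (i : Fin n) → fsuc i)
  ... | js = refl

mutual
  go₁ : (n : ℕ) → Matrix (suc (suc n)) → (Fin n → Fin (suc (suc n))) → ℤ
  go₁ = _

  go₁-spec : ∀ n M js → go₀ (suc n) M (prepend js) ≡
    1ℤ * M fzero fzero * det (suc n) (λ r c → M (fsuc r) (fsuc c)) + go₁ n M js
  go₁-spec n M js = refl

module _ (n : ℕ) (M : Matrix (suc (suc n))) (js : ∀ k → Fin k → Fin (suc (suc n))) (eq : n ≡ suc n) where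
  private
    unfold : {A : (n : ℕ) → Matrix (suc n) → (Fin n → Fin (suc n)) → ℤ}
      {B : (n : ℕ) → Matrix (suc (suc n)) → (Fin n → Fin (suc (suc n))) → ℤ} →
      (∀ n M js x → reveal (go₀ n M js) x ≡ A n M js) → (∀ n M js x → reveal (go₁ n M js) x ≡ B n M js) →
      B n M (js n) ≡ A (suc n) M (js (suc n)) → B n M (js n) ≡ A (suc n) M (js (suc n))
    unfold _ _ p = p

  go-cong = unfold (λ _ _ _ _ → refl) (λ _ _ _ _ → refl) (cong! eq)

stuck : {A : Set} {x y : A} → x ≡ y → ℕ
stuck refl = 0

mutual
  go-family : (n : ℕ) (M : Matrix (suc (suc n))) → (∀ k → Fin k → Fin (suc (suc n))) → ℕ → ℤ
  go-family = _

  go-family-spec : ∀ n M js eq → stuck (cong (go-family n M js) eq) ≡ stuck (go-cong n M js eq)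
  go-family-spec n M js eq = refl

mutual
  go : (n : ℕ) (M : Matrix (suc (suc n))) (k : ℕ) → (Fin k → Fin (suc (suc n))) → ℤ
  go = _

  go-spec : ∀ n M js k → go-family n M js k ≡ go n M k (js k)
  go-spec n M js k with js k
  ... | _ = refl

mutual
  det-sign : (n : ℕ) → Matrix (suc (suc n)) → ℕ → ℤ
  det-sign = _

  go-suc : ∀ n M k js → go n M (suc k) js ≡
    det-sign n M (toℕ (js fzero)) * M fzero (js fzero) * det (suc n) (minor M (js fzero)) + go n M k (js ∘ fsuc)
  go-suc n M k js with js fzero
  ... | j with toℕ j | _+_ | ℤ._◃_ | ℤ.∣_∣
  ... | _ | _ | _ | _ = refl

alternate : ℕ → ℤ
alternate zero = 1ℤ
alternate (suc k) = - alternate k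

det-sign≡ : ∀ n M k → det-sign n M k ≡ alternate k
det-sign≡ n M zero = refl
det-sign≡ n M (suc k) = cong -_ (det-sign≡ n M k)

Σᶠ : ∀ k → (Fin k → ℤ) → ℤ
Σᶠ zero t = 0ℤ
Σᶠ (suc k) t = t fzero + Σᶠ k (t ∘ fsuc)

Σᶠ-cong : ∀ k {s t : Fin k → ℤ} → (∀ i → s i ≡ t i) → Σᶠ k s ≡ Σᶠ k t
Σᶠ-cong zero h = refl
Σᶠ-cong (suc k) h = cong₂ _+_ (h fzero) (Σᶠ-cong k (h ∘ fsuc))

Σᶠ-neg : ∀ k (t : Fin k → ℤ) → - Σᶠ k t ≡ Σᶠ k (λ i → - t i)
Σᶠ-neg zero t = refl
Σᶠ-neg (suc k) t = trans (ℤ.neg-distrib-+ (t fzero) _) (cong (λ u → - t fzero + u) (Σᶠ-neg k (t ∘ fsuc)))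

go-sum : ∀ n M k js →
  go n M k js ≡ Σᶠ k (λ i → alternate (toℕ (js i)) * M fzero (js i) * det (suc n) (minor M (js i)))
go-sum n M zero js = refl
go-sum n M (suc k) js = trans (go-suc n M k js)
  (cong₂ (λ s u → s * M fzero (js fzero) * det (suc n) (minor M (js fzero)) + u)
    (det-sign≡ n M (toℕ (js fzero))) (go-sum n M k (js ∘ fsuc)))

det-first-row : ∀ n M →
  det (suc n) M ≡ Σᶠ (suc n) (λ j → alternate (toℕ j) * M fzero j * det n (minor M j))
det-first-row zero M = refl
det-first-row (suc n) M = go-sum n M (suc (suc n)) id

∂-tabulate : {A : Set} (b : A → ℤ) (φ : List A → ℤ) → ∀ n (x : Fin (suc n) → A) →
  ∂ b φ (tabulate x) ≡ Σᶠ (suc n) (λ j → alternate (toℕ j) * b (x j) * φ (tabulate (x ∘ punchIn j)))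
∂-tabulate b φ zero x = lem (b (x fzero)) (φ [])
  where
  lem : ∀ u v → u * v - 0ℤ ≡ 1ℤ * u * v + 0ℤ
  lem = solve-∀
∂-tabulate b φ (suc n) x = cong₂ _+_ (cong (_* φ (tabulate (x ∘ fsuc))) (sym (ℤ.*-identityˡ (b (x fzero)))))
  (trans (cong -_ (∂-tabulate b (λ t → φ (x fzero ∷ t)) n (x ∘ fsuc)))
    (trans (Σᶠ-neg (suc n) (λ j → alternate (toℕ j) * b (x (fsuc j)) * φ (tabulate (x ∘ punchIn (fsuc j)))))
      (Σᶠ-cong (suc n) (λ j → lem (alternate (toℕ j)) (b (x (fsuc j))) (φ (tabulate (x ∘ punchIn (fsuc j))))))))
  where
  lem : ∀ s u v → - (s * u * v) ≡ - s * u * v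
  lem = solve-∀

-- Both sides are expanded along the first row, where the minors correspond to each other and
-- induction applies.
det≡Det : ∀ n M (rows : Fin n → Poly) (cols : Fin n → ℕ) →
  (∀ i j → M i j ≡ coeff (rows i) (cols j)) → det n M ≡ Det (tabulate cols) (tabulate rows)
det≡Det zero M rows cols h = refl
det≡Det (suc n) M rows cols h = begin
  det (suc n) M ≡⟨ det-first-row n M ⟩
  Σᶠ (suc n) (λ j → alternate (toℕ j) * M fzero j * det n (minor M j))
    ≡⟨ Σᶠ-cong (suc n) (λ j → cong₂ (λ u v → alternate (toℕ j) * u * v) (h fzero j)
         (det≡Det n (minor M j) (rows ∘ fsuc) (cols ∘ punchIn j) (λ r c → h (fsuc r) (punchIn j c)))) ⟩
  Σᶠ (suc n) (λ j → alternate (toℕ j) * coeff (rows fzero) (cols j)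
    * Det (tabulate (cols ∘ punchIn j)) (tabulate (rows ∘ fsuc)))
    ≡⟨ ∂-tabulate (coeff (rows fzero)) (λ s → Det s (tabulate (rows ∘ fsuc))) n cols ⟨
  ∂ (coeff (rows fzero)) (λ s → Det s (tabulate (rows ∘ fsuc))) (tabulate cols)
    ≡⟨ Det-first-row (tabulate cols) (rows fzero) (tabulate (rows ∘ fsuc)) ⟨
  Det (tabulate cols) (tabulate rows) ∎
  where open ≡-Reasoning

-- Division by monic polynomials

Deg<-≋ : ∀ {n f g} → f ≋ g → Deg< n f → Deg< n g
Deg<-≋ p d i l = trans (sym (p .at i)) (d i l)

Deg<-mono : ∀ {m n f} → m ℕ.≤ n → Deg< m f → Deg< n f
Deg<-mono l d i k = d i (ℕ.≤-trans l k)

Deg<-combine : ∀ {n f g} c → Deg< n f → Deg< n g → Deg< n (c • f +ₚ g)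
Deg<-combine {f = f} {g} c p q i l = trans (coeff-linear i .linearᵃ c f g)
  (trans (cong₂ (λ u v → c * u + v) (p i l) (q i l)) (lem c))
  where
  lem : ∀ c → c * 0ℤ + 0ℤ ≡ 0ℤ
  lem = solve-∀

-- `Monic` with the degree as an index, phrased by coefficients so that it passes along `_≋_`
-- without computing a normal form.
record MonicOf (p : ℕ) (f : Poly) : Set where
  constructor monicOf
  field
    leading : coeff f p ≡ 1ℤ
    above : Deg< (suc p) f

open MonicOf

monicOf-≋ : ∀ {p f g} → f ≋ g → MonicOf p f → MonicOf p g
monicOf-≋ e m .leading = trans (sym (e .at _)) (m .leading)
monicOf-≋ e m .above = Deg<-≋ e (m .above)

coeff-*-suc : ∀ c q f i → coeff ((c ∷ q) *ₚ f) (suc i) ≡ c * coeff f (suc i) + coeff (q *ₚ f) i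
coeff-*-suc c q f i = trans (coeff-+ (c • f) (0ℤ ∷ q *ₚ f) (suc i))
  (cong (_+ coeff (q *ₚ f) i) (coeff-• c f (suc i)))

coeff-*-0 : ∀ c q f → coeff ((c ∷ q) *ₚ f) 0 ≡ c * coeff f 0
coeff-*-0 c q f = trans (coeff-+ (c • f) (0ℤ ∷ q *ₚ f) 0)
  (trans (ℤ.+-identityʳ _) (coeff-• c f 0))

-- Induction from the constant term upwards. `c` contributes only to positions up to `p`, so the
-- tail satisfies the same hypothesis and is zero; coefficient `p` of the product is then `c` times
-- the nonzero `coeff f p`.
product-small⇒zero : ∀ {p f} → coeff f p ≢ 0ℤ → Deg< (suc p) f → ∀ q → Deg< p (q *ₚ f) → q ≋ []
product-small⇒zero l d [] h = ≋-refl
product-small⇒zero {p} {f} l d (c ∷ q) h = ≋-trans (∷-cong (c≡0 p refl) q≋0) 0∷[]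
  where
  q≋0 : q ≋ []
  q≋0 = product-small⇒zero l d q λ i p≤i → begin
    coeff (q *ₚ f) i ≡⟨ lem c (coeff (q *ₚ f) i) ⟩
    c * 0ℤ + coeff (q *ₚ f) i ≡⟨ cong (λ u → c * u + coeff (q *ₚ f) i) (d (suc i) (s≤s p≤i)) ⟨
    c * coeff f (suc i) + coeff (q *ₚ f) i ≡⟨ coeff-*-suc c q f i ⟨
    coeff ((c ∷ q) *ₚ f) (suc i) ≡⟨ h (suc i) (ℕ.m≤n⇒m≤1+n p≤i) ⟩
    0ℤ ∎
    where
    open ≡-Reasoning
    lem : ∀ x y → y ≡ x * 0ℤ + y
    lem = solve-∀
  at-p : ∀ r → r ≡ p → coeff ((c ∷ q) *ₚ f) r ≡ c * coeff f r
  at-p zero _ = coeff-*-0 c q f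
  at-p (suc r) _ = trans (coeff-*-suc c q f r)
    (trans (cong (c * coeff f (suc r) +_) (*-zeroˡ {q} f q≋0 .at r)) (ℤ.+-identityʳ _))
  c≡0 : ∀ r → r ≡ p → c ≡ 0ℤ
  c≡0 r refl with ℤ.i*j≡0⇒i≡0∨j≡0 c (trans (sym (at-p r refl)) (h r ℕ.≤-refl))
  ... | inj₁ e = e
  ... | inj₂ e = ⊥-elim (l e)

1≢0 : 1ℤ ≢ 0ℤ
1≢0 ()

monic-small⇒zero : ∀ {p f} → MonicOf p f → ∀ q → Deg< p (q *ₚ f) → q ≋ []
monic-small⇒zero {p} m = product-small⇒zero (λ e → 1≢0 (trans (sym (m .leading)) e)) (m .above)

-- Division in the style of Horner, by recursion on the coefficient list: prepending `a` raises the
-- degree of the remainder to at most `p`, and one multiple of `f` brings it down again.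
quotient remainder : ℕ → Poly → Poly → Poly
quotient p f [] = []
quotient p f (a ∷ h) = coeff (a ∷ remainder p f h) p ∷ quotient p f h
remainder p f [] = []
remainder p f (a ∷ h) = (a ∷ remainder p f h) -ₚ coeff (a ∷ remainder p f h) p • f

division : ∀ p f h → h ≋ quotient p f h *ₚ f +ₚ remainder p f h
division p f [] = ≋-refl
division p f (a ∷ h) = ≋-trans (∷-cong (sym (ℤ.+-identityˡ a)) (division p f h))
  (lem (c • f) (0ℤ ∷ quotient p f h *ₚ f) (a ∷ remainder p f h))
  where
  c = coeff (a ∷ remainder p f h) p
  lem : ∀ x y z → y +ₚ z ≋ x +ₚ y +ₚ (z -ₚ x)
  lem = Ring.solve-∀ polyACR

Deg<-remainder : ∀ {p f} → MonicOf p f → ∀ h → Deg< p (remainder p f h)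
Deg<-remainder m [] i _ = refl
Deg<-remainder {p} {f} m (a ∷ h) =
  Deg<-reduce {f} {p} {a ∷ remainder p f h} (m .leading) (m .above) λ { (suc i) (s≤s l) → Deg<-remainder m h i l }

remainder-unique : ∀ {p f h} → MonicOf p f → ∀ q {r} → Deg< p r → h ≋ q *ₚ f +ₚ r → remainder p f h ≋ r
remainder-unique {p} {f} {h} m q {r} d e = begin
  s ≈⟨ lem₁ f q₀ q r s ⟩
  (q₀ *ₚ f +ₚ s) -ₚ (q *ₚ f +ₚ r) -ₚ (q₀ -ₚ q) *ₚ f +ₚ r
    ≈⟨ +-cong (+-cong (+-cong (≋-trans (≋-sym (division p f h)) e) ≋-refl) (neg-cong (*-congˡ f zero-quotient))) ≋-refl ⟩
  (q *ₚ f +ₚ r) -ₚ (q *ₚ f +ₚ r) -ₚ [] *ₚ f +ₚ r ≈⟨ lem₂ f (q *ₚ f +ₚ r) r ⟩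
  r ∎
  where
  open ≋-Reasoning
  q₀ = quotient p f h
  s = remainder p f h
  lem₁ : ∀ f q₀ q r s → s ≋ (q₀ *ₚ f +ₚ s) -ₚ (q *ₚ f +ₚ r) -ₚ (q₀ -ₚ q) *ₚ f +ₚ r
  lem₁ = Ring.solve-∀ polyACR
  lem₂ : ∀ f x r → x -ₚ x -ₚ [] *ₚ f +ₚ r ≋ r
  lem₂ = Ring.solve-∀ polyACR
  lem₃ : ∀ f q₀ q r s → (q₀ *ₚ f +ₚ s) -ₚ (q *ₚ f +ₚ r) +ₚ (r -ₚ s) ≋ (q₀ -ₚ q) *ₚ f
  lem₃ = Ring.solve-∀ polyACR
  lem₄ : ∀ x y → x -ₚ x +ₚ y ≋ y
  lem₄ = Ring.solve-∀ polyACR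
  difference : r -ₚ s ≋ (q₀ -ₚ q) *ₚ f
  difference = ≋-trans (≋-sym (lem₄ (q *ₚ f +ₚ r) (r -ₚ s)))
    (≋-trans (+-cong (+-cong (≋-trans (≋-sym e) (division p f h)) ≋-refl) ≋-refl) (lem₃ f q₀ q r s))
  zero-quotient : q₀ -ₚ q ≋ []
  zero-quotient = monic-small⇒zero m (q₀ -ₚ q) (Deg<-≋ difference λ i l →
    trans (coeff-- r s i) (cong₂ _-_ (d i l) (Deg<-remainder m h i l)))

infix 4 _∣≋_
_∣≋_ : Poly → Poly → Set
f ∣≋ h = Σ Poly λ q → h ≋ q *ₚ f

infix 4 _≡_mod_
_≡_mod_ : Poly → Poly → Poly → Set
g ≡ h mod f = Σ Poly λ q → g ≋ q *ₚ f +ₚ h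

remainder-mod : ∀ {p f g h} → MonicOf p f → g ≡ h mod f → remainder p f g ≋ remainder p f h
remainder-mod {p} {f} {g} {h} m (q , e) = remainder-unique m (q +ₚ quotient p f h) (Deg<-remainder m h)
  (≋-trans e (≋-trans (+-cong ≋-refl (division p f h)) (lem q (quotient p f h) f (remainder p f h))))
  where
  lem : ∀ q q′ f r → q *ₚ f +ₚ (q′ *ₚ f +ₚ r) ≋ (q +ₚ q′) *ₚ f +ₚ r
  lem = Ring.solve-∀ polyACR

mod-reflexive : ∀ {g h} f → g ≋ h → g ≡ h mod f
mod-reflexive f e = [] , e

mod-*ˡ : ∀ {f g h} k → g ≡ h mod f → k *ₚ g ≡ k *ₚ h mod f
mod-*ˡ {f} {g} {h} k (q , e) = k *ₚ q , ≋-trans (*-congʳ k e) (lem k q f h)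
  where
  lem : ∀ k q f h → k *ₚ (q *ₚ f +ₚ h) ≋ k *ₚ q *ₚ f +ₚ k *ₚ h
  lem = Ring.solve-∀ polyACR

remainder-small : ∀ {p f h} → MonicOf p f → Deg< p h → remainder p f h ≋ h
remainder-small m d = remainder-unique m [] d ≋-refl

remainder-linear : ∀ {p f} → MonicOf p f → ∀ c x y →
  remainder p f (c • x +ₚ y) ≋ c • remainder p f x +ₚ remainder p f y
remainder-linear {p} {f} m c x y = remainder-unique m (c • quotient p f x +ₚ quotient p f y)
  (Deg<-combine {f = remainder p f x} {remainder p f y} c (Deg<-remainder m x) (Deg<-remainder m y))
  (≋-trans (+-cong (•-cong {c = c} refl (division p f x)) (division p f y))
    (≋-trans (+-cong (•-distribˡ c (qx *ₚ f) rx) ≋-refl)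
      (≋-trans (+-cong (+-cong (≋-sym (•-*ˡ c qx f)) ≋-refl) ≋-refl) (lem f (c • qx) (c • rx) qy ry))))
  where
  qx = quotient p f x
  qy = quotient p f y
  rx = remainder p f x
  ry = remainder p f y
  lem : ∀ f a b c d → a *ₚ f +ₚ b +ₚ (c *ₚ f +ₚ d) ≋ (a +ₚ c) *ₚ f +ₚ (b +ₚ d)
  lem = Ring.solve-∀ polyACR

remainder-cong : ∀ {p f g h} → MonicOf p f → g ≋ h → remainder p f g ≋ remainder p f h
remainder-cong {f = f} m e = remainder-mod m (mod-reflexive f e)

remainder-mod-self : ∀ p f h → remainder p f h ≡ h mod f
remainder-mod-self p f h = negₚ (quotient p f h) ,
  ≋-trans (lem (quotient p f h) f (remainder p f h)) (+-cong ≋-refl (≋-sym (division p f h)))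
  where
  lem : ∀ q f r → r ≋ negₚ q *ₚ f +ₚ (q *ₚ f +ₚ r)
  lem = Ring.solve-∀ polyACR

map-alternating : ∀ {φ} (T : Poly → Poly) → (∀ {x y} → x ≋ y → T x ≋ T y) →
  (∀ c x y → T (c • x +ₚ y) ≋ c • T x +ₚ T y) → Alternating φ → Alternating (φ ∘ map T)
map-alternating T T-cong T-linear A .cong≋ ps = cong≋ A (Pointwise.map⁺ T T (Pointwise.map T-cong ps))
map-alternating {φ} T T-cong T-linear A .linear as c x y bs
  rewrite map-++ T as ((c • x +ₚ y) ∷ bs) | map-++ T as (x ∷ bs) | map-++ T as (y ∷ bs) =
  trans (cong≋ A (Pointwise.++⁺ (Pointwise.refl ≋-refl) (T-linear c x y ∷ Pointwise.refl ≋-refl)))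
    (linear A (map T as) c (T x) (T y) (map T bs))
map-alternating T T-cong T-linear A .repeat as x bs rewrite map-++ T as (x ∷ x ∷ bs) = repeat A (map T as) (T x) (map T bs)

map-≋ : ∀ {f g : ℕ → Poly} xs → (∀ k → f k ≋ g k) → Pointwise _≋_ (map f xs) (map g xs)
map-≋ {f} {g} xs h = Pointwise.map⁺ f g (Pointwise.refl (λ {k} → h k))

-- determinant of multiplication by g on ℤ[x]/(f), where f is monic of degree p
Norm : ℕ → Poly → Poly → ℤ
Norm p f g = Det (downFrom p) (map (λ k → remainder p f (Xpow k *ₚ g)) (downFrom p))

Norm-mod : ∀ {p f g h} → MonicOf p f → g ≡ h mod f → Norm p f g ≡ Norm p f h
Norm-mod {p} m e = cong≋ (Det-alternating (downFrom p))
  (map-≋ (downFrom p) λ k → remainder-mod m (mod-*ˡ (Xpow k) e))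

Norm-cong : ∀ {p f g h} → MonicOf p f → g ≋ h → Norm p f g ≡ Norm p f h
Norm-cong {f = f} m e = Norm-mod m (mod-reflexive f e)

Norm-congˡ : ∀ {p f f′} → MonicOf p f → f ≋ f′ → ∀ g → Norm p f g ≡ Norm p f′ g
Norm-congˡ {p} {f} {f′} m e g = cong≋ (Det-alternating (downFrom p)) (map-≋ (downFrom p) λ k →
  let h = Xpow k *ₚ g in
  remainder-unique m (quotient p f′ h) (Deg<-remainder (monicOf-≋ e m) h)
    (≋-trans (division p f′ h) (+-cong (*-congʳ (quotient p f′ h) (≋-sym e)) ≋-refl)))

-- Multiplying every row by `h` modulo `f` and then taking `Det` is an alternating form.
-- `alternating-unique` evaluates it on the rows of multiplication by `g`: the determinant of these
-- rows times the value on the basis, which is the norm of `h`.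
Norm-* : ∀ {p f} → MonicOf p f → ∀ g h → Norm p f (g *ₚ h) ≡ Norm p f g * Norm p f h
Norm-* {p} {f} m g h = begin
  Norm p f (g *ₚ h) ≡⟨ cong≋ (Det-alternating (downFrom p)) (map-≋ (downFrom p) λ k →
    remainder-mod m (mod-sym (Xpow k))) ⟩
  Det (downFrom p) (map (T ∘ R) (downFrom p)) ≡⟨ cong (Det (downFrom p)) (map-∘ (downFrom p)) ⟩
  Det (downFrom p) (map T (map R (downFrom p)))
    ≡⟨ alternating-unique p alternating (map R (downFrom p))
         (All.map⁺ (All.universal (λ k → Deg<-remainder m (Xpow k *ₚ g)) (downFrom p)))
         (trans (length-map R (downFrom p)) (length-downFrom p)) ⟩
  Norm p f g * Det (downFrom p) (map T (basis p)) ≡⟨ cong (λ u → Norm p f g * Det (downFrom p) u) (map-∘ (downFrom p)) ⟨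
  Norm p f g * Norm p f h ∎
  where
  open ≡-Reasoning
  T : Poly → Poly
  T x = remainder p f (x *ₚ h)
  R : ℕ → Poly
  R k = remainder p f (Xpow k *ₚ g)
  T-linear : ∀ c x y → T (c • x +ₚ y) ≋ c • T x +ₚ T y
  T-linear c x y = ≋-trans
    (remainder-cong m (≋-trans (*-distribʳ h (c • x) y) (+-cong (•-*ˡ c x h) ≋-refl)))
    (remainder-linear m c (x *ₚ h) (y *ₚ h))
  alternating = map-alternating T (λ e → remainder-cong m (*-congˡ h e)) T-linear (Det-alternating (downFrom p))
  mod-sym : ∀ x → x *ₚ (g *ₚ h) ≡ remainder p f (x *ₚ g) *ₚ h mod f
  mod-sym x with remainder-mod-self p f (x *ₚ g)
  ... | q , e = negₚ (h *ₚ q) , ≋-trans (lem x g h q f) (+-cong ≋-refl (*-congˡ h (≋-sym e)))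
    where
    lem : ∀ x g h q f → x *ₚ (g *ₚ h) ≋ negₚ (h *ₚ q) *ₚ f +ₚ (q *ₚ f +ₚ x *ₚ g) *ₚ h
    lem = Ring.solve-∀ polyACR

const-* : ∀ c f → (c ∷ []) *ₚ f ≋ c • f
const-* c f = ≋-trans (+-cong ≋-refl 0∷[]) (+-identityʳ (c • f))

Deg<-• : ∀ {n f} c → Deg< n f → Deg< n (c • f)
Deg<-• {f = f} c d i l = trans (coeff-• c f i) (trans (cong (c *_) (d i l)) (ℤ.*-zeroʳ c))

Norm-const : ∀ {p f} → MonicOf p f → ∀ c → Norm p f (c ∷ []) ≡ c ℤ.^ p
Norm-const {p} {f} m c = begin
  Norm p f (c ∷ []) ≡⟨ cong≋ (Det-alternating (downFrom p)) (rows p ℕ.≤-refl) ⟩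
  Det (downFrom p) (map (c •_) (basis p)) ≡⟨ scale-rows (Det-alternating (downFrom p)) c (basis p) ⟩
  c ℤ.^ length (basis p) * Det (downFrom p) (basis p)
    ≡⟨ cong₂ (λ u v → c ℤ.^ u * v) (trans (length-map Xpow (downFrom p)) (length-downFrom p)) (Det-basis p) ⟩
  c ℤ.^ p * 1ℤ ≡⟨ ℤ.*-identityʳ _ ⟩
  c ℤ.^ p ∎
  where
  open ≡-Reasoning
  rows : ∀ k → k ℕ.≤ p → Pointwise _≋_ (map (λ k → remainder p f (Xpow k *ₚ (c ∷ []))) (downFrom k)) (map (c •_) (basis k))
  rows zero l = []
  rows (suc k) l = ≋-trans (remainder-cong m (≋-trans (*-comm (Xpow k) (c ∷ [])) (const-* c (Xpow k))))
      (remainder-small m (Deg<-mono {f = c • Xpow k} l (Deg<-• {f = Xpow k} c (Deg<-Xpow k))))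
    ∷ rows k (ℕ.<⇒≤ l)

coeff-shift : ∀ k f i → coeff (Xpow k *ₚ f) (k ℕ.+ i) ≡ coeff f i
coeff-shift zero f i = *-identityˡ f .at i
coeff-shift (suc k) f i = trans (shift-* (Xpow k) f .at (suc (k ℕ.+ i))) (coeff-shift k f i)

coeff-shift-low : ∀ k f {i} → i ℕ.< k → coeff (Xpow k *ₚ f) i ≡ 0ℤ
coeff-shift-low (suc k) f {zero} l = shift-* (Xpow k) f .at 0
coeff-shift-low (suc k) f {suc i} (s≤s l) = trans (shift-* (Xpow k) f .at (suc i)) (coeff-shift-low k f l)

Deg<-shift : ∀ k {n f} → Deg< n f → Deg< (k ℕ.+ n) (Xpow k *ₚ f)
Deg<-shift k {n} {f} d i l = subst (λ j → coeff (Xpow k *ₚ f) j ≡ 0ℤ) (ℕ.m+[n∸m]≡n k≤i)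
  (trans (coeff-shift k f (i ℕ.∸ k)) (d (i ℕ.∸ k) (ℕ.+-cancelˡ-≤ k _ _ (subst (k ℕ.+ n ℕ.≤_) (sym (ℕ.m+[n∸m]≡n k≤i)) l))))
  where
  k≤i : k ℕ.≤ i
  k≤i = ℕ.≤-trans (ℕ.m≤m+n k n) l

monicOf-shift : ∀ k {p f} → MonicOf p f → MonicOf (k ℕ.+ p) (Xpow k *ₚ f)
monicOf-shift k {p} {f} m .leading = trans (coeff-shift k f p) (m .leading)
monicOf-shift k {p} {f} m .above = subst (λ n → Deg< n (Xpow k *ₚ f)) (ℕ.+-suc k p) (Deg<-shift k (m .above))

multiples : Poly → ℕ → List Poly
multiples f n = map (λ k → Xpow k *ₚ f) (downFrom n)

-- The top row is monic of the top degree, so `Det-leading` removes it and its column. The other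
-- rows change only by multiples of `f`; after `q` rounds they have degree below `p` and are the
-- remainders.
Det-multiples : ∀ {p f} → MonicOf p f → ∀ q hs → All (Deg< (q ℕ.+ p)) hs →
  Det (downFrom (q ℕ.+ p)) (multiples f q ++ hs) ≡ Det (downFrom p) (map (remainder p f) hs)
Det-multiples {p} {f} m zero hs ds = cong≋ (Det-alternating (downFrom p)) (small ds)
  where
  small : ∀ {hs} → All (Deg< p) hs → Pointwise _≋_ hs (map (remainder p f) hs)
  small [] = []
  small (d ∷ ds) = ≋-sym (remainder-small m d) ∷ small ds
Det-multiples {p} {f} m (suc q) hs ds = begin
  Det (downFrom (suc n)) (F ∷ multiples f q ++ hs) ≡⟨ Det-leading {F} n (multiples f q ++ hs) (mF .leading) ⟩
  Det (downFrom n) (map reduce (multiples f q ++ hs))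
    ≡⟨ cong (Det (downFrom n)) (map-++ reduce (multiples f q) hs) ⟩
  Det (downFrom n) (map reduce (multiples f q) ++ map reduce hs)
    ≡⟨ cong≋ (Det-alternating (downFrom n)) (Pointwise.++⁺ (unchanged q ℕ.≤-refl) (Pointwise.refl ≋-refl)) ⟩
  Det (downFrom n) (multiples f q ++ map reduce hs)
    ≡⟨ Det-multiples m q (map reduce hs)
         (All.map⁺ (All.map (λ {h} → Deg<-reduce {F} {n} {h} (mF .leading) (mF .above)) ds)) ⟩
  Det (downFrom p) (map (remainder p f) (map reduce hs))
    ≡⟨ cong≋ (Det-alternating (downFrom p)) (congruent hs) ⟩
  Det (downFrom p) (map (remainder p f) hs) ∎
  where
  open ≡-Reasoning
  n = q ℕ.+ p
  F = Xpow q *ₚ f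
  mF = monicOf-shift q m
  reduce = λ h → h -ₚ coeff h n • F
  unchanged : ∀ k → k ℕ.≤ q → Pointwise _≋_ (map reduce (multiples f k)) (multiples f k)
  unchanged zero l = []
  unchanged (suc k) l = mk≋ (λ i → trans (coeff-reduce g (coeff g n) F i)
      (trans (cong (λ u → coeff g i - u * coeff F i) (monicOf-shift k m .above n (ℕ.+-monoˡ-≤ p l))) (lem (coeff g i) (coeff F i))))
    ∷ unchanged k (ℕ.<⇒≤ l)
    where
    g = Xpow k *ₚ f
    lem : ∀ x y → x - 0ℤ * y ≡ x
    lem = solve-∀
  lem : ∀ h c x f → h -ₚ c *ₚ (x *ₚ f) ≋ negₚ (c *ₚ x) *ₚ f +ₚ h
  lem = Ring.solve-∀ polyACR
  congruent : ∀ hs → Pointwise _≋_ (map (remainder p f) (map reduce hs)) (map (remainder p f) hs)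
  congruent [] = []
  congruent (h ∷ hs) = remainder-mod m (negₚ ((coeff h n ∷ []) *ₚ Xpow q) ,
      ≋-trans (+-cong (≋-refl {h}) (neg-cong (≋-sym (const-* (coeff h n) F)))) (lem h (coeff h n ∷ []) (Xpow q) f))
    ∷ congruent hs

multiples-small : ∀ {q g} → Deg< (suc q) g → ∀ p → All (Deg< (p ℕ.+ q)) (multiples g p)
multiples-small d zero = []
multiples-small {q} {g} d (suc p) = subst (λ n → Deg< n (Xpow p *ₚ g)) (ℕ.+-suc p q) (Deg<-shift p d)
  ∷ All.map (λ {h} → Deg<-mono {f = h} (ℕ.n≤1+n _)) (multiples-small d p)

Norm-Sylvester : ∀ {p q f g} → MonicOf p f → Deg< (suc q) g →
  Det (downFrom (q ℕ.+ p)) (multiples f q ++ multiples g p) ≡ Norm p f g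
Norm-Sylvester {p} {q} {f} {g} m d = trans
  (Det-multiples m q (multiples g p) (subst (λ n → All (Deg< n) (multiples g p)) (ℕ.+-comm p q) (multiples-small d p)))
  (cong (Det (downFrom p)) (sym (map-∘ (downFrom p))))

-- Both norms are the same Sylvester determinant, with its two blocks of rows in opposite order.
Norm-symmetric : ∀ {p q f g} → MonicOf p f → MonicOf q g → Norm p f g ≡ -1ℤ ℤ.^ (q ℕ.* p) * Norm q g f
Norm-symmetric {p} {q} {f} {g} mf mg = begin
  Norm p f g ≡⟨ Norm-Sylvester mf (mg .above) ⟨
  Det (downFrom (q ℕ.+ p)) (multiples f q ++ multiples g p)
    ≡⟨ swap-blocks (Det-alternating (downFrom (q ℕ.+ p))) (multiples f q) (multiples g p) ⟩
  -1ℤ ℤ.^ (length (multiples f q) ℕ.* length (multiples g p)) * Det (downFrom (q ℕ.+ p)) (multiples g p ++ multiples f q)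
    ≡⟨ cong₂ (λ u v → -1ℤ ℤ.^ u * v) (cong₂ ℕ._*_ (len f q) (len g p))
         (trans (cong (λ n → Det (downFrom n) (multiples g p ++ multiples f q)) (ℕ.+-comm q p)) (Norm-Sylvester mg (mf .above))) ⟩
  -1ℤ ℤ.^ (q ℕ.* p) * Norm q g f ∎
  where
  open ≡-Reasoning
  len : ∀ f n → length (multiples f n) ≡ n
  len f n = trans (length-map _ (downFrom n)) (length-downFrom n)

-- The Sylvester matrix

coeff-beyond : ∀ f → Deg< (length f) f
coeff-beyond [] i _ = refl
coeff-beyond (a ∷ f) (suc i) (s≤s l) = coeff-beyond f i l

deg-above : ∀ f → Deg< (suc (deg f)) f
deg-above f = Deg<-≋ {f = norm f} (norm-sound f) (Deg<-mono {f = norm f} (ℕ.m≤n+m∸n (length (norm f)) 1) (coeff-beyond (norm f)))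

monic⇒monicOf : ∀ {f} → Monic f → MonicOf (deg f) f
monic⇒monicOf {f} m = monicOf m (deg-above f)

monicOf⇒degree : ∀ {p q f} → MonicOf p f → MonicOf q f → p ≡ q
monicOf⇒degree {p} {q} m m′ with ℕ.<-cmp p q
... | tri< l _ _ = ⊥-elim (1≢0 (trans (sym (m′ .leading)) (m .above q l)))
... | tri≈ _ e _ = e
... | tri> _ _ l = ⊥-elim (1≢0 (trans (sym (m .leading)) (m′ .above p l)))

length-norm : ∀ {n f} → Deg< n f → length (norm f) ℕ.≤ n
length-norm {n} {[]} d = z≤n
length-norm {zero} {a ∷ f} d rewrite norm-zero (a ∷ f) (Deg<-zero d) = z≤n
length-norm {suc n} {a ∷ f} d with norm f | length-norm {n} {f} (λ i l → d (suc i) (s≤s l))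
... | [] | l with a ℤ.≟ 0ℤ
...   | yes _ = z≤n
...   | no _ = s≤s z≤n
length-norm {suc n} {a ∷ f} d | _ ∷ _ | l = s≤s l

monicOf⇒deg : ∀ {p f} → MonicOf p f → deg f ≡ p
monicOf⇒deg {p} {f} m = ℕ.≤-antisym (ℕ.∸-monoˡ-≤ 1 (length-norm {f = f} (m .above)))
  (ℕ.≮⇒≥ λ l → 1≢0 (trans (sym (m .leading)) (deg-above f p l)))

monicOf⇒monic : ∀ {p f} → MonicOf p f → Monic f
monicOf⇒monic {f = f} m = trans (cong (coeff f) (monicOf⇒deg m)) (m .leading)

-- The equation says `e = k + d + s - j` without truncated subtraction. To the left of the shifted
-- row (`j < s`) the exponent `e` exceeds `k + d`; to its right (`j - s > d`) it is below `k`; in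
-- both cases the coefficient is 0, as the entry is.
rowEntry-coeff : ∀ h d s j k e → Deg< (suc d) h → e ℕ.+ j ≡ k ℕ.+ d ℕ.+ s →
  rowEntry h d s j ≡ coeff (Xpow k *ₚ h) e
rowEntry-coeff h d s j k e small eq with s ℕ.≤? j
... | no s≰j rewrite dec-false (s ℕ.≤? j) s≰j = sym (Deg<-shift k small e (ℕ.+-cancelʳ-≤ j _ _ (subst ((k ℕ.+ suc d) ℕ.+ j ℕ.≤_) (sym eq)
  (subst (ℕ._≤ (k ℕ.+ d) ℕ.+ s) (trans (ℕ.+-suc (k ℕ.+ d) j) (cong (ℕ._+ j) (sym (ℕ.+-suc k d))))
    (ℕ.+-monoʳ-≤ (k ℕ.+ d) (ℕ.≰⇒> s≰j))))))
... | yes s≤j rewrite dec-true (s ℕ.≤? j) s≤j with j ℕ.∸ s ℕ.≤? d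
...   | yes t≤d rewrite dec-true (j ℕ.∸ s ℕ.≤? d) t≤d = trans (sym (coeff-shift k h (d ℕ.∸ (j ℕ.∸ s)))) (cong (coeff (Xpow k *ₚ h)) (ℕ.+-cancelʳ-≡ j _ _ (begin
  k ℕ.+ (d ℕ.∸ t) ℕ.+ j ≡⟨ cong (k ℕ.+ (d ℕ.∸ t) ℕ.+_) (ℕ.m∸n+n≡m s≤j) ⟨
  k ℕ.+ (d ℕ.∸ t) ℕ.+ (t ℕ.+ s) ≡⟨ ℕ.+-assoc (k ℕ.+ (d ℕ.∸ t)) t s ⟨
  k ℕ.+ (d ℕ.∸ t) ℕ.+ t ℕ.+ s ≡⟨ cong (ℕ._+ s) (ℕ.+-assoc k (d ℕ.∸ t) t) ⟩
  k ℕ.+ ((d ℕ.∸ t) ℕ.+ t) ℕ.+ s ≡⟨ cong (λ u → k ℕ.+ u ℕ.+ s) (ℕ.m∸n+n≡m t≤d) ⟩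
  k ℕ.+ d ℕ.+ s ≡⟨ eq ⟨
  e ℕ.+ j ∎)))
  where
  open ≡-Reasoning
  t = j ℕ.∸ s
...   | no t≰d rewrite dec-false (j ℕ.∸ s ℕ.≤? d) t≰d = sym (coeff-shift-low k h (ℕ.+-cancelʳ-< j e k (subst (ℕ._< k ℕ.+ j) (sym eq)
  (subst (ℕ._≤ k ℕ.+ j) (trans (ℕ.+-suc k (d ℕ.+ s)) (cong suc (sym (ℕ.+-assoc k d s))))
    (ℕ.+-monoʳ-≤ k (subst (suc d ℕ.+ s ℕ.≤_) (ℕ.m∸n+n≡m s≤j) (ℕ.+-monoˡ-≤ s (ℕ.≰⇒> t≰d))))))))

tabulate-∸ : ∀ n → tabulate {n = n} (λ j → n ℕ.∸ suc (toℕ j)) ≡ downFrom n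
tabulate-∸ zero = refl
tabulate-∸ (suc n) = cong (n ∷_) (tabulate-∸ n)

tabulate-toℕ : {A : Set} (x : ℕ → A) → ∀ n → tabulate {n = n} (λ i → x (toℕ i)) ≡ applyUpTo x n
tabulate-toℕ x zero = refl
tabulate-toℕ x (suc n) = cong (x 0 ∷_) (tabulate-toℕ (x ∘ suc) n)

applyUpTo-+ : {A : Set} (x : ℕ → A) → ∀ m n → applyUpTo x (m ℕ.+ n) ≡ applyUpTo x m ++ applyUpTo (λ i → x (m ℕ.+ i)) n
applyUpTo-+ x zero n = refl
applyUpTo-+ x (suc m) n = cong (x 0 ∷_) (applyUpTo-+ (x ∘ suc) m n)

applyUpTo-reverse : {A : Set} (x y : ℕ → A) → ∀ n → (∀ i → i ℕ.< n → x i ≡ y (n ℕ.∸ suc i)) → applyUpTo x n ≡ map y (downFrom n)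
applyUpTo-reverse x y zero h = refl
applyUpTo-reverse x y (suc n) h = cong₂ _∷_ (h 0 (s≤s z≤n)) (applyUpTo-reverse (x ∘ suc) y n (λ i l → h (suc i) (s≤s l)))

exponents : ∀ n d i j → i ℕ.< n → j ℕ.< n ℕ.+ d → (n ℕ.+ d ℕ.∸ suc j) ℕ.+ j ≡ n ℕ.∸ suc i ℕ.+ d ℕ.+ i
exponents n d i j i<n j<n+d = ℕ.suc-injective (begin
  suc (n ℕ.+ d ℕ.∸ suc j ℕ.+ j) ≡⟨ ℕ.+-suc _ j ⟨
  n ℕ.+ d ℕ.∸ suc j ℕ.+ suc j ≡⟨ ℕ.m∸n+n≡m j<n+d ⟩
  n ℕ.+ d ≡⟨ cong (ℕ._+ d) (ℕ.m∸n+n≡m i<n) ⟨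
  n ℕ.∸ suc i ℕ.+ suc i ℕ.+ d ≡⟨ ℕ.+-assoc (n ℕ.∸ suc i) (suc i) d ⟩
  n ℕ.∸ suc i ℕ.+ suc (i ℕ.+ d) ≡⟨ ℕ.+-suc (n ℕ.∸ suc i) (i ℕ.+ d) ⟩
  suc (n ℕ.∸ suc i ℕ.+ (i ℕ.+ d)) ≡⟨ cong (λ u → suc (n ℕ.∸ suc i ℕ.+ u)) (ℕ.+-comm i d) ⟩
  suc (n ℕ.∸ suc i ℕ.+ (d ℕ.+ i)) ≡⟨ cong suc (ℕ.+-assoc (n ℕ.∸ suc i) d i) ⟨
  suc (n ℕ.∸ suc i ℕ.+ d ℕ.+ i) ∎)
  where open ≡-Reasoning

-- Row `i` of the Sylvester matrix is a polynomial `Xpow k *ₚ f` or `Xpow k *ₚ g`, and column `j`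
-- reads off the exponent `p + q - 1 - j`. So the columns are `downFrom (p + q)` and the rows two
-- blocks of `multiples`.
res≡Norm : ∀ {f g} → Monic f → res f g ≡ Norm (deg f) f g
res≡Norm {f} {g} m = begin
  res f g ≡⟨ det≡Det (p ℕ.+ q) _ (λ i → row (toℕ i)) (λ j → p ℕ.+ q ℕ.∸ suc (toℕ j)) entry ⟩
  Det (tabulate {n = p ℕ.+ q} (λ j → p ℕ.+ q ℕ.∸ suc (toℕ j))) (tabulate {n = p ℕ.+ q} (λ i → row (toℕ i)))
    ≡⟨ cong₂ Det (tabulate-∸ (p ℕ.+ q)) (tabulate-toℕ row (p ℕ.+ q)) ⟩
  Det (downFrom (p ℕ.+ q)) (applyUpTo row (p ℕ.+ q)) ≡⟨ cong (λ n → Det (downFrom n) (applyUpTo row n)) (ℕ.+-comm p q) ⟩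
  Det (downFrom (q ℕ.+ p)) (applyUpTo row (q ℕ.+ p)) ≡⟨ cong (Det (downFrom (q ℕ.+ p))) (applyUpTo-+ row q p) ⟩
  Det (downFrom (q ℕ.+ p)) (applyUpTo row q ++ applyUpTo (λ i → row (q ℕ.+ i)) p)
    ≡⟨ cong₂ (λ xs ys → Det (downFrom (q ℕ.+ p)) (xs ++ ys))
         (applyUpTo-reverse row _ q λ i → row-f i) (applyUpTo-reverse _ _ p λ i _ → row-g i) ⟩
  Det (downFrom (q ℕ.+ p)) (multiples f q ++ multiples g p) ≡⟨ Norm-Sylvester (monic⇒monicOf m) (deg-above g) ⟩
  Norm p f g ∎
  where
  open ≡-Reasoning
  p = deg f
  q = deg g
  row : ℕ → Poly
  row i with i ℕ.<? q
  ... | yes _ = Xpow (q ℕ.∸ suc i) *ₚ f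
  ... | no _ = Xpow (p ℕ.∸ suc (i ℕ.∸ q)) *ₚ g
  row-f : ∀ i → i ℕ.< q → row i ≡ Xpow (q ℕ.∸ suc i) *ₚ f
  row-f i l with i ℕ.<? q
  ... | yes _ = refl
  ... | no n = ⊥-elim (n l)
  row-g : ∀ i → row (q ℕ.+ i) ≡ Xpow (p ℕ.∸ suc i) *ₚ g
  row-g i with q ℕ.+ i ℕ.<? q
  ... | yes l = ⊥-elim (ℕ.m+n≮m q i l)
  ... | no _ = cong (λ j → Xpow (p ℕ.∸ suc j) *ₚ g) (ℕ.m+n∸m≡n q i)
  entry : ∀ (i j : Fin (p ℕ.+ q)) → sylvester f g (toℕ i) (toℕ j) ≡ coeff (row (toℕ i)) (p ℕ.+ q ℕ.∸ suc (toℕ j))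
  entry i j with toℕ i ℕ.<? q
  ... | yes l = rowEntry-coeff f p (toℕ i) (toℕ j) (q ℕ.∸ suc (toℕ i)) _ (deg-above f)
    (trans (cong (λ n → n ℕ.∸ suc (toℕ j) ℕ.+ toℕ j) (ℕ.+-comm p q))
      (exponents q p (toℕ i) (toℕ j) l (subst (toℕ j ℕ.<_) (ℕ.+-comm p q) (Fin.toℕ<n j))))
  ... | no n = rowEntry-coeff g q (toℕ i ℕ.∸ q) (toℕ j) (p ℕ.∸ suc (toℕ i ℕ.∸ q)) _ (deg-above g)
    (exponents p q (toℕ i ℕ.∸ q) (toℕ j)
      (subst (toℕ i ℕ.∸ q ℕ.<_) (ℕ.m+n∸n≡m p q) (ℕ.∸-monoˡ-< (Fin.toℕ<n i) (ℕ.≮⇒≥ n))) (Fin.toℕ<n j))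

-- Coprimality

-- ideal membership of a nonzero constant: coprimality over ℚ without leaving ℤ[x]
Comax : Poly → Poly → Set
Comax f g = Σ ℤ λ c → c ≢ 0ℤ × Σ Poly λ u → Σ Poly λ v → u *ₚ f +ₚ v *ₚ g ≋ c ∷ []

comax-sym : ∀ {f g} → Comax f g → Comax g f
comax-sym {f} {g} (c , c≢0 , u , v , e) = c , c≢0 , v , u , ≋-trans (+-comm (v *ₚ g) (u *ₚ f)) e

comax-mod : ∀ {f g h} → g ≡ h mod f → Comax f h → Comax f g
comax-mod {f} {g} {h} (q , e) (c , c≢0 , u , v , e′) = c , c≢0 , u -ₚ v *ₚ q , v ,
  ≋-trans (+-cong ≋-refl (*-congʳ v e)) (≋-trans (lem u v q f h) e′)
  where
  lem : ∀ u v q f h → (u -ₚ v *ₚ q) *ₚ f +ₚ v *ₚ (q *ₚ f +ₚ h) ≋ u *ₚ f +ₚ v *ₚ h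
  lem = Ring.solve-∀ polyACR

comax-cong : ∀ {f g h} → g ≋ h → Comax f h → Comax f g
comax-cong {f} e = comax-mod (mod-reflexive f e)

const-const : ∀ c d → (c ∷ []) *ₚ (d ∷ []) ≋ c * d ∷ []
const-const c d = const-* c (d ∷ [])

comax-const : ∀ {f c} → c ≢ 0ℤ → Comax f (c ∷ [])
comax-const {f} {c} c≢0 = c , c≢0 , [] , oneₚ , *-identityˡ (c ∷ [])

*≢0 : ∀ {c d} → c ≢ 0ℤ → d ≢ 0ℤ → c * d ≢ 0ℤ
*≢0 {c} c≢0 d≢0 e with ℤ.i*j≡0⇒i≡0∨j≡0 c e
... | inj₁ p = c≢0 p
... | inj₂ p = d≢0 p

comax-* : ∀ {f g h} → Comax f g → Comax f h → Comax f (g *ₚ h)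
comax-* {f} {g} {h} (c , c≢0 , u , v , e) (d , d≢0 , s , t , e′) =
  c * d , *≢0 c≢0 d≢0 , (u *ₚ (s *ₚ f +ₚ t *ₚ h) +ₚ v *ₚ g *ₚ s) , v *ₚ t ,
  ≋-trans (lem f g h u v s t) (≋-trans (*-cong e e′) (const-const c d))
  where
  lem : ∀ f g h u v s t → (u *ₚ (s *ₚ f +ₚ t *ₚ h) +ₚ v *ₚ g *ₚ s) *ₚ f +ₚ v *ₚ t *ₚ (g *ₚ h) ≋
    (u *ₚ f +ₚ v *ₚ g) *ₚ (s *ₚ f +ₚ t *ₚ h)
  lem = Ring.solve-∀ polyACR

comax-factor : ∀ {f g h} → g ∣≋ h → Comax f h → Comax f g
comax-factor {f} {g} {h} (k , e) (c , c≢0 , u , v , e′) = c , c≢0 , u , v *ₚ k ,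
  ≋-trans (+-cong ≋-refl (≋-trans (*-assoc v k g) (*-congʳ v (≋-sym e)))) e′

comax-unit : ∀ {f} g → f ∣≋ oneₚ → Comax f g
comax-unit {f} g (q , e) = 1ℤ , 1≢0 , q , [] , ≋-trans (+-identityʳ (q *ₚ f)) (≋-sym e)

∣≋-refl : ∀ {f} → f ∣≋ f
∣≋-refl {f} = oneₚ , ≋-sym (*-identityˡ f)

∣≋-trans : ∀ {f g h} → f ∣≋ g → g ∣≋ h → f ∣≋ h
∣≋-trans {f} {g} {h} (q , e) (r , e′) = r *ₚ q , ≋-trans e′ (≋-trans (*-congʳ r e) (≋-sym (*-assoc r q f)))

∣≋-cong : ∀ {f g h} → g ≋ h → f ∣≋ g → f ∣≋ h
∣≋-cong e (q , e′) = q , ≋-trans (≋-sym e) e′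

∣≋-*ˡ : ∀ {f g} k → f ∣≋ g → f ∣≋ k *ₚ g
∣≋-*ˡ {f} k (q , e) = k *ₚ q , ≋-trans (*-congʳ k e) (≋-sym (*-assoc k q f))

∣≋-*ʳ : ∀ {f g} k → f ∣≋ g → f ∣≋ g *ₚ k
∣≋-*ʳ {f} {g} k p = ∣≋-cong (*-comm k g) (∣≋-*ˡ k p)

∣≋-+ : ∀ {f g h} → f ∣≋ g → f ∣≋ h → f ∣≋ g +ₚ h
∣≋-+ {f} (q , e) (r , e′) = q +ₚ r , ≋-trans (+-cong e e′) (≋-sym (*-distribʳ f q r))

-- Removes the constant that `Comax` has in place of 1: `c` times the remainder of `k` is a multiple
-- of `f` of degree below `p`, hence zero, and `c` cancels coefficientwise.
monic-∣-const-* : ∀ {p f c k} → MonicOf p f → c ≢ 0ℤ → f ∣≋ (c ∷ []) *ₚ k → f ∣≋ k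
monic-∣-const-* {p} {f} {c} {k} m c≢0 (q , e) = s , ≋-trans (division p f k) (≋-trans (+-cong ≋-refl r≋0) (+-identityʳ (s *ₚ f)))
  where
  s = quotient p f k
  r = remainder p f k
  C = c ∷ []
  lem₁ : ∀ C s f r → C *ₚ r ≋ C *ₚ (s *ₚ f +ₚ r) -ₚ C *ₚ s *ₚ f
  lem₁ = Ring.solve-∀ polyACR
  lem₂ : ∀ C s f q → q *ₚ f -ₚ C *ₚ s *ₚ f ≋ (q -ₚ C *ₚ s) *ₚ f
  lem₂ = Ring.solve-∀ polyACR
  multiple : c • r ≋ (q -ₚ C *ₚ s) *ₚ f
  multiple = ≋-trans (≋-sym (const-* c r)) (≋-trans (lem₁ C s f r)
    (≋-trans (+-cong (≋-trans (*-congʳ C (≋-sym (division p f k))) e) ≋-refl) (lem₂ C s f q)))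
  zero-quotient : q -ₚ C *ₚ s ≋ []
  zero-quotient = monic-small⇒zero m (q -ₚ C *ₚ s) (Deg<-≋ multiple (Deg<-• {f = r} c (Deg<-remainder m k)))
  c•r≋0 : c • r ≋ []
  c•r≋0 = ≋-trans multiple (*-congˡ f zero-quotient)
  r≋0 : r ≋ []
  r≋0 .at i with ℤ.i*j≡0⇒i≡0∨j≡0 c (trans (sym (coeff-• c r i)) (c•r≋0 .at i))
  ... | inj₁ p = ⊥-elim (c≢0 p)
  ... | inj₂ p = p

coprime-divides : ∀ {p f g k} → MonicOf p f → Comax f g → f ∣≋ g *ₚ k → f ∣≋ k
coprime-divides {p} {f} {g} {k} m (c , c≢0 , u , v , e) (q , e′) = monic-∣-const-* m c≢0
  (u *ₚ k +ₚ v *ₚ q , ≋-trans (*-congˡ k (≋-sym e)) (≋-trans (lem₁ u v f g k) (≋-trans (+-cong ≋-refl (*-congʳ v e′)) (lem₂ u v f k q))))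
  where
  lem₁ : ∀ u v f g k → (u *ₚ f +ₚ v *ₚ g) *ₚ k ≋ u *ₚ k *ₚ f +ₚ v *ₚ (g *ₚ k)
  lem₁ = Ring.solve-∀ polyACR
  lem₂ : ∀ u v f k q → u *ₚ k *ₚ f +ₚ v *ₚ (q *ₚ f) ≋ (u *ₚ k +ₚ v *ₚ q) *ₚ f
  lem₂ = Ring.solve-∀ polyACR

coprime-product-divides : ∀ {p f g h} → MonicOf p f → Comax f g → f ∣≋ h → g ∣≋ h → f *ₚ g ∣≋ h
coprime-product-divides {p} {f} {g} {h} m c f∣h (k , e)
  with coprime-divides {g = g} {k} m c (∣≋-cong (≋-trans e (*-comm k g)) f∣h)
... | l , e′ = l , ≋-trans e (≋-trans (*-congˡ g e′) (*-assoc l f g))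

-- Modulo `f` the identity reads `v *ₚ g ≡ c`, so the norm of `g` divides the nonzero power `c ^ p`.
Norm-nonzero : ∀ {p f g} → MonicOf p f → Comax f g → Norm p f g ≢ 0ℤ
Norm-nonzero {p} {f} {g} m (c , c≢0 , u , v , e) z = c≢0 (ℤ.i^n≡0⇒i≡0 c p (begin
  c ℤ.^ p ≡⟨ Norm-const m c ⟨
  Norm p f (c ∷ []) ≡⟨ Norm-mod m (u , ≋-sym e) ⟩
  Norm p f (v *ₚ g) ≡⟨ Norm-* m v g ⟩
  Norm p f v * Norm p f g ≡⟨ cong (Norm p f v *_) z ⟩
  Norm p f v * 0ℤ ≡⟨ ℤ.*-zeroʳ (Norm p f v) ⟩
  0ℤ ∎))
  where
  open ≡-Reasoning

mod-trans : ∀ {f g h k} → g ≡ h mod f → h ≡ k mod f → g ≡ k mod f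
mod-trans {f} {k = k} (q , e) (r , e′) = q +ₚ r , ≋-trans e (≋-trans (+-cong ≋-refl e′) (lem q r f k))
  where
  lem : ∀ q r f k → q *ₚ f +ₚ (r *ₚ f +ₚ k) ≋ (q +ₚ r) *ₚ f +ₚ k
  lem = Ring.solve-∀ polyACR

mod-+ : ∀ {f g h g′ h′} → g ≡ h mod f → g′ ≡ h′ mod f → g +ₚ g′ ≡ h +ₚ h′ mod f
mod-+ {f} {g} {h} {g′} {h′} (q , e) (r , e′) = q +ₚ r , ≋-trans (+-cong e e′) (lem q r f h h′)
  where
  lem : ∀ q r f h h′ → q *ₚ f +ₚ h +ₚ (r *ₚ f +ₚ h′) ≋ (q +ₚ r) *ₚ f +ₚ (h +ₚ h′)
  lem = Ring.solve-∀ polyACR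

mod-* : ∀ {f g h g′ h′} → g ≡ h mod f → g′ ≡ h′ mod f → g *ₚ g′ ≡ h *ₚ h′ mod f
mod-* {f} {g} {h} {g′} {h′} p p′ = mod-trans (mod-*ˡ g p′)
  (mod-trans (mod-reflexive f (*-comm g h′)) (mod-trans (mod-*ˡ h′ p) (mod-reflexive f (*-comm h′ h))))

mod-weaken : ∀ {f f′ g h} → f′ ∣≋ f → g ≡ h mod f → g ≡ h mod f′
mod-weaken {f} {f′} {g} {h} (k , e) (q , e′) = q *ₚ k ,
  ≋-trans e′ (+-cong (≋-trans (*-congʳ q e) (≋-sym (*-assoc q k f′))) ≋-refl)

top-coefficient : ∀ {a b f g} → Deg< (suc a) f → Deg< (suc b) g →
  coeff (f *ₚ g) (a ℕ.+ b) ≡ coeff f a * coeff g b × Deg< (suc (a ℕ.+ b)) (f *ₚ g)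
top-coefficient {f = []} df dg = refl , λ _ _ → refl
top-coefficient {zero} {b} {c ∷ f} {g} df dg = trans (only-c b) (coeff-• c g b) , λ i l →
  trans (only-c i) (Deg<-• {f = g} c dg i l)
  where
  only-c : ∀ i → coeff ((c ∷ f) *ₚ g) i ≡ coeff (c • g) i
  only-c i = trans (*-congˡ {c ∷ f} {c ∷ []} g (∷-cong refl (mk≋ λ i → df (suc i) (s≤s z≤n))) .at i) (const-* c g .at i)
top-coefficient {suc a} {b} {c ∷ f} {g} df dg with top-coefficient {a} {b} {f} {g} (λ i l → df (suc i) (s≤s l)) dg
... | top , small = trans (drop-c (a ℕ.+ b) (s≤s (ℕ.m≤n+m b a))) top ,
    λ { (suc i) (s≤s l) → trans (drop-c i (ℕ.≤-trans (s≤s (ℕ.m≤n+m b a)) (ℕ.m≤n⇒m≤1+n l))) (small i l) }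
  where
  drop-c : ∀ i → suc b ℕ.≤ suc i → coeff ((c ∷ f) *ₚ g) (suc i) ≡ coeff (f *ₚ g) i
  drop-c i l = trans (coeff-*-suc c f g i) (trans (cong (λ u → c * u + coeff (f *ₚ g) i) (dg (suc i) l)) (lem c (coeff (f *ₚ g) i)))
    where
    lem : ∀ x y → x * 0ℤ + y ≡ y
    lem = solve-∀

monic-* : ∀ {a b f g} → MonicOf a f → MonicOf b g → MonicOf (a ℕ.+ b) (f *ₚ g)
monic-* {f = f} {g} m n with top-coefficient {f = f} {g} (m .above) (n .above)
... | top , small = monicOf (trans top (cong₂ _*_ (m .leading) (n .leading))) small

degree : ∀ f → f ≋ [] ⊎ Σ ℕ λ a → coeff f a ≢ 0ℤ × Deg< (suc a) f
degree [] = inj₁ ≋-refl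
degree (c ∷ f) with degree f
... | inj₂ (a , l , d) = inj₂ (suc a , l , λ { (suc i) (s≤s k) → d i k })
... | inj₁ f≋0 with c ℤ.≟ 0ℤ
...   | yes refl = inj₁ (≋-trans (∷-cong refl f≋0) 0∷[])
...   | no c≢0 = inj₂ (0 , c≢0 , λ { (suc i) (s≤s k) → f≋0 .at i })

product-degree : ∀ {a b n f g} → coeff f a ≢ 0ℤ → Deg< (suc a) f → coeff g b ≢ 0ℤ → Deg< (suc b) g →
  MonicOf n (f *ₚ g) → n ≡ a ℕ.+ b × coeff f a * coeff g b ≡ 1ℤ
product-degree {a} {b} {n} {f} {g} lf df lg dg m with top-coefficient {f = f} {g} df dg
... | top , small with ℕ.<-cmp n (a ℕ.+ b)
... | tri< l _ _ = ⊥-elim (*≢0 lf lg (trans (sym top) (m .above _ l)))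
... | tri≈ _ refl _ = refl , trans (sym top) (m .leading)
... | tri> _ _ l = ⊥-elim (1≢0 (trans (sym (m .leading)) (small n l)))

monic-quotient : ∀ {b n q g} → MonicOf b g → MonicOf n (q *ₚ g) → Σ ℕ λ a → MonicOf a q × n ≡ a ℕ.+ b
monic-quotient {b} {n} {q} {g} mg m with degree q
... | inj₁ q≋0 = ⊥-elim (1≢0 (trans (sym (m .leading)) (*-zeroˡ g q≋0 .at n)))
... | inj₂ (a , l , d) with product-degree {f = q} {g} l d (λ e → 1≢0 (trans (sym (mg .leading)) e)) (mg .above) m
... | e , p = a , monicOf (trans (sym (ℤ.*-identityʳ _)) (trans (cong (coeff q a *_) (sym (mg .leading))) p)) d , e

monic-cancel : ∀ {p f g h} → MonicOf p f → g *ₚ f ≋ h *ₚ f → g ≋ h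
monic-cancel {p} {f} {g} {h} m e = ≋-trans (lem₁ g h) (≋-trans (+-cong (monic-small⇒zero m (g -ₚ h) zero-product) ≋-refl) ≋-refl)
  where
  lem₁ : ∀ g h → g ≋ g -ₚ h +ₚ h
  lem₁ = Ring.solve-∀ polyACR
  lem₂ : ∀ g h f → (g -ₚ h) *ₚ f ≋ g *ₚ f -ₚ h *ₚ f
  lem₂ = Ring.solve-∀ polyACR
  zero-product : Deg< p ((g -ₚ h) *ₚ f)
  zero-product i _ = (≋-trans (lem₂ g h f) (≋-trans (+-cong e ≋-refl) (neg-inverseʳ (h *ₚ f)))) .at i

monic-- : ∀ {p f g} → MonicOf p f → Deg< p g → MonicOf p (f -ₚ g)
monic-- {p} {f} {g} m d .leading = trans (coeff-- f g p) (cong₂ _-_ (m .leading) (d p ℕ.≤-refl))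
monic-- {p} {f} {g} m d .above i l = trans (coeff-- f g i) (cong₂ _-_ (m .above i l) (d i (ℕ.<⇒≤ l)))

infixr 8 _^ₚ_
_^ₚ_ : Poly → ℕ → Poly
f ^ₚ zero = oneₚ
f ^ₚ suc n = f *ₚ f ^ₚ n

comax-^ : ∀ {f g} → Comax f g → ∀ n → Comax f (g ^ₚ n)
comax-^ c zero = comax-const 1≢0
comax-^ c (suc n) = comax-* c (comax-^ c n)

Norm-one : ∀ {p f} → MonicOf p f → Norm p f oneₚ ≡ 1ℤ
Norm-one {p} m = trans (Norm-const m 1ℤ) (ℤ.^-zeroˡ p)

Norm-^ : ∀ {p f} → MonicOf p f → ∀ g n → Norm p f (g ^ₚ n) ≡ Norm p f g ℤ.^ n
Norm-^ m g zero = Norm-one m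
Norm-^ {p} {f} m g (suc n) = trans (Norm-* m g (g ^ₚ n)) (cong (Norm p f g *_) (Norm-^ m g n))

-- Lucas sequences and their new factors

module LucasSequence (P Q : Poly) where

  U : ℕ → Poly
  U zero = []
  U (suc zero) = oneₚ
  U (suc (suc n)) = P *ₚ U (suc n) -ₚ Q *ₚ U n

  -- As functions of `m`, both sides satisfy the Lucas recurrence, so two initial cases suffice.
  U-+ : ∀ m k → U (suc (m ℕ.+ k)) ≋ U (suc m) *ₚ U (suc k) -ₚ Q *ₚ U m *ₚ U k
  U-+ zero k = lem (U (suc k)) Q (U k)
    where
    lem : ∀ x q y → x ≋ oneₚ *ₚ x -ₚ q *ₚ [] *ₚ y
    lem = Ring.solve-∀ polyACR
  U-+ (suc zero) k = lem P Q (U (suc k)) (U k)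
    where
    lem : ∀ p q x y → p *ₚ x -ₚ q *ₚ y ≋ (p *ₚ oneₚ -ₚ q *ₚ []) *ₚ x -ₚ q *ₚ oneₚ *ₚ y
    lem = Ring.solve-∀ polyACR
  U-+ (suc (suc m)) k = ≋-trans (+-cong (*-congʳ P (U-+ (suc m) k)) (neg-cong (*-congʳ Q (U-+ m k))))
    (lem P Q (U (suc m)) (U m) (U (suc k)) (U k))
    where
    lem : ∀ p q u v x y → p *ₚ ((p *ₚ u -ₚ q *ₚ v) *ₚ x -ₚ q *ₚ u *ₚ y) -ₚ q *ₚ (u *ₚ x -ₚ q *ₚ v *ₚ y) ≋
      (p *ₚ (p *ₚ u -ₚ q *ₚ v) -ₚ q *ₚ u) *ₚ x -ₚ q *ₚ (p *ₚ u -ₚ q *ₚ v) *ₚ y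
    lem = Ring.solve-∀ polyACR

  U-shift : ∀ m k → U (m ℕ.+ k) ≡ U (suc m) *ₚ U k mod U m
  U-shift m zero rewrite ℕ.+-identityʳ m = oneₚ , lem (U m) (U (suc m))
    where
    lem : ∀ x y → x ≋ oneₚ *ₚ x +ₚ y *ₚ []
    lem = Ring.solve-∀ polyACR
  U-shift m (suc k) rewrite ℕ.+-suc m k = negₚ (Q *ₚ U k) , ≋-trans (U-+ m k) (lem Q (U m) (U k) (U (suc m)) (U (suc k)))
    where
    lem : ∀ q u v x y → x *ₚ y -ₚ q *ₚ u *ₚ v ≋ negₚ (q *ₚ v) *ₚ u +ₚ x *ₚ y
    lem = Ring.solve-∀ polyACR

  U-shift* : ∀ m q r → U (q ℕ.* m ℕ.+ r) ≡ U (suc m) ^ₚ q *ₚ U r mod U m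
  U-shift* m zero r = mod-reflexive (U m) (≋-sym (*-identityˡ (U r)))
  U-shift* m (suc q) r rewrite ℕ.+-assoc m (q ℕ.* m) r = mod-trans (U-shift m (q ℕ.* m ℕ.+ r))
    (mod-trans (mod-*ˡ (U (suc m)) (U-shift* m q r)) (mod-reflexive (U m) (≋-sym (*-assoc (U (suc m)) (U (suc m) ^ₚ q) (U r)))))

  U-suc : ∀ m → U (suc (suc m)) ≡ negₚ Q *ₚ U m mod U (suc m)
  U-suc m = P , lem P Q (U (suc m)) (U m)
    where
    lem : ∀ p q x y → p *ₚ x -ₚ q *ₚ y ≋ p *ₚ x +ₚ negₚ q *ₚ y
    lem = Ring.solve-∀ polyACR

  -- U (k * suc m) / U (suc m)
  ratio : ℕ → ℕ → Poly
  ratio m zero = []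
  ratio m (suc k) = U (suc (k ℕ.* suc m)) -ₚ Q *ₚ U m *ₚ ratio m k

  ratio-* : ∀ m k → U (k ℕ.* suc m) ≋ ratio m k *ₚ U (suc m)
  ratio-* m zero = ≋-refl
  ratio-* m (suc k) = ≋-trans (U-+ m (k ℕ.* suc m))
    (≋-trans (+-cong (≋-refl {U (suc m) *ₚ V}) (neg-cong (*-congʳ (Q *ₚ U m) (ratio-* m k)))) (lem Q (U m) (U (suc m)) V (ratio m k)))
    where
    V = U (suc (k ℕ.* suc m))
    lem : ∀ q u x v r → x *ₚ v -ₚ q *ₚ u *ₚ (r *ₚ x) ≋ (v -ₚ q *ₚ u *ₚ r) *ₚ x
    lem = Ring.solve-∀ polyACR

  -- Write `W` for `U (suc (suc m))`. One step of `ratio` adds a term `U` of index one above a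
  -- multiple of `suc m`, congruent to a power of `W`, to `negₚ (Q *ₚ U m)` times the previous
  -- ratio. That factor is itself congruent to `W`, so each step contributes one more copy of the
  -- same power.
  ratio-mod : ∀ m k → ratio m (suc k) ≡ (ℤ.+ suc k ∷ []) *ₚ U (suc (suc m)) ^ₚ k mod U (suc m)
  ratio-mod m zero = mod-reflexive (U (suc m)) (lem (Q *ₚ U m))
    where
    lem : ∀ q → oneₚ -ₚ q *ₚ [] ≋ oneₚ *ₚ oneₚ
    lem = Ring.solve-∀ polyACR
  ratio-mod m (suc k) = mod-trans (mod-reflexive (U (suc m)) (lem₁ Q (U m) V (ratio m (suc k))))
    (mod-trans (mod-+ (subst (λ n → U n ≡ W ^ₚ suc k *ₚ oneₚ mod U (suc m)) (ℕ.+-comm (suc k ℕ.* suc m) 1) (U-shift* (suc m) (suc k) 1))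
        (mod-* (P′ , lem₂ P Q (U m) (U (suc m))) (ratio-mod m k)))
      (mod-reflexive (U (suc m)) (lem₃ W (W ^ₚ k) (ℤ.+ suc k ∷ []))))
    where
    V = U (suc (suc k ℕ.* suc m))
    W = U (suc (suc m))
    P′ = negₚ P
    lem₁ : ∀ q u v r → v -ₚ q *ₚ u *ₚ r ≋ v +ₚ negₚ (q *ₚ u) *ₚ r
    lem₁ = Ring.solve-∀ polyACR
    lem₂ : ∀ p q u x → negₚ (q *ₚ u) ≋ negₚ p *ₚ x +ₚ (p *ₚ x -ₚ q *ₚ u)
    lem₂ = Ring.solve-∀ polyACR
    lem₃ : ∀ w x c → w *ₚ x *ₚ oneₚ +ₚ w *ₚ (c *ₚ x) ≋ (oneₚ +ₚ c) *ₚ (w *ₚ x)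
    lem₃ = Ring.solve-∀ polyACR

  U-monic : MonicOf 1 P → Deg< 2 Q → ∀ n → MonicOf n (U (suc n))
  U-monic p q zero = monicOf refl λ { (suc i) _ → refl }
  U-monic p q (suc n) = monic-- (monic-* p (U-monic p q n)) (small n)
    where
    small : ∀ n → Deg< (suc n) (Q *ₚ U n)
    small zero i _ = *-zeroʳ Q .at i
    small (suc n) = top-coefficient {f = Q} {U (suc n)} q (U-monic p q n .above) .proj₂

-- Products over sets of divisors

_∣ᵇ_ : ℕ → ℕ → Bool
d ∣ᵇ n = does (d ∣? n)

∣ᵇ-true : ∀ {d n} → d ∣ n → d ∣ᵇ n ≡ true
∣ᵇ-true {d} {n} = dec-true (d ∣? n)

∣ᵇ-sound : ∀ d n → d ∣ᵇ n ≡ true → d ∣ n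
∣ᵇ-sound d n p with d ∣? n
∣ᵇ-sound d n p | yes q = q
∣ᵇ-sound d n () | no _

-- product of the Ψ d over the selected d with 1 ≤ d ≤ b
∏ : (ℕ → Poly) → ℕ → (ℕ → Bool) → Poly
∏ Ψ zero s = oneₚ
∏ Ψ (suc b) s = (if s (suc b) then Ψ (suc b) else oneₚ) *ₚ ∏ Ψ b s

∏-cong : ∀ {Ψ Ψ′ s s′} b → (∀ d → d ℕ.< b → s (suc d) ≡ true → Ψ (suc d) ≋ Ψ′ (suc d)) →
  (∀ d → d ℕ.< b → s (suc d) ≡ s′ (suc d)) → ∏ Ψ b s ≋ ∏ Ψ′ b s′
∏-cong zero h k = ≋-refl
∏-cong {s = s} {s′} (suc b) h k with s (suc b) | h b ℕ.≤-refl | s′ (suc b) | k b ℕ.≤-refl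
... | true | e | _ | refl = *-cong (e refl) (∏-cong b (λ d l → h d (ℕ.m<n⇒m<1+n l)) (λ d l → k d (ℕ.m<n⇒m<1+n l)))
... | false | _ | _ | refl = *-congʳ oneₚ (∏-cong b (λ d l → h d (ℕ.m<n⇒m<1+n l)) (λ d l → k d (ℕ.m<n⇒m<1+n l)))

∏-closed : (C : Poly → Set) → C oneₚ → (∀ {f g} → C f → C g → C (f *ₚ g)) → ∀ {Ψ s} b →
  (∀ d → d ℕ.< b → s (suc d) ≡ true → C (Ψ (suc d))) → C (∏ Ψ b s)
∏-closed C one mul zero h = one
∏-closed C one mul {s = s} (suc b) h with s (suc b) | h b ℕ.≤-refl
... | true | c = mul (c refl) (∏-closed C one mul b (λ d l → h d (ℕ.m<n⇒m<1+n l)))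
... | false | _ = mul one (∏-closed C one mul b (λ d l → h d (ℕ.m<n⇒m<1+n l)))

∏-split : ∀ {Ψ} (s t : ℕ → Bool) b → ∏ Ψ b s ≋ ∏ Ψ b (λ d → s d ∧ not (t d)) *ₚ ∏ Ψ b (λ d → s d ∧ t d)
∏-split s t zero = ≋-sym (*-identityˡ oneₚ)
∏-split {Ψ} s t (suc b) = ≋-trans (*-cong head (∏-split s t b)) (interchange
  (if s (suc b) ∧ not (t (suc b)) then Ψ (suc b) else oneₚ) (if s (suc b) ∧ t (suc b) then Ψ (suc b) else oneₚ)
  (∏ Ψ b (λ d → s d ∧ not (t d))) (∏ Ψ b (λ d → s d ∧ t d)))
  where
  interchange : ∀ u v x y → u *ₚ v *ₚ (x *ₚ y) ≋ u *ₚ x *ₚ (v *ₚ y)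
  interchange = Ring.solve-∀ polyACR
  head : (if s (suc b) then Ψ (suc b) else oneₚ) ≋
    (if s (suc b) ∧ not (t (suc b)) then Ψ (suc b) else oneₚ) *ₚ (if s (suc b) ∧ t (suc b) then Ψ (suc b) else oneₚ)
  head with s (suc b) | t (suc b)
  ... | true | true = ≋-sym (*-identityˡ _)
  ... | true | false = ≋-sym (≋-trans (*-comm _ oneₚ) (*-identityˡ _))
  ... | false | true = ≋-sym (*-identityˡ _)
  ... | false | false = ≋-sym (*-identityˡ _)

∏-extend : ∀ {Ψ s} b c → (∀ d → b ℕ.≤ d → s (suc d) ≡ false) → ∏ Ψ (c ℕ.+ b) s ≋ ∏ Ψ b s
∏-extend b zero h = ≋-refl
∏-extend {Ψ} {s} b (suc c) h rewrite h (c ℕ.+ b) (ℕ.m≤n+m b c) = ≋-trans (*-identityˡ _) (∏-extend b c h)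

∏-member : ∀ {Ψ s} b d → d ℕ.< b → s (suc d) ≡ true → Ψ (suc d) ∣≋ ∏ Ψ b s
∏-member {Ψ} {s} (suc b) d d<b p with ℕ.m<1+n⇒m<n∨m≡n d<b
... | inj₁ l = ∣≋-*ˡ (if s (suc b) then Ψ (suc b) else oneₚ) (∏-member b d l p)
... | inj₂ refl rewrite p = ∣≋-*ʳ (∏ Ψ b s) ∣≋-refl

-- Pairwise coprimality makes each new factor coprime to the product so far, so the two divide `h`
-- jointly.
∏-divides : ∀ {Ψ s h} (e : ℕ → ℕ) b → (∀ d → d ℕ.< b → MonicOf (e (suc d)) (Ψ (suc d))) →
  (∀ d d′ → d ℕ.< d′ → d′ ℕ.< b → Comax (Ψ (suc d)) (Ψ (suc d′))) →
  (∀ d → d ℕ.< b → s (suc d) ≡ true → Ψ (suc d) ∣≋ h) → ∏ Ψ b s ∣≋ h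
∏-divides {h = h} e zero m c k = h , ≋-sym (≋-trans (*-comm h oneₚ) (*-identityˡ h))
∏-divides {Ψ} {s} e (suc b) m c k with ∏-divides {Ψ} {s} e b (λ d l → m d (ℕ.m<n⇒m<1+n l))
    (λ d d′ l l′ → c d d′ l (ℕ.m<n⇒m<1+n l′)) (λ d l → k d (ℕ.m<n⇒m<1+n l)) | s (suc b) | k b ℕ.≤-refl
... | q , e′ | false | _ = q , ≋-trans e′ (*-congʳ q (≋-sym (*-identityˡ _)))
... | r | true | k′ = coprime-product-divides (m b ℕ.≤-refl)
  (∏-closed (Comax (Ψ (suc b))) (comax-const 1≢0) comax-* b (λ d l _ → comax-sym (c d b l ℕ.≤-refl))) (k′ refl) r

∑ : (ℕ → ℕ) → ℕ → (ℕ → Bool) → ℕ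
∑ e zero s = 0
∑ e (suc b) s = (if s (suc b) then e (suc b) else 0) ℕ.+ ∑ e b s

∑-cong : ∀ {e e′ s} b → (∀ d → d ℕ.< b → e (suc d) ≡ e′ (suc d)) → ∑ e b s ≡ ∑ e′ b s
∑-cong zero h = refl
∑-cong {s = s} (suc b) h = cong₂ (λ x y → (if s (suc b) then x else 0) ℕ.+ y) (h b ℕ.≤-refl) (∑-cong b (λ d l → h d (ℕ.m<n⇒m<1+n l)))

monicOf-one : MonicOf 0 oneₚ
monicOf-one = monicOf refl λ { (suc i) _ → refl }

∏-monic : ∀ {Ψ e s} b → (∀ d → d ℕ.< b → MonicOf (e (suc d)) (Ψ (suc d))) → MonicOf (∑ e b s) (∏ Ψ b s)
∏-monic zero h = monicOf-one
∏-monic {Ψ} {e} {s} (suc b) h = monic-* head (∏-monic b (λ d l → h d (ℕ.m<n⇒m<1+n l)))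
  where
  head : MonicOf (if s (suc b) then e (suc b) else 0) (if s (suc b) then Ψ (suc b) else oneₚ)
  head with s (suc b)
  ... | true = h b ℕ.≤-refl
  ... | false = monicOf-one

∏-Norm : ∀ {p f p′ f′ Ψ Ψ′ s} → MonicOf p f → MonicOf p′ f′ → ∀ b →
  (∀ d → d ℕ.< b → s (suc d) ≡ true → Norm p f (Ψ (suc d)) ≡ Norm p′ f′ (Ψ′ (suc d))) →
  Norm p f (∏ Ψ b s) ≡ Norm p′ f′ (∏ Ψ′ b s)
∏-Norm m m′ zero h = trans (Norm-one m) (sym (Norm-one m′))
∏-Norm {p} {f} {p′} {f′} {Ψ} {Ψ′} {s} m m′ (suc b) h = trans (Norm-* m (if s (suc b) then Ψ (suc b) else oneₚ) (∏ Ψ b s))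
  (trans (cong₂ _*_ head (∏-Norm {Ψ = Ψ} {Ψ′} {s} m m′ b (λ d l → h d (ℕ.m<n⇒m<1+n l))))
    (sym (Norm-* m′ (if s (suc b) then Ψ′ (suc b) else oneₚ) (∏ Ψ′ b s))))
  where
  head : Norm p f (if s (suc b) then Ψ (suc b) else oneₚ) ≡ Norm p′ f′ (if s (suc b) then Ψ′ (suc b) else oneₚ)
  head with s (suc b) | h b ℕ.≤-refl
  ... | true | e = e refl
  ... | false | _ = trans (Norm-one m) (sym (Norm-one m′))

-- Existence and coprimality of the new factors

record LucasParameters : Set where
  field
    P Q : Poly
  open LucasSequence P Q public
  field
    P-monic : MonicOf 1 P
    Q-small : Deg< 2 Q
    -- Together with `U-suc` this makes consecutive terms of the sequence coprime to the new factor
    -- between them, see `comax-U-suc`.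
    Q-coprime : ∀ n → Comax (U (suc n)) Q

  monic-U : ∀ n → MonicOf n (U (suc n))
  monic-U = U-monic P-monic Q-small

  -- Every divisor of `suc m` divides `suc n`, so cancelling `U (suc m)` removes exactly these
  -- divisors. The index `suc m` is among them: what remains no longer contains `Ψ (suc m)`. The
  -- factor `r` is left free because in `Extend` it is a mere quotient.
  ratio-product : ∀ {Ψ r m n k} → m ℕ.< n → suc n ≡ k ℕ.* suc m →
    U (suc n) ≋ r *ₚ ∏ Ψ n (_∣ᵇ suc n) → U (suc m) ≋ ∏ Ψ (suc m) (_∣ᵇ suc m) →
    ratio m k ≋ r *ₚ ∏ Ψ n (λ d → (d ∣ᵇ suc n) ∧ not (d ∣ᵇ suc m))
  ratio-product {Ψ} {r} {m} {n} {k} m<n n≡km e e′ = monic-cancel (monic-U m) (begin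
    ratio m k *ₚ U (suc m) ≈⟨ ratio-* m k ⟨
    U (k ℕ.* suc m) ≡⟨ cong U n≡km ⟨
    U (suc n) ≈⟨ e ⟩
    r *ₚ ∏ Ψ n (_∣ᵇ suc n) ≈⟨ *-congʳ r (∏-split (_∣ᵇ suc n) (_∣ᵇ suc m) n) ⟩
    r *ₚ (W *ₚ ∏ Ψ n (λ d → (d ∣ᵇ suc n) ∧ (d ∣ᵇ suc m))) ≈⟨ *-congʳ r (*-congʳ W common) ⟩
    r *ₚ (W *ₚ U (suc m)) ≈⟨ *-assoc r W (U (suc m)) ⟨
    r *ₚ W *ₚ U (suc m) ∎)
    where
    open ≋-Reasoning
    W = ∏ Ψ n (λ d → (d ∣ᵇ suc n) ∧ not (d ∣ᵇ suc m))
    absorb : ∀ d → (d ∣ᵇ suc n) ∧ (d ∣ᵇ suc m) ≡ d ∣ᵇ suc m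
    absorb d with d ∣? suc m
    ... | no _ with d ∣ᵇ suc n
    ...   | true = refl
    ...   | false = refl
    absorb d | yes d∣m rewrite ∣ᵇ-true (subst (d ∣_) (sym n≡km) (ℕ∣.∣n⇒∣m*n k d∣m)) = refl
    large : ∀ d → suc m ℕ.≤ d → suc d ∣ᵇ suc m ≡ false
    large d l = dec-false (suc d ∣? suc m) (λ p → ℕ.<⇒≱ (s≤s l) (ℕ∣.∣⇒≤ p))
    common : ∏ Ψ n (λ d → (d ∣ᵇ suc n) ∧ (d ∣ᵇ suc m)) ≋ U (suc m)
    common = begin
      ∏ Ψ n (λ d → (d ∣ᵇ suc n) ∧ (d ∣ᵇ suc m)) ≈⟨ ∏-cong n (λ _ _ _ → ≋-refl) (λ d _ → absorb (suc d)) ⟩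
      ∏ Ψ n (_∣ᵇ suc m) ≡⟨ cong (λ b → ∏ Ψ b (_∣ᵇ suc m)) (ℕ.m∸n+n≡m m<n) ⟨
      ∏ Ψ (n ℕ.∸ suc m ℕ.+ suc m) (_∣ᵇ suc m) ≈⟨ ∏-extend (suc m) (n ℕ.∸ suc m) large ⟩
      ∏ Ψ (suc m) (_∣ᵇ suc m) ≈⟨ e′ ⟨
      U (suc m) ∎

  U-∣ : ∀ {m n} → suc m ∣ n → U (suc m) ∣≋ U n
  U-∣ {m} {n} (divides k e) = ratio m k , subst (λ j → U j ≋ ratio m k *ₚ U (suc m)) (sym e) (ratio-* m k)

  U-mod : ∀ m n → U n ≡ U (suc (suc m)) ^ₚ (n / suc m) *ₚ U (n % suc m) mod U (suc m)
  U-mod m n = subst (λ j → U j ≡ U (suc (suc m)) ^ₚ (n / suc m) *ₚ U (n % suc m) mod U (suc m))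
    (trans (ℕ.+-comm (n / suc m ℕ.* suc m) (n % suc m)) (sym (m≡m%n+[m/n]*n n (suc m))))
    (U-shift* (suc m) (n / suc m) (n % suc m))

  -- The fields constrain the indices 1 to `N` only. Existence and coprimality advance together: the
  -- next quotient exists because the earlier factors are pairwise coprime, and its own coprimality
  -- comes from `comax-U` and `comax-ratio`.
  record Factorization (N : ℕ) : Set where
    field
      Ψ : ℕ → Poly
      e : ℕ → ℕ
      monic : ∀ d → d ℕ.< N → MonicOf (e (suc d)) (Ψ (suc d))
      product : ∀ n → n ℕ.< N → U (suc n) ≋ Ψ (suc n) *ₚ ∏ Ψ n (_∣ᵇ suc n)
      comax : ∀ m n → m ℕ.< n → n ℕ.< N → Comax (Ψ (suc m)) (Ψ (suc n))

    full-product : ∀ n → n ℕ.< N → U (suc n) ≋ ∏ Ψ (suc n) (_∣ᵇ suc n)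
    full-product n l rewrite ∣ᵇ-true {suc n} {suc n} ℕ∣.∣-refl = product n l

    Ψ∣U : ∀ n → n ℕ.< N → Ψ (suc n) ∣≋ U (suc n)
    Ψ∣U n l = ∣≋-cong (≋-sym (product n l)) (∣≋-*ʳ _ ∣≋-refl)

    comax-U-< : ∀ {m k} → k ℕ.< m → m ℕ.< N → Comax (Ψ (suc m)) (U (suc k))
    comax-U-< {m} {k} k<m m<N = comax-cong (full-product k (ℕ.<-trans k<m m<N))
      (∏-closed (Comax (Ψ (suc m))) (comax-const 1≢0) comax-* {Ψ} {_∣ᵇ suc k} (suc k)
        (λ d l _ → comax-sym (comax d m (ℕ.≤-trans l k<m) m<N)))

    -- Modulo `Ψ (suc m)` the next term is `negₚ Q` times the preceding one, a product of earlier
    -- factors. At index 1 the factor divides `U 1`, which is 1.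
    comax-U-suc : ∀ {m} → m ℕ.< N → Comax (Ψ (suc m)) (U (suc (suc m)))
    comax-U-suc {zero} l = comax-unit (U 2) (Ψ∣U 0 l)
    comax-U-suc {suc m} l = comax-mod (mod-weaken (Ψ∣U (suc m) l) (U-suc (suc m)))
      (comax-* (comax-cong (neg-const Q) (comax-* (comax-const {c = -1ℤ} λ ())
          (comax-sym (comax-factor (Ψ∣U (suc m) l) (comax-sym (Q-coprime (suc m)))))))
        (comax-U-< ℕ.≤-refl l))
      where
      neg-const : ∀ q → negₚ q ≋ (-1ℤ ∷ []) *ₚ q
      neg-const = Ring.solve-∀ polyACR

    comax-U : ∀ {m n} → m ℕ.< N → ¬ suc m ∣ n → Comax (Ψ (suc m)) (U n)
    comax-U {m} {n} m<N ∤n = comax-mod (mod-weaken (Ψ∣U m m<N) (U-mod m n))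
      (comax-* (comax-^ (comax-U-suc m<N) (n / suc m)) (below (n % suc m) refl (m%n<n n (suc m))))
      where
      below : ∀ r → n % suc m ≡ r → r ℕ.< suc m → Comax (Ψ (suc m)) (U r)
      below zero r≡0 _ = ⊥-elim (∤n (ℕ∣.m%n≡0⇒n∣m n (suc m) r≡0))
      below (suc r) _ (s≤s l) = comax-U-< l m<N

    -- The constant `suc k` is not a unit of ℤ in general, which is why `Comax` admits any nonzero
    -- constant.
    comax-ratio : ∀ {m} k → m ℕ.< N → Comax (Ψ (suc m)) (ratio m (suc k))
    comax-ratio {m} k m<N = comax-mod (mod-weaken (Ψ∣U m m<N) (ratio-mod m k))
      (comax-* (comax-const {c = ℤ.+ suc k} λ ()) (comax-^ (comax-U-suc m<N) k))

  empty : Factorization 0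
  empty = record { Ψ = λ _ → oneₚ ; e = λ _ → 0 ; monic = λ _ () ; product = λ _ () ; comax = λ _ _ _ () }

  module Extend {N : ℕ} (T : Factorization N) where
    open Factorization T

    W : Poly
    W = ∏ Ψ N (_∣ᵇ suc N)

    W∣U : W ∣≋ U (suc N)
    W∣U = ∏-divides e N monic comax λ d l p → ∣≋-trans (Ψ∣U d l) (U-∣ (∣ᵇ-sound (suc d) (suc N) p))

    r : Poly
    r = proj₁ W∣U

    r-monic = monic-quotient {q = r} (∏-monic {Ψ} {e} {_∣ᵇ suc N} N monic) (monicOf-≋ (proj₂ W∣U) (monic-U N))

    -- If `suc m` does not divide `suc N`, already `U (suc N)`, a multiple of `r`, is coprime to
    -- `Ψ (suc m)`. Otherwise `U (suc N)` contains `Ψ (suc m)`, and the multiple of `r` to use is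
    -- the ratio, from which that factor has been removed.
    r-comax : ∀ m → m ℕ.< N → Comax (Ψ (suc m)) r
    r-comax m m<N with suc m ∣? suc N
    ... | no ∤N = comax-factor (W , ≋-trans (proj₂ W∣U) (*-comm r W)) (comax-U m<N ∤N)
    ... | yes (divides (suc k) N≡) = comax-factor
      (W′ , ≋-trans (ratio-product {Ψ} {r} {m} {N} {suc k} m<N N≡ (proj₂ W∣U) (full-product m m<N)) (*-comm r W′)) (comax-ratio k m<N)
      where
      W′ = ∏ Ψ N (λ d → (d ∣ᵇ suc N) ∧ not (d ∣ᵇ suc m))

    extend : {A : Set} → (ℕ → A) → A → ℕ → A
    extend x y d with d ℕ.≟ suc N
    ... | yes _ = y
    ... | no _ = x d

    extend-old : {A : Set} (x : ℕ → A) (y : A) → ∀ d → d ℕ.< N → extend x y (suc d) ≡ x (suc d)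
    extend-old x y d l with suc d ℕ.≟ suc N
    ... | yes p = ⊥-elim (ℕ.<-irrefl (ℕ.suc-injective p) l)
    ... | no _ = refl

    extend-new : {A : Set} (x : ℕ → A) (y : A) → extend x y (suc N) ≡ y
    extend-new x y with suc N ℕ.≟ suc N
    ... | yes _ = refl
    ... | no n = ⊥-elim (n refl)

    Ψ′ = extend Ψ r
    e′ = extend e (proj₁ r-monic)

    ∏-old : ∀ n → n ℕ.≤ N → ∏ Ψ n (_∣ᵇ suc n) ≋ ∏ Ψ′ n (_∣ᵇ suc n)
    ∏-old n l = ∏-cong {s = _∣ᵇ suc n} n (λ d k _ → ≋-reflexive (sym (extend-old Ψ r d (ℕ.≤-trans k l)))) (λ _ _ → refl)

    extended : Factorization (suc N)
    extended = record { Ψ = Ψ′ ; e = e′ ; monic = monic′ ; product = product′ ; comax = comax′ }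
      where
      monic′ : ∀ d → d ℕ.< suc N → MonicOf (e′ (suc d)) (Ψ′ (suc d))
      monic′ d l with ℕ.m<1+n⇒m<n∨m≡n l
      ... | inj₁ k rewrite extend-old Ψ r d k | extend-old e (proj₁ r-monic) d k = monic d k
      ... | inj₂ refl rewrite extend-new Ψ r | extend-new e (proj₁ r-monic) = proj₁ (proj₂ r-monic)
      product′ : ∀ n → n ℕ.< suc N → U (suc n) ≋ Ψ′ (suc n) *ₚ ∏ Ψ′ n (_∣ᵇ suc n)
      product′ n l with ℕ.m<1+n⇒m<n∨m≡n l
      ... | inj₁ k rewrite extend-old Ψ r n k = ≋-trans (product n k) (*-congʳ (Ψ (suc n)) (∏-old n (ℕ.<⇒≤ k)))
      ... | inj₂ refl rewrite extend-new Ψ r = ≋-trans (proj₂ W∣U) (*-congʳ r (∏-old n ℕ.≤-refl))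
      comax′ : ∀ m n → m ℕ.< n → n ℕ.< suc N → Comax (Ψ′ (suc m)) (Ψ′ (suc n))
      comax′ m n m<n l with ℕ.m<1+n⇒m<n∨m≡n l
      ... | inj₁ k rewrite extend-old Ψ r m (ℕ.<-trans m<n k) | extend-old Ψ r n k = comax m n m<n k
      ... | inj₂ refl rewrite extend-old Ψ r m m<n | extend-new Ψ r = r-comax m m<n

  factorization : ∀ N → Factorization N
  factorization zero = empty
  factorization (suc N) = Extend.extended (factorization N)

-- Norms of the new factors

below-suc : (R : ℕ → Set) → ∀ b → (∀ d → d ℕ.< b → R d) → R b → ∀ d → d ℕ.< suc b → R d
below-suc R b h r d l with ℕ.m<1+n⇒m<n∨m≡n l
... | inj₁ k = h d k
... | inj₂ refl = r

module NormRecursion (L : LucasParameters) {N : ℕ} (T : LucasParameters.Factorization L N) where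
  open LucasParameters L
  open Factorization T

  𝓝 : ℕ → Poly → ℤ
  𝓝 m g = Norm (e (suc m)) (Ψ (suc m)) g

  𝓝-product : ∀ {m} → m ℕ.< N → ∀ {g} f h → g ≋ f *ₚ h → 𝓝 m g ≡ 𝓝 m f * 𝓝 m h
  𝓝-product l f h p = trans (Norm-cong (monic _ l) p) (Norm-* (monic _ l) f h)

  𝓝-suc : ∀ {m} → suc m ℕ.< N → 𝓝 (suc m) (negₚ Q) ≡ 1ℤ → 𝓝 (suc m) (U (suc (suc (suc m)))) ≡ 𝓝 (suc m) (U (suc m))
  𝓝-suc {m} l unit = trans (Norm-mod (monic (suc m) l) (mod-weaken (Ψ∣U (suc m) l) (U-suc (suc m))))
    (trans (Norm-* (monic (suc m) l) (negₚ Q) (U (suc m)))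
      (trans (cong (_* 𝓝 (suc m) (U (suc m))) unit) (ℤ.*-identityˡ _)))

  𝓝-% : ∀ {m} → m ℕ.< N → ∀ n → 𝓝 m (U n) ≡ 𝓝 m (U (suc (suc m))) ℤ.^ (n / suc m) * 𝓝 m (U (n % suc m))
  𝓝-% {m} l n = trans (Norm-mod (monic m l) (mod-weaken (Ψ∣U m l) (U-mod m n)))
    (trans (Norm-* (monic m l) (U (suc (suc m)) ^ₚ (n / suc m)) (U (n % suc m)))
      (cong (_* 𝓝 m (U (n % suc m))) (Norm-^ (monic m l) (U (suc (suc m))) (n / suc m))))

  𝓝-ratio : ∀ {m} → m ℕ.< N → ∀ k →
    𝓝 m (ratio m (suc k)) ≡ (ℤ.+ suc k) ℤ.^ e (suc m) * 𝓝 m (U (suc (suc m))) ℤ.^ k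
  𝓝-ratio {m} l k = trans (Norm-mod (monic m l) (mod-weaken (Ψ∣U m l) (ratio-mod m k)))
    (trans (Norm-* (monic m l) (ℤ.+ suc k ∷ []) (U (suc (suc m)) ^ₚ k))
      (cong₂ _*_ (Norm-const (monic m l) (ℤ.+ suc k)) (Norm-^ (monic m l) (U (suc (suc m))) k)))

  𝓝-symmetric : ∀ {m n} → m ℕ.< N → n ℕ.< N → 𝓝 m (Ψ (suc n)) ≡ -1ℤ ℤ.^ (e (suc n) ℕ.* e (suc m)) * 𝓝 n (Ψ (suc m))
  𝓝-symmetric {m} {n} l k = Norm-symmetric (monic m l) (monic n k)

  𝓝-∏-nonzero : ∀ {m} n s → m ℕ.< n → n ℕ.< N → (∀ d → s (suc d) ≡ true → d ≢ m) → 𝓝 m (∏ Ψ n s) ≢ 0ℤ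
  𝓝-∏-nonzero {m} n s m<n n<N avoid = Norm-nonzero (monic m (ℕ.<-trans m<n n<N))
    (∏-closed (Comax (Ψ (suc m))) (comax-const 1≢0) comax-* {Ψ} {s} n coprime)
    where
    coprime : ∀ d → d ℕ.< n → s (suc d) ≡ true → Comax (Ψ (suc m)) (Ψ (suc d))
    coprime d l p with ℕ.<-cmp m d
    ... | tri< m<d _ _ = comax m d m<d (ℕ.<-trans l n<N)
    ... | tri≈ _ m≡d _ = ⊥-elim (avoid d p (sym m≡d))
    ... | tri> _ _ d<m = comax-sym (comax d m d<m (ℕ.<-trans m<n n<N))

  -- This recursion involves no parameter of the sequence, so the degrees agree for any two
  -- sequences: 0 at index 1, Euler's totient from index 2 on.
  degree-sum : ∀ n → n ℕ.< N → n ≡ e (suc n) ℕ.+ ∑ e n (_∣ᵇ suc n)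
  degree-sum n l = monicOf⇒degree (monicOf-≋ (product n l) (monic-U n))
    (monic-* (monic n l) (∏-monic {Ψ} {e} {_∣ᵇ suc n} n (λ d k → monic d (ℕ.<-trans k l))))

module Comparison (L L′ : LucasParameters) {N : ℕ}
  (T : LucasParameters.Factorization L N) (T′ : LucasParameters.Factorization L′ N)
  (unit : ∀ m → suc m ℕ.< N → NormRecursion.𝓝 L T (suc m) (negₚ (LucasParameters.Q L)) ≡ 1ℤ)
  (unit′ : ∀ m → suc m ℕ.< N → NormRecursion.𝓝 L′ T′ (suc m) (negₚ (LucasParameters.Q L′)) ≡ 1ℤ) where

  private
    module S = LucasParameters L
    module S′ = LucasParameters L′
    module Fac = LucasParameters.Factorization T
    module Fac′ = LucasParameters.Factorization T′
    module R = NormRecursion L T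
    module R′ = NormRecursion L′ T′

  degrees-below : ∀ b → b ℕ.≤ N → ∀ d → d ℕ.< b → Fac.e (suc d) ≡ Fac′.e (suc d)
  degrees-below zero _ d ()
  degrees-below (suc b) l = below-suc _ b IH (ℕ.+-cancelʳ-≡ (∑ Fac.e b s) _ _ (trans (sym (R.degree-sum b l))
      (trans (R′.degree-sum b l) (cong (Fac′.e (suc b) ℕ.+_) (sym (∑-cong {s = s} b IH))))))
    where
    s = _∣ᵇ suc b
    IH = degrees-below b (ℕ.<⇒≤ l)

  degrees : ∀ d → d ℕ.< N → Fac.e (suc d) ≡ Fac′.e (suc d)
  degrees = degrees-below N ℕ.≤-refl

  module Step (n : ℕ) (n<N : n ℕ.< N)
    (IH : ∀ m k → m ℕ.< k → k ℕ.< n → R.𝓝 m (Fac.Ψ (suc k)) ≡ R′.𝓝 m (Fac′.Ψ (suc k)))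
    (m : ℕ) (m<n : suc m ℕ.< n) where

    m<N : suc m ℕ.< N
    m<N = ℕ.<-trans m<n n<N

    V = S.U (suc (suc (suc m)))
    V′ = S′.U (suc (suc (suc m)))

    -- The induction hypothesis takes the smaller index as modulus. The other order follows by
    -- symmetry; its sign depends only on degrees, and these agree.
    earlier : ∀ d → d ℕ.< n → d ≢ suc m → R.𝓝 (suc m) (Fac.Ψ (suc d)) ≡ R′.𝓝 (suc m) (Fac′.Ψ (suc d))
    earlier d d<n d≢m with ℕ.<-cmp (suc m) d
    ... | tri< m<d _ _ = IH (suc m) d m<d d<n
    ... | tri≈ _ m≡d _ = ⊥-elim (d≢m (sym m≡d))
    ... | tri> _ _ d<m = trans (R.𝓝-symmetric m<N d<N) (trans
        (cong₂ _*_ (cong₂ (λ a b → -1ℤ ℤ.^ (a ℕ.* b)) (degrees d d<N) (degrees (suc m) m<N)) (IH d (suc m) d<m m<n))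
        (sym (R′.𝓝-symmetric m<N d<N)))
      where
      d<N = ℕ.<-trans d<n n<N

    products : ∀ k s → k ℕ.≤ n → (∀ d → d ℕ.< k → s (suc d) ≡ true → d ≢ suc m) →
      R.𝓝 (suc m) (∏ Fac.Ψ k s) ≡ R′.𝓝 (suc m) (∏ Fac′.Ψ k s)
    products k s l avoid = ∏-Norm {Ψ = Fac.Ψ} {Fac′.Ψ} {s} (Fac.monic (suc m) m<N) (Fac′.monic (suc m) m<N) k
      (λ d d<k p → earlier d (ℕ.≤-trans d<k l) (avoid d d<k p))

    lucas : ∀ k → k ℕ.< suc m → R.𝓝 (suc m) (S.U (suc k)) ≡ R′.𝓝 (suc m) (S′.U (suc k))
    lucas k l = trans (Norm-cong (Fac.monic (suc m) m<N) (Fac.full-product k k<N))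
      (trans (products (suc k) (_∣ᵇ suc k) (ℕ.≤-trans l (ℕ.<⇒≤ m<n)) (λ d d<k _ d≡m → ℕ.<⇒≢ (ℕ.<-≤-trans d<k l) d≡m))
        (sym (Norm-cong (Fac′.monic (suc m) m<N) (Fac′.full-product k k<N))))
      where
      k<N = ℕ.<-trans l m<N

    next : R.𝓝 (suc m) V ≡ R′.𝓝 (suc m) V′
    next = trans (R.𝓝-suc m<N (unit m m<N)) (trans (lucas m ℕ.≤-refl) (sym (R′.𝓝-suc m<N (unit′ m m<N))))

    -- The earlier factors selected by `s` have equal norms in both sequences, and `avoid` makes
    -- their product coprime to the modulus, so this norm is nonzero and can be cancelled.
    cancel : ∀ s {g g′} → R.𝓝 (suc m) g ≡ R′.𝓝 (suc m) g′ → (∀ d → s (suc d) ≡ true → d ≢ suc m) →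
      g ≋ Fac.Ψ (suc n) *ₚ ∏ Fac.Ψ n s → g′ ≋ Fac′.Ψ (suc n) *ₚ ∏ Fac′.Ψ n s →
      R.𝓝 (suc m) (Fac.Ψ (suc n)) ≡ R′.𝓝 (suc m) (Fac′.Ψ (suc n))
    cancel s {g} {g′} eq avoid p p′ = ℤ.*-cancelʳ-≡ _ _ (R.𝓝 (suc m) (∏ Fac.Ψ n s)) (begin
      R.𝓝 (suc m) (Fac.Ψ (suc n)) * R.𝓝 (suc m) (∏ Fac.Ψ n s) ≡⟨ R.𝓝-product m<N (Fac.Ψ (suc n)) (∏ Fac.Ψ n s) p ⟨
      R.𝓝 (suc m) g ≡⟨ eq ⟩
      R′.𝓝 (suc m) g′ ≡⟨ R′.𝓝-product m<N (Fac′.Ψ (suc n)) (∏ Fac′.Ψ n s) p′ ⟩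
      R′.𝓝 (suc m) (Fac′.Ψ (suc n)) * R′.𝓝 (suc m) (∏ Fac′.Ψ n s)
        ≡⟨ cong (R′.𝓝 (suc m) (Fac′.Ψ (suc n)) *_) (products n s ℕ.≤-refl (λ d _ → avoid d)) ⟨
      R′.𝓝 (suc m) (Fac′.Ψ (suc n)) * R.𝓝 (suc m) (∏ Fac.Ψ n s) ∎)
      where
      open ≡-Reasoning
      instance
        nonzero = ℤ.≢-nonZero (R.𝓝-∏-nonzero n s m<n n<N avoid)

    -- When `suc (suc m)` divides `suc n`, the product for `U (suc n)` contains the modulus itself
    -- and nothing can be cancelled; the ratio takes its place. Otherwise `U (suc n)` reduces to a
    -- term of smaller index than the modulus.
    step : R.𝓝 (suc m) (Fac.Ψ (suc n)) ≡ R′.𝓝 (suc m) (Fac′.Ψ (suc n))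
    step with suc (suc m) ∣? suc n
    ... | yes (divides (suc k) n≡km) = cancel s {S.ratio (suc m) (suc k)} {S′.ratio (suc m) (suc k)}
        (trans (R.𝓝-ratio m<N k) (trans (cong₂ (λ a b → (ℤ.+ suc k) ℤ.^ a * b ℤ.^ k) (degrees (suc m) m<N) next) (sym (R′.𝓝-ratio m<N k))))
        avoid
        (S.ratio-product {Fac.Ψ} {Fac.Ψ (suc n)} {k = suc k} m<n n≡km (Fac.product n n<N) (Fac.full-product (suc m) m<N))
        (S′.ratio-product {Fac′.Ψ} {Fac′.Ψ (suc n)} {k = suc k} m<n n≡km (Fac′.product n n<N) (Fac′.full-product (suc m) m<N))
      where
      s = λ d → (d ∣ᵇ suc n) ∧ not (d ∣ᵇ suc (suc m))
      avoid : ∀ d → s (suc d) ≡ true → d ≢ suc m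
      avoid .(suc m) p refl rewrite ∣ᵇ-true {suc (suc m)} {suc (suc m)} ℕ∣.∣-refl with suc (suc m) ∣ᵇ suc n
      avoid .(suc m) () refl | true
      avoid .(suc m) () refl | false
    ... | no ∤n = cancel s {S.U (suc n)} {S′.U (suc n)}
        (trans (R.𝓝-% m<N (suc n)) (trans
          (cong₂ (λ a b → a ℤ.^ (suc n / suc (suc m)) * b) next (residue (suc n % suc (suc m)) refl (m%n<n (suc n) (suc (suc m)))))
          (sym (R′.𝓝-% m<N (suc n)))))
        (λ d p d≡m → ∤n (subst (λ x → suc x ∣ suc n) d≡m (∣ᵇ-sound (suc d) (suc n) p)))
        (Fac.product n n<N) (Fac′.product n n<N)
      where
      s = _∣ᵇ suc n
      residue : ∀ r → suc n % suc (suc m) ≡ r → r ℕ.< suc (suc m) → R.𝓝 (suc m) (S.U r) ≡ R′.𝓝 (suc m) (S′.U r)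
      residue zero r≡0 _ = ⊥-elim (∤n (ℕ∣.m%n≡0⇒n∣m (suc n) (suc (suc m)) r≡0))
      residue (suc r) _ (s≤s l) = lucas r l

  norms-below : ∀ b → b ℕ.≤ N → ∀ n → n ℕ.< b → ∀ m → m ℕ.< n → R.𝓝 m (Fac.Ψ (suc n)) ≡ R′.𝓝 m (Fac′.Ψ (suc n))
  norms-below zero _ n ()
  norms-below (suc b) l = below-suc _ b IH last
    where
    IH = norms-below b (ℕ.<⇒≤ l)
    last : ∀ m → m ℕ.< b → R.𝓝 m (Fac.Ψ (suc b)) ≡ R′.𝓝 m (Fac′.Ψ (suc b))
    last (suc m) m<b = Step.step b l (λ m k m<k k<b → IH k k<b m m<k) m m<b
    -- The factor of index 1 has degree 0, so both norms are empty determinants.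
    last zero 0<b = trans (constant (R.degree-sum 0 0<N)) (sym (constant (R′.degree-sum 0 0<N)))
      where
      0<N = ℕ.<-≤-trans 0<b (ℕ.<⇒≤ l)
      constant : ∀ {p f g} → 0 ≡ p ℕ.+ 0 → Norm p f g ≡ 1ℤ
      constant {zero} _ = refl

  norms : ∀ m n → m ℕ.< n → n ℕ.< N → R.𝓝 m (Fac.Ψ (suc n)) ≡ R′.𝓝 m (Fac′.Ψ (suc n))
  norms m n m<n n<N = norms-below N ℕ.≤-refl n n<N m m<n

-- Irreducible polynomials

AllDivisible : ℤ → Poly → Set
AllDivisible c f = ∀ i → c ℤ∣.∣ coeff f i

allDivisible⇒• : ∀ {c} f → AllDivisible c f → Σ Poly λ g → f ≋ c • g
allDivisible⇒• [] h = [] , ≋-refl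
allDivisible⇒• {c} (a ∷ f) h with h 0 | allDivisible⇒• f (λ i → h (suc i))
... | ℤ∣.divides b e | g , p = b ∷ g , ∷-cong (trans e (ℤ.*-comm b c)) p

∣0 : ∀ c → c ℤ∣.∣ 0ℤ
∣0 c = ℤ∣.divides 0ℤ (sym (ℤ.*-zeroˡ c))

prime-∣-* : ∀ {p} → Prime p → ∀ a b → (ℤ.+ p) ℤ∣.∣ a * b → (ℤ.+ p) ℤ∣.∣ a ⊎ (ℤ.+ p) ℤ∣.∣ b
prime-∣-* {p} pr a b h with Primality.euclidsLemma ℤ.∣ a ∣ ℤ.∣ b ∣ pr
  (subst (p ∣_) (ℤ.abs-* a b) (ℤ∣.∣⇒∣ᵤ h))
... | inj₁ k = inj₁ (ℤ∣.∣ᵤ⇒∣ k)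
... | inj₂ k = inj₂ (ℤ∣.∣ᵤ⇒∣ k)

-- The prime divides the product of the two constant terms, hence one of them. Dropping that term
-- from its list changes the remaining coefficients of the product by multiples of `p` only, so
-- induction on the two lists applies.
gauss : ∀ {p} → Prime p → ∀ f g → AllDivisible (ℤ.+ p) (f *ₚ g) → AllDivisible (ℤ.+ p) f ⊎ AllDivisible (ℤ.+ p) g
gauss {p} pr [] g h = inj₁ λ _ → ∣0 (ℤ.+ p)
gauss {p} pr (a ∷ f) g h = inner g h
  where
  inner : ∀ g → AllDivisible (ℤ.+ p) ((a ∷ f) *ₚ g) → AllDivisible (ℤ.+ p) (a ∷ f) ⊎ AllDivisible (ℤ.+ p) g
  inner [] h = inj₂ λ _ → ∣0 (ℤ.+ p)
  inner (b ∷ g) h with prime-∣-* pr a b (subst ((ℤ.+ p) ℤ∣.∣_) (ℤ.+-identityʳ (a * b)) (h 0))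
  ... | inj₁ p∣a = Sum.map₁ (λ q → λ { zero → p∣a ; (suc i) → q i }) (gauss pr f (b ∷ g) (λ i → ℤ∣.∣m+n∣m⇒∣n
    (subst ((ℤ.+ p) ℤ∣.∣_) (coeff-*-suc a f (b ∷ g) i) (h (suc i))) (ℤ∣.∣m⇒∣m*n (coeff g i) p∣a)))
  ... | inj₂ p∣b = Sum.map₂ (λ q → λ { zero → p∣b ; (suc i) → q i }) (inner g (λ i → ℤ∣.∣m+n∣m⇒∣n
    (subst ((ℤ.+ p) ℤ∣.∣_) (trans (*-∷ʳ (a ∷ f) b g .at (suc i))
      (trans (coeff-+ (b • f) ((a ∷ f) *ₚ g) i) (cong (_+ coeff ((a ∷ f) *ₚ g) i) (coeff-• b f i)))) (h (suc i)))
    (ℤ∣.∣m⇒∣m*n (coeff f i) p∣b)))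

•-cancel : ∀ {c f g} → c ≢ 0ℤ → c • f ≋ c • g → f ≋ g
•-cancel {c} {f} {g} c≢0 e .at i = ℤ.*-cancelˡ-≡ c (coeff f i) (coeff g i)
  (trans (sym (coeff-• c f i)) (trans (e .at i) (coeff-• c g i)))
  where
  instance
    nonzero = ℤ.≢-nonZero c≢0

•-*ʳ : ∀ c f g → f *ₚ (c • g) ≋ c • (f *ₚ g)
•-*ʳ c f g = ≋-trans (*-comm f (c • g)) (≋-trans (•-*ˡ c g f) (•-cong {c = c} refl (*-comm g f)))

unit-square : ∀ a → ℤ.∣ a ∣ ≡ 1 → a * a ≡ 1ℤ
unit-square (ℤ.+ suc zero) refl = refl
unit-square -[1+ zero ] refl = refl

prime-divisor : ∀ n → Σ ℕ λ p → Prime p × p ∣ suc (suc n)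
prime-divisor n with factorise (suc (suc n))
... | record { factors = [] ; isFactorisation = () }
... | record { factors = p ∷ ps ; isFactorisation = e ; factorsPrime = pr ∷ _ } =
  p , pr , divides (listProduct ps) (trans e (ℕ.*-comm p (listProduct ps)))

-- Descent of a factorization from ℚ[x] to ℤ[x]: by `gauss`, each prime divisor of `a` divides all
-- of `r` or all of `s` and is cancelled there. The content `c` removed from `r` is recorded, so
-- that `r′` can be compared with `r` afterwards; `n` bounds the recursion on the absolute value of
-- `a`.
clear-constant : ∀ n a {q r s} → ℤ.∣ a ∣ ℕ.< n → a ≢ 0ℤ → a • q ≋ r *ₚ s →
  Σ ℤ λ c → Σ Poly λ r′ → Σ Poly λ s′ → r ≋ c • r′ × q ≋ r′ *ₚ s′
clear-constant (suc n) a {q} {r} {s} l a≢0 e = by-size ℤ.∣ a ∣ refl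
  where
  by-size : ∀ k → ℤ.∣ a ∣ ≡ k → Σ ℤ λ c → Σ Poly λ r′ → Σ Poly λ s′ → r ≋ c • r′ × q ≋ r′ *ₚ s′
  by-size zero eq = ⊥-elim (a≢0 (ℤ.∣i∣≡0⇒i≡0 eq))
  by-size (suc zero) eq = 1ℤ , r , a • s , ≋-sym (1• r) , (begin
    q ≈⟨ 1• q ⟨
    1ℤ • q ≡⟨ cong (_• q) (unit-square a eq) ⟨
    (a * a) • q ≈⟨ •-assoc a a q ⟩
    a • a • q ≈⟨ •-cong {c = a} refl e ⟩
    a • (r *ₚ s) ≈⟨ •-*ʳ a r s ⟨
    r *ₚ (a • s) ∎)
    where open ≋-Reasoning
  by-size (suc (suc k)) eq with prime-divisor k
  ... | p , pr , p∣k with ℤ∣.∣ᵤ⇒∣ {ℤ.+ p} {a} (subst (p ∣_) (sym eq) p∣k)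
  ... | ℤ∣.divides b a≡bp with gauss pr r s (λ i → subst ((ℤ.+ p) ℤ∣.∣_)
      (trans (sym (coeff-• a q i)) (e .at i)) (ℤ∣.∣m⇒∣m*n (coeff q i) (ℤ∣.divides b a≡bp)))
  ... | split = continue split
    where
    b≢0 : b ≢ 0ℤ
    b≢0 b≡0 = a≢0 (trans a≡bp (trans (cong (_* (ℤ.+ p)) b≡0) (ℤ.*-zeroˡ (ℤ.+ p))))
    p≢0 : ℤ.+ p ≢ 0ℤ
    p≢0 p≡0 = a≢0 (trans a≡bp (trans (cong (b *_) p≡0) (ℤ.*-zeroʳ b)))
    smaller : ℤ.∣ b ∣ ℕ.< n
    smaller = ℕ.<-≤-trans (subst (ℤ.∣ b ∣ ℕ.<_) (sym (trans (cong ℤ.∣_∣ a≡bp) (ℤ.abs-* b (ℤ.+ p))))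
      (ℕ.m<m*n ℤ.∣ b ∣ p {{ℕ.≢-nonZero (λ z → b≢0 (ℤ.∣i∣≡0⇒i≡0 z))}}
        (ℕ.nonTrivial⇒n>1 p {{Primality.prime⇒nonTrivial pr}}))) (ℕ.s≤s⁻¹ l)
    b•q : (ℤ.+ p) • (b • q) ≋ r *ₚ s
    b•q = ≋-trans (≋-sym (•-assoc (ℤ.+ p) b q)) (≋-trans (•-cong {f = q} (trans (ℤ.*-comm (ℤ.+ p) b) (sym a≡bp)) ≋-refl) e)
    continue : AllDivisible (ℤ.+ p) r ⊎ AllDivisible (ℤ.+ p) s → Σ ℤ λ c → Σ Poly λ r′ → Σ Poly λ s′ → r ≋ c • r′ × q ≋ r′ *ₚ s′
    continue (inj₁ h) with allDivisible⇒• r h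
    ... | r₁ , e₁ with clear-constant n b {q} {r₁} {s} smaller b≢0 (•-cancel p≢0 (≋-trans b•q (≋-trans (*-congˡ s e₁) (•-*ˡ (ℤ.+ p) r₁ s))))
    ... | c , r′ , s′ , e₂ , e₃ = (ℤ.+ p) * c , r′ , s′ ,
      ≋-trans e₁ (≋-trans (•-cong {c = ℤ.+ p} refl e₂) (≋-sym (•-assoc (ℤ.+ p) c r′))) , e₃
    continue (inj₂ h) with allDivisible⇒• s h
    ... | s₁ , e₁ = clear-constant n b {q} {r} {s₁} smaller b≢0 (•-cancel p≢0 (≋-trans b•q (≋-trans (*-congʳ r e₁) (•-*ʳ (ℤ.+ p) r s₁))))

-- The leading coefficient of `r` need not be a unit, so each coefficient of `h` costs one more
-- factor `coeff r d` in the multiplier.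
pseudo-division : ∀ {d r} → coeff r d ≢ 0ℤ → Deg< (suc d) r → ∀ h →
  Σ ℤ λ c → Σ Poly λ s → Σ Poly λ t → c ≢ 0ℤ × c • h ≋ s *ₚ r +ₚ t × Deg< d t
pseudo-division l dr [] = 1ℤ , [] , [] , 1≢0 , ≋-refl , λ _ _ → refl
pseudo-division {d} {r} l dr (a ∷ h) with pseudo-division {d} {r} l dr h
... | c , s , t , c≢0 , e , dt = k * c , k • (0ℤ ∷ s) +ₚ (τ ∷ []) , k • t₁ -ₚ τ • r , *≢0 l c≢0 , identity , small
  where
  k = coeff r d
  t₁ = c * a ∷ t
  τ = coeff t₁ d
  identity : (k * c) • (a ∷ h) ≋ (k • (0ℤ ∷ s) +ₚ (τ ∷ [])) *ₚ r +ₚ (k • t₁ -ₚ τ • r)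
  identity = begin
    (k * c) • (a ∷ h) ≈⟨ •-assoc k c (a ∷ h) ⟩
    k • c • (a ∷ h) ≈⟨ •-cong {c = k} refl (∷-cong (sym (ℤ.+-identityˡ (c * a))) e) ⟩
    k • ((0ℤ ∷ s *ₚ r) +ₚ t₁) ≈⟨ •-distribˡ k (0ℤ ∷ s *ₚ r) t₁ ⟩
    k • (0ℤ ∷ s *ₚ r) +ₚ k • t₁ ≈⟨ +-cong (•-cong {c = k} refl (≋-sym (shift-* s r))) ≋-refl ⟩
    k • ((0ℤ ∷ s) *ₚ r) +ₚ k • t₁ ≈⟨ +-cong (≋-sym (•-*ˡ k (0ℤ ∷ s) r)) ≋-refl ⟩
    (k • (0ℤ ∷ s)) *ₚ r +ₚ k • t₁ ≈⟨ lem (k • (0ℤ ∷ s)) r (τ ∷ []) (k • t₁) ⟩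
    (k • (0ℤ ∷ s) +ₚ (τ ∷ [])) *ₚ r +ₚ (k • t₁ -ₚ (τ ∷ []) *ₚ r) 
      ≈⟨ +-cong (≋-refl {(k • (0ℤ ∷ s) +ₚ (τ ∷ [])) *ₚ r}) (+-cong (≋-refl {k • t₁}) (neg-cong (const-* τ r))) ⟩
    (k • (0ℤ ∷ s) +ₚ (τ ∷ [])) *ₚ r +ₚ (k • t₁ -ₚ τ • r) ∎
    where
    open ≋-Reasoning
    lem : ∀ u r v w → u *ₚ r +ₚ w ≋ (u +ₚ v) *ₚ r +ₚ (w -ₚ v *ₚ r)
    lem = Ring.solve-∀ polyACR
  coeffs : ∀ i → coeff (k • t₁ -ₚ τ • r) i ≡ k * coeff t₁ i - τ * coeff r i
  coeffs i = trans (coeff-- (k • t₁) (τ • r) i) (cong₂ _-_ (coeff-• k t₁ i) (coeff-• τ r i))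
  small₁ : Deg< (suc d) t₁
  small₁ (suc i) (s≤s m) = dt i m
  small : Deg< d (k • t₁ -ₚ τ • r)
  small i m with ℕ.m≤n⇒m<n∨m≡n m
  ... | inj₂ refl = trans (coeffs d) (lem k τ)
    where
    lem : ∀ x y → x * y - y * x ≡ 0ℤ
    lem = solve-∀
  ... | inj₁ n = trans (coeffs i) (trans (cong₂ (λ x y → k * x - τ * y) (small₁ i n) (dr i n)) (lem k τ))
    where
    lem : ∀ x y → x * 0ℤ - y * 0ℤ ≡ 0ℤ
    lem = solve-∀

unit-sign : ∀ {f} → IsUnit f → Σ ℤ λ ε → f ≋ ε ∷ [] × ε * ε ≡ 1ℤ
unit-sign (inj₁ e) = 1ℤ , ≈⇒≋ e , refl
unit-sign (inj₂ e) = -1ℤ , ≈⇒≋ e , refl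

unit-absorb : ∀ {f u} g → IsUnit u → f ≋ g *ₚ u → Σ ℤ λ ε → g ≋ ε • f
unit-absorb {f} {u} g iu e with unit-sign iu
... | ε , u≋ε , εε = ε , (begin
  g ≈⟨ 1• g ⟨
  1ℤ • g ≡⟨ cong (_• g) εε ⟨
  (ε * ε) • g ≈⟨ •-assoc ε ε g ⟩
  ε • ε • g ≈⟨ •-cong {c = ε} refl (≋-sym (const-* ε g)) ⟩
  ε • ((ε ∷ []) *ₚ g) ≈⟨ •-cong {c = ε} refl (≋-trans (*-comm (ε ∷ []) g) (*-congʳ g (≋-sym u≋ε))) ⟩
  ε • (g *ₚ u) ≈⟨ •-cong {c = ε} refl (≋-sym e) ⟩
  ε • f ∎)
  where open ≋-Reasoning

Deg<1⇒const : ∀ {f} → Deg< 1 f → f ≋ coeff f 0 ∷ []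
Deg<1⇒const d .at zero = refl
Deg<1⇒const d .at (suc i) = d (suc i) (s≤s z≤n)

degree-bound : ∀ {d f} → Deg< d f → f ≋ [] ⊎ Σ ℕ λ a → a ℕ.< d × coeff f a ≢ 0ℤ × Deg< (suc a) f
degree-bound {d} {f} h with degree f
... | inj₁ z = inj₁ z
... | inj₂ (a , l , k) = inj₂ (a , ℕ.≰⇒> (λ d≤a → l (h a d≤a)) , l , k)

-- Euclid's algorithm on the ideal (q, g), by pseudo-division.
irreducible-dichotomy : ∀ {p q} → MonicOf p q → Irreducible q → ∀ g → q ∣≋ g ⊎ Comax q g
irreducible-dichotomy {p} {q} mq (_ , _ , irr) g =
  euclid (suc p) p ℕ.≤-refl q oneₚ [] (λ e → 1≢0 (trans (sym (mq .leading)) e)) (mq .above)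
    (≋-trans (≋-sym (*-identityˡ q)) (≋-sym (+-identityʳ (oneₚ *ₚ q))))
  where
  euclid : ∀ n d → d ℕ.< n → ∀ r u v → coeff r d ≢ 0ℤ → Deg< (suc d) r → r ≋ u *ₚ q +ₚ v *ₚ g → q ∣≋ g ⊎ Comax q g
  euclid (suc n) zero _ r u v l dr e = inj₂ (coeff r 0 , l , u , v , ≋-trans (≋-sym e) (Deg<1⇒const {r} dr))
  euclid (suc n) (suc d) d<n r u v l dr e with pseudo-division {suc d} {r} l dr q | pseudo-division {suc d} {r} l dr g
  ... | c , s , t , c≢0 , eq , dt | c′ , s′ , t′ , c′≢0 , eq′ , dt′ with degree-bound {suc d} {t} dt | degree-bound {suc d} {t′} dt′
  ... | inj₂ (a , a<d , la , da) | _ = euclid n a (ℕ.<-≤-trans a<d (ℕ.s≤s⁻¹ d<n)) t ((c ∷ []) -ₚ s *ₚ u) (negₚ (s *ₚ v)) la da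
    (≋-trans (lem t s r) (≋-trans (+-cong (≋-trans (≋-sym eq) (≋-sym (const-* c q))) (neg-cong (*-congʳ s e))) (lem′ (c ∷ []) s u v q g)))
    where
    lem : ∀ t s r → t ≋ s *ₚ r +ₚ t -ₚ s *ₚ r
    lem = Ring.solve-∀ polyACR
    lem′ : ∀ c s u v q g → c *ₚ q -ₚ s *ₚ (u *ₚ q +ₚ v *ₚ g) ≋ (c -ₚ s *ₚ u) *ₚ q +ₚ negₚ (s *ₚ v) *ₚ g
    lem′ = Ring.solve-∀ polyACR
  ... | inj₁ _ | inj₂ (a , a<d , la , da) = euclid n a (ℕ.<-≤-trans a<d (ℕ.s≤s⁻¹ d<n)) t′ (negₚ (s′ *ₚ u)) ((c′ ∷ []) -ₚ s′ *ₚ v) la da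
    (≋-trans (lem t′ s′ r) (≋-trans (+-cong (≋-trans (≋-sym eq′) (≋-sym (const-* c′ g))) (neg-cong (*-congʳ s′ e))) (lem′ (c′ ∷ []) s′ u v q g)))
    where
    lem : ∀ t s r → t ≋ s *ₚ r +ₚ t -ₚ s *ₚ r
    lem = Ring.solve-∀ polyACR
    lem′ : ∀ c s u v q g → c *ₚ g -ₚ s *ₚ (u *ₚ q +ₚ v *ₚ g) ≋ negₚ (s *ₚ u) *ₚ q +ₚ (c -ₚ s *ₚ v) *ₚ g
    lem′ = Ring.solve-∀ polyACR
  -- Now `r` divides constant multiples of both `q` and `g`. Clearing the constant factors `q` as
  -- `r₁ *ₚ s₁`; since `r` has positive degree, `r₁` is no unit, so `s₁` is one. Hence `r` is a
  -- constant multiple of `q`, and `q` divides `g`.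
  ... | inj₁ t≋0 | inj₁ t′≋0 with clear-constant (suc ℤ.∣ c ∣) c {q} {r} {s} ℕ.≤-refl c≢0
      (≋-trans eq (≋-trans (+-cong ≋-refl t≋0) (≋-trans (+-identityʳ (s *ₚ r)) (*-comm s r))))
  ... | k , r₁ , s₁ , r≋kr₁ , q≋r₁s₁ with irr r₁ s₁ (norm-cong q≋r₁s₁)
  ...   | inj₁ unit = ⊥-elim (l (trans (r≋kr₁ .at (suc d)) (trans (coeff-• k r₁ (suc d))
          (trans (cong (k *_) (proj₁ (proj₂ (unit-sign {r₁} unit)) .at (suc d))) (ℤ.*-zeroʳ k)))))
  ...   | inj₂ unit with unit-absorb r₁ unit q≋r₁s₁
  ...     | ε , r₁≋εq = inj₁ (monic-∣-const-* mq c′≢0 (∣≋-cong (≋-sym (≋-trans (const-* c′ g)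
            (≋-trans eq′ (≋-trans (+-cong ≋-refl t′≋0) (+-identityʳ (s′ *ₚ r)))))) (∣≋-*ˡ s′ q∣r)))
    where
    q∣r : q ∣≋ r
    q∣r = (k * ε) ∷ [] , ≋-trans r≋kr₁ (≋-trans (•-cong {c = k} refl r₁≋εq)
      (≋-trans (≋-sym (•-assoc k ε q)) (≋-sym (const-* (k * ε) q))))

∣≋⇒∣ₚ : ∀ {q f} → q ∣≋ f → q ∣ₚ f
∣≋⇒∣ₚ {q} (r , e) = r , norm-cong (≋-trans e (*-comm r q))

∣ₚ⇒∣≋ : ∀ {q f} → q ∣ₚ f → q ∣≋ f
∣ₚ⇒∣≋ {q} (r , e) = r , ≋-trans (≈⇒≋ e) (*-comm q r)

unit? : ∀ f → Dec (IsUnit f)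
unit? f = List.≡-dec ℤ._≟_ (norm f) (norm oneₚ) ⊎-dec List.≡-dec ℤ._≟_ (norm f) (norm (-1ℤ ∷ []))

unit-inverse : ∀ a b → a * b ≡ 1ℤ → a * a ≡ 1ℤ
unit-inverse a b e = unit-square a (ℕ.m*n≡1⇒m≡1 ℤ.∣ a ∣ ℤ.∣ b ∣ (trans (sym (ℤ.abs-* a b)) (cong ℤ.∣_∣ e)))

const-unit : ∀ {a f} → a * a ≡ 1ℤ → f ≋ a ∷ [] → IsUnit f
const-unit {ℤ.+ suc zero} _ e = inj₁ (norm-cong e)
const-unit { -[1+ zero ]} _ e = inj₂ (norm-cong e)
const-unit {ℤ.+ zero} () _
const-unit {ℤ.+ suc (suc n)} () _
const-unit { -[1+ suc n ]} () _

∣-one⇒degree-zero : ∀ {p q} → MonicOf p q → q ∣≋ oneₚ → p ≡ 0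
∣-one⇒degree-zero {p} {q} m (r , e) with monic-quotient {q = r} m (monicOf-≋ e monicOf-one)
... | a , _ , eq = ℕ.m+n≡0⇒n≡0 a (sym eq)

monicOf-zero : ∀ {f} → MonicOf 0 f → f ≋ oneₚ
monicOf-zero {f} m = ≋-trans (Deg<1⇒const {f} (m .above)) (∷-cong (m .leading) ≋-refl)

irreducible-degree : ∀ {p q} → MonicOf p q → Irreducible q → p ≢ 0
irreducible-degree m (_ , ¬unit , _) refl = ¬unit (inj₁ (norm-cong (monicOf-zero m)))

coprime-∤ : ∀ {p q f} → MonicOf p q → Irreducible q → Comax q f → ¬ q ∣≋ f
coprime-∤ {f = f} m irr c q∣f = irreducible-degree m irr (∣-one⇒degree-zero m
  (coprime-divides m c (∣≋-cong (≋-trans (≋-sym (*-identityˡ f)) (*-comm oneₚ f)) q∣f)))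

IrreducibleFactor : Poly → Set
IrreducibleFactor f = Σ Poly λ q → Monic q × Irreducible q × q ∣≋ f

-- If there were no such factor, `f` itself would be irreducible: a splitting into two nonunits
-- would give a monic factor of smaller positive degree, to which the recursion applies.
-- Irreducibility is refuted rather than decided here, whence the double negation.
irreducible-factor : ∀ n {p f} → p ℕ.< n → MonicOf (suc p) f → ¬ ¬ IrreducibleFactor f
irreducible-factor (suc n) {p} {f} p<n m none = none (f , monicOf⇒monic m , (nonzero , nonunit , irreducible) , ∣≋-refl)
  where
  nonzero : ¬ f ≈ []
  nonzero e = 1≢0 (trans (sym (m .leading)) (≈⇒≋ {f} {[]} e .at (suc p)))
  nonunit : ¬ IsUnit f
  nonunit u = 1≢0 (trans (sym (m .leading)) (proj₁ (proj₂ (unit-sign {f} u)) .at (suc p)))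
  irreducible : ∀ a b → f ≈ a *ₚ b → IsUnit a ⊎ IsUnit b
  irreducible a b f≈ab with unit? a | unit? b
  ... | yes u | _ = inj₁ u
  ... | no _ | yes u = inj₂ u
  ... | no a-nonunit | no b-nonunit with ≈⇒≋ {f} {a *ₚ b} f≈ab | degree a | degree b
  ... | f≋ab | inj₁ a≋0 | _ = ⊥-elim (nonzero (norm-cong (≋-trans f≋ab (*-zeroˡ b a≋0))))
  ... | f≋ab | inj₂ _ | inj₁ b≋0 = ⊥-elim (nonzero (norm-cong (≋-trans f≋ab (≋-trans (*-comm a b) (*-zeroˡ a b≋0)))))
  ... | f≋ab | inj₂ (α , la , da) | inj₂ (β , lb , db) with product-degree {f = a} {b} la da lb db (monicOf-≋ f≋ab m)
  ... | p≡α+β , lab with α | β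
  ... | zero | _ = ⊥-elim (a-nonunit (const-unit {coeff a 0} {a} (unit-inverse (coeff a 0) _ lab) (Deg<1⇒const {a} da)))
  ... | suc α′ | zero = ⊥-elim (b-nonunit (const-unit {coeff b 0} {b}
          (unit-inverse (coeff b 0) (coeff a (suc α′)) (trans (ℤ.*-comm (coeff b 0) (coeff a (suc α′))) lab)) (Deg<1⇒const {b} db)))
  ... | suc α′ | suc β′ = ⊥-elim (irreducible-factor n {α′} {ε • a} α′<n a-monic
          λ { (q , mq , irr , q∣a) → none (q , mq , irr , ∣≋-trans q∣a (ε • b , f-factor)) })
    where
    -- The leading coefficients of `a` and `b` multiply to 1, so `ε` is a sign that makes `a` monic.
    ε = coeff a (suc α′)
    εε = unit-inverse ε _ lab
    α′<n : α′ ℕ.< n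
    α′<n = ℕ.<-≤-trans (subst (α′ ℕ.<_) (sym (ℕ.suc-injective p≡α+β)) (ℕ.m<m+n α′ (s≤s z≤n))) (ℕ.s≤s⁻¹ p<n)
    a-monic : MonicOf (suc α′) (ε • a)
    a-monic = monicOf (trans (coeff-• ε a (suc α′)) εε) (Deg<-• {f = a} ε da)
    f-factor : f ≋ (ε • b) *ₚ (ε • a)
    f-factor = begin
      f ≈⟨ f≋ab ⟩
      a *ₚ b ≈⟨ *-comm a b ⟩
      b *ₚ a ≈⟨ 1• (b *ₚ a) ⟨
      1ℤ • (b *ₚ a) ≡⟨ cong (_• (b *ₚ a)) εε ⟨
      (ε * ε) • (b *ₚ a) ≈⟨ •-assoc ε ε (b *ₚ a) ⟩
      ε • ε • (b *ₚ a) ≈⟨ •-cong {c = ε} refl (•-*ʳ ε b a) ⟨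
      ε • (b *ₚ (ε • a)) ≈⟨ •-*ˡ ε b (ε • a) ⟨
      (ε • b) *ₚ (ε • a) ∎
      where open ≋-Reasoning

∣≋-*-mono : ∀ {f g f′ g′} → f ∣≋ g → f′ ∣≋ g′ → f *ₚ f′ ∣≋ g *ₚ g′
∣≋-*-mono {f} {f′ = f′} (q , e) (r , e′) = q *ₚ r , ≋-trans (*-cong e e′) (lem q f r f′)
  where
  lem : ∀ q f r f′ → q *ₚ f *ₚ (r *ₚ f′) ≋ q *ₚ r *ₚ (f *ₚ f′)
  lem = Ring.solve-∀ polyACR

-- Split off an irreducible factor: `f` is `f′ *ₚ q`, and by induction `g` is `l *ₚ f′`. As `f` is
-- squarefree, `q` does not divide `f′` and so is coprime to it; dividing `g`, it must divide `l`.
squarefree-divides : ∀ n {p f} g → p ℕ.< n → MonicOf p f →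
  (∀ q → Monic q → Irreducible q → ¬ q *ₚ q ∣≋ f) →
  (∀ q → Monic q → Irreducible q → q ∣≋ f → q ∣≋ g) → ¬ ¬ (f ∣≋ g)
squarefree-divides (suc n) {zero} {f} g _ m _ _ k =
  k (g , ≋-trans (≋-sym (≋-trans (*-comm g oneₚ) (*-identityˡ g))) (*-congʳ g (≋-sym (monicOf-zero m))))
squarefree-divides (suc n) {suc p} {f} g p<n m sqf h k = irreducible-factor (suc p) ℕ.≤-refl m step
  where
  step : ¬ IrreducibleFactor f
  step (q , mq , irr , q∣f@(f′ , e)) with monic-quotient {q = f′} (monic⇒monicOf mq) (monicOf-≋ e m)
  ... | a , mf′ , sum = squarefree-divides n g a<n mf′
      (λ r mr ir d → sqf r mr ir (∣≋-trans d f′∣f)) (λ r mr ir d → h r mr ir (∣≋-trans d f′∣f)) finish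
    where
    f′∣f : f′ ∣≋ f
    f′∣f = q , ≋-trans e (*-comm f′ q)
    positive : deg q ≢ 0
    positive = irreducible-degree (monic⇒monicOf {q} mq) irr
    a<n : a ℕ.< n
    a<n = ℕ.<-≤-trans (subst (a ℕ.<_) (sym sum) (ℕ.m<m+n a (ℕ.n≢0⇒n>0 positive))) (ℕ.s≤s⁻¹ p<n)
    finish : ¬ (f′ ∣≋ g)
    finish (l , g≋lf′) with irreducible-dichotomy (monic⇒monicOf mq) irr f′
    ... | inj₁ q∣f′ = sqf q mq irr (∣≋-cong (≋-sym e) (∣≋-*-mono q∣f′ (∣≋-refl {q})))
    ... | inj₂ c with coprime-divides {k = l} (monic⇒monicOf mq) c (∣≋-cong (≋-trans g≋lf′ (*-comm l f′)) (h q mq irr q∣f))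
    ...   | l′ , l≋l′q = k (l′ , ≋-trans g≋lf′ (≋-trans (*-congˡ f′ l≋l′q) (≋-trans (*-assoc l′ q f′)
              (*-congʳ l′ (≋-trans (*-comm q f′) (≋-sym e))))))

monic-∣-antisym : ∀ {p q f g} → MonicOf p f → MonicOf q g → f ∣≋ g → g ∣≋ f → f ≋ g
monic-∣-antisym {p} {q} {f} {g} mf mg (u , e) (v , e′) with monic-quotient {q = u} mf (monicOf-≋ e mg) | monic-quotient {q = v} mg (monicOf-≋ e′ mf)
... | a , mu , q≡ | b , _ , p≡ = ≋-sym (≋-trans e (≋-trans (*-congˡ f (monicOf-zero (subst (λ n → MonicOf n u) a≡0 mu))) (*-identityˡ f)))
  where
  a≡0 : a ≡ 0
  a≡0 = ℕ.n≤0⇒n≡0 (ℕ.+-cancelʳ-≤ p a 0 (subst (ℕ._≤ p) q≡ (subst (q ℕ.≤_) (sym p≡) (ℕ.m≤n+m q b))))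

-- Fibonacci polynomials are squarefree

-- The product rule in the form (a + x f)′ = f + x f′; exponents need not be counted.
derivative : Poly → Poly
derivative [] = []
derivative (a ∷ f) = f +ₚ (0ℤ ∷ derivative f)

coeff-derivative : ∀ f i → coeff (derivative f) i ≡ ℤ.+ suc i * coeff f (suc i)
coeff-derivative [] i = sym (ℤ.*-zeroʳ (ℤ.+ suc i))
coeff-derivative (a ∷ f) zero = trans (coeff-+ f (0ℤ ∷ derivative f) 0) (lem (coeff f 0))
  where
  lem : ∀ x → x + 0ℤ ≡ 1ℤ * x
  lem = solve-∀
coeff-derivative (a ∷ f) (suc i) = trans (coeff-+ f (0ℤ ∷ derivative f) (suc i))
  (trans (cong (coeff f (suc i) +_) (coeff-derivative f i)) (lem (coeff f (suc i)) (ℤ.+ suc i)))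
  where
  lem : ∀ x y → x + y * x ≡ (1ℤ + y) * x
  lem = solve-∀

derivative-cong : ∀ {f g} → f ≋ g → derivative f ≋ derivative g
derivative-cong {f} {g} e .at i = trans (coeff-derivative f i)
  (trans (cong (ℤ.+ suc i *_) (e .at (suc i))) (sym (coeff-derivative g i)))

derivative-linear : ∀ c f g → derivative (c • f +ₚ g) ≋ c • derivative f +ₚ derivative g
derivative-linear c f g .at i = trans (coeff-derivative (c • f +ₚ g) i)
  (trans (cong (ℤ.+ suc i *_) (coeff-linear (suc i) .linearᵃ c f g))
    (trans (lem (ℤ.+ suc i) c (coeff f (suc i)) (coeff g (suc i)))
      (sym (trans (coeff-linear i .linearᵃ c (derivative f) (derivative g))
        (cong₂ (λ x y → c * x + y) (coeff-derivative f i) (coeff-derivative g i))))))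
  where
  lem : ∀ k c x y → k * (c * x + y) ≡ c * (k * x) + k * y
  lem = solve-∀

leibniz : ∀ f g → derivative (f *ₚ g) ≋ derivative f *ₚ g +ₚ f *ₚ derivative g
leibniz [] g = ≋-refl
leibniz (a ∷ f) g = begin
  derivative (a • g +ₚ (0ℤ ∷ f *ₚ g)) ≈⟨ derivative-linear a g (0ℤ ∷ f *ₚ g) ⟩
  a • derivative g +ₚ (f *ₚ g +ₚ (0ℤ ∷ derivative (f *ₚ g)))
    ≈⟨ +-cong (≋-refl {a • derivative g}) (+-cong (≋-refl {f *ₚ g}) (∷-cong refl (leibniz f g))) ⟩
  a • derivative g +ₚ (f *ₚ g +ₚ ((0ℤ ∷ derivative f *ₚ g) +ₚ (0ℤ ∷ f *ₚ derivative g)))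
    ≈⟨ lem (a • derivative g) (f *ₚ g) (0ℤ ∷ derivative f *ₚ g) (0ℤ ∷ f *ₚ derivative g) ⟩
  f *ₚ g +ₚ (0ℤ ∷ derivative f *ₚ g) +ₚ (a • derivative g +ₚ (0ℤ ∷ f *ₚ derivative g))
    ≈⟨ +-cong (≋-trans (*-distribʳ g f (0ℤ ∷ derivative f)) (+-cong (≋-refl {f *ₚ g}) (shift-* (derivative f) g))) ≋-refl ⟨
  (f +ₚ (0ℤ ∷ derivative f)) *ₚ g +ₚ (a • derivative g +ₚ (0ℤ ∷ f *ₚ derivative g)) ∎
  where
  open ≋-Reasoning
  lem : ∀ w x y z → w +ₚ (x +ₚ (y +ₚ z)) ≋ x +ₚ y +ₚ (w +ₚ z)
  lem = Ring.solve-∀ polyACR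

square-∣⇒∣-derivative : ∀ {q f} → q *ₚ q ∣≋ f → q ∣≋ derivative f
square-∣⇒∣-derivative {q} {f} (r , e) = derivative r *ₚ q +ₚ r *ₚ (derivative q +ₚ derivative q) ,
  ≋-trans (derivative-cong e) (≋-trans (leibniz r (q *ₚ q)) (≋-trans (+-cong (≋-refl {derivative r *ₚ (q *ₚ q)}) (*-congʳ r (leibniz q q)))
    (lem (derivative r) r q (derivative q))))
  where
  lem : ∀ r′ r q q′ → r′ *ₚ (q *ₚ q) +ₚ r *ₚ (q′ *ₚ q +ₚ q *ₚ q′) ≋ (r′ *ₚ q +ₚ r *ₚ (q′ +ₚ q′)) *ₚ q
  lem = Ring.solve-∀ polyACR

two four : Poly
two = oneₚ +ₚ oneₚ
four = two +ₚ two

derivative-Fib-step : ∀ n → derivative (Fib (suc (suc n))) ≋ Fib (suc n) +ₚ X *ₚ derivative (Fib (suc n)) +ₚ derivative (Fib n)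
derivative-Fib-step n = begin
  derivative (X *ₚ F₁ +ₚ F₀) ≈⟨ derivative-cong (+-cong (1• (X *ₚ F₁)) ≋-refl) ⟨
  derivative (1ℤ • (X *ₚ F₁) +ₚ F₀) ≈⟨ derivative-linear 1ℤ (X *ₚ F₁) F₀ ⟩
  1ℤ • derivative (X *ₚ F₁) +ₚ derivative F₀ ≈⟨ +-cong (≋-trans (1• (derivative (X *ₚ F₁))) (leibniz X F₁)) ≋-refl ⟩
  derivative X *ₚ F₁ +ₚ X *ₚ derivative F₁ +ₚ derivative F₀
    ≈⟨ +-cong (+-cong (≋-trans (*-congˡ {derivative X} {oneₚ} F₁ (∷-cong refl 0∷[])) (*-identityˡ F₁)) ≋-refl) ≋-refl ⟩
  F₁ +ₚ X *ₚ derivative F₁ +ₚ derivative F₀ ∎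
  where
  open ≋-Reasoning
  F₀ = Fib n
  F₁ = Fib (suc n)

-- (x² + 4) Fₙ′ + x Fₙ = n (2 Fₙ₊₁ − x Fₙ), where 2 Fₙ₊₁ − x Fₙ is the n-th Lucas polynomial
derivative-Fib : ∀ n → (X *ₚ X +ₚ four) *ₚ derivative (Fib n) +ₚ X *ₚ Fib n ≋
  (ℤ.+ n ∷ []) *ₚ (two *ₚ Fib (suc n) -ₚ X *ₚ Fib n)
derivative-Fib zero = mk≋ λ { zero → refl ; (suc zero) → refl ; (suc (suc zero)) → refl ; (suc (suc (suc i))) → refl }
derivative-Fib (suc zero) = mk≋ λ { zero → refl ; (suc zero) → refl ; (suc (suc zero)) → refl ; (suc (suc (suc zero))) → refl ; (suc (suc (suc (suc i)))) → refl }
derivative-Fib (suc (suc n)) = begin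
  (X *ₚ X +ₚ four) *ₚ derivative (Fib (suc (suc n))) +ₚ X *ₚ (X *ₚ F₁ +ₚ F₀)
    ≈⟨ +-cong (*-congʳ (X *ₚ X +ₚ four) (derivative-Fib-step n)) ≋-refl ⟩
  (X *ₚ X +ₚ four) *ₚ (F₁ +ₚ X *ₚ D₁ +ₚ D₀) +ₚ X *ₚ (X *ₚ F₁ +ₚ F₀) ≈⟨ lem₁ X four F₀ F₁ D₀ D₁ ⟩
  (X *ₚ X +ₚ four) *ₚ F₁ +ₚ X *ₚ ((X *ₚ X +ₚ four) *ₚ D₁ +ₚ X *ₚ F₁) +ₚ ((X *ₚ X +ₚ four) *ₚ D₀ +ₚ X *ₚ F₀)
    ≈⟨ +-cong (+-cong (≋-refl {(X *ₚ X +ₚ four) *ₚ F₁}) (*-congʳ X (derivative-Fib (suc n)))) (derivative-Fib n) ⟩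
  (X *ₚ X +ₚ four) *ₚ F₁ +ₚ X *ₚ ((oneₚ +ₚ k) *ₚ (two *ₚ (X *ₚ F₁ +ₚ F₀) -ₚ X *ₚ F₁)) +ₚ k *ₚ (two *ₚ F₁ -ₚ X *ₚ F₀)
    ≈⟨ lem₂ X F₀ F₁ k ⟩
  (two +ₚ k) *ₚ (two *ₚ (X *ₚ (X *ₚ F₁ +ₚ F₀) +ₚ F₁) -ₚ X *ₚ (X *ₚ F₁ +ₚ F₀)) ∎
  where
  open ≋-Reasoning
  F₀ = Fib n
  F₁ = Fib (suc n)
  D₀ = derivative F₀
  D₁ = derivative F₁
  k = ℤ.+ n ∷ []
  lem₁ : ∀ x c f₀ f₁ d₀ d₁ → (x *ₚ x +ₚ c) *ₚ (f₁ +ₚ x *ₚ d₁ +ₚ d₀) +ₚ x *ₚ (x *ₚ f₁ +ₚ f₀) ≋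
    (x *ₚ x +ₚ c) *ₚ f₁ +ₚ x *ₚ ((x *ₚ x +ₚ c) *ₚ d₁ +ₚ x *ₚ f₁) +ₚ ((x *ₚ x +ₚ c) *ₚ d₀ +ₚ x *ₚ f₀)
  lem₁ = Ring.solve-∀ polyACR
  lem₂ : ∀ x f₀ f₁ k → let two = oneₚ +ₚ oneₚ in
    (x *ₚ x +ₚ (two +ₚ two)) *ₚ f₁ +ₚ x *ₚ ((oneₚ +ₚ k) *ₚ (two *ₚ (x *ₚ f₁ +ₚ f₀) -ₚ x *ₚ f₁)) +ₚ k *ₚ (two *ₚ f₁ -ₚ x *ₚ f₀) ≋
    (two +ₚ k) *ₚ (two *ₚ (x *ₚ (x *ₚ f₁ +ₚ f₀) +ₚ f₁) -ₚ x *ₚ (x *ₚ f₁ +ₚ f₀))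
  lem₂ = Ring.solve-∀ polyACR

-- The local functions behind `Φ`

-- The same for the divisor filter inside cycloList, whose list of candidates starts as its module parameter.

mutual
  filter₀ : ℕ → ℕ → List Poly → List Poly
  filter₀ = _

  cycloList-suc : ∀ k → cycloList (suc k) ≡
    cycloList k ∷ʳ divMonic (Xpow (suc k) -ₚ oneₚ) (prodₚ (filter₀ k 1 (cycloList k)))
  cycloList-suc k with foldr _*ₚ_ oneₚ | cycloList k
  ... | _ | _ with 1
  ... | _ = refl

mutual
  filter₁ : ℕ → ℕ → Poly → List Poly → List Poly
  filter₁ = _

  filter₁-spec : ∀ k d p ps → filter₀ k d (p ∷ ps) ≡
    (if does (d ∣? suc k) then p ∷ filter₁ k (suc d) p ps else filter₁ k (suc d) p ps)
  filter₁-spec k d p ps with does (d ∣? suc k) | suc d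
  ... | true | _ = refl
  ... | false | _ = refl

module _ (k : ℕ) (p : Poly) (ps : List Poly) (d : List Poly → ℕ) (eq : ps ≡ p ∷ ps) where
  private
    unfold : {A : ℕ → ℕ → List Poly → List Poly} {B : ℕ → ℕ → Poly → List Poly → List Poly} →
      (∀ k d ps x → reveal (filter₀ k d ps) x ≡ A k d ps) →
      (∀ k d p ps x → reveal (filter₁ k d p ps) x ≡ B k d p ps) →
      B k (d ps) p ps ≡ A k (d (p ∷ ps)) (p ∷ ps) → B k (d ps) p ps ≡ A k (d (p ∷ ps)) (p ∷ ps)
    unfold _ _ p = p

  filter-cong = unfold (λ _ _ _ _ → refl) (λ _ _ _ _ _ → refl) (cong! eq)

mutual
  filter-family : ℕ → Poly → List Poly → (List Poly → ℕ) → List Poly → List Poly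
  filter-family = _

  filter-family-spec : ∀ k p ps d eq → stuck (cong (filter-family k p ps d) eq) ≡ stuck (filter-cong k p ps d eq)
  filter-family-spec k p ps d eq = refl

mutual
  filterΦ : ℕ → Poly → List Poly → ℕ → List Poly → List Poly
  filterΦ = _

  filterΦ-spec : ∀ k p ps d qs → filter-family k p ps d qs ≡ filterΦ k p ps (d qs) qs
  filterΦ-spec k p ps d qs with d qs
  ... | _ = refl

mutual
  lastΦ : ℕ → List Poly → Poly
  lastΦ = _

  Φ-suc : ∀ k → Φ (suc k) ≡ lastΦ k (cycloList (suc k))
  Φ-suc k with cycloList (suc k)
  ... | _ = refl

mutual
  longDivision : List ℤ → ℕ → List ℤ → List ℤ
  longDivision = _

  divMonic-unfold : ∀ f g c gs → reverse (norm g) ≡ c ∷ gs →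
    divMonic f g ≡ reverse (longDivision gs (length (reverse (norm f)) ℕ.∸ length gs) (reverse (norm f)))
  divMonic-unfold f g c gs e with reverse (norm g)
  divMonic-unfold f g c gs refl | .c ∷ .gs with reverse (norm f)
  ... | r with length r ℕ.∸ length gs
  ... | _ with reverse {A = ℤ}
  ... | _ = refl

mutual
  subtractPrefix : List ℤ → List ℤ → List ℤ
  subtractPrefix = _

  longDivision-suc : ∀ gs k c r →
    longDivision gs (suc k) (c ∷ r) ≡ c ∷ longDivision gs k (subtractPrefix (map (c *_) gs) r)
  longDivision-suc gs k c r with map (c *_) gs
  ... | _ = refl

-- Fibotomic polynomials

fibonacci : LucasParameters
fibonacci = record
  { P = X ; Q = -1ℤ ∷ []
  ; P-monic = monicOf refl λ { (suc (suc i)) _ → refl ; (suc zero) (s≤s ()) }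
  ; Q-small = λ { (suc (suc i)) _ → refl ; (suc zero) (s≤s ()) }
  ; Q-coprime = λ n → comax-const {c = -1ℤ} λ () }

module Fibonacci where
  open LucasParameters fibonacci

  U≋Fib : ∀ n → U n ≋ Fib n
  U≋Fib zero = ≋-refl
  U≋Fib (suc zero) = ≋-refl
  U≋Fib (suc (suc n)) = ≋-trans (lem X (U (suc n)) (U n)) (+-cong (*-congʳ X (U≋Fib (suc n))) (U≋Fib n))
    where
    lem : ∀ x u v → x *ₚ u -ₚ negₚ oneₚ *ₚ v ≋ x *ₚ u +ₚ v
    lem = Ring.solve-∀ polyACR

  module _ {N : ℕ} (T : Factorization N) {n : ℕ} (n<N : n ℕ.< N) where
    open Factorization T

    -- If the square of `q` divided `Ψ (suc n)`, then `q` would divide `Fib (suc n)` and its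
    -- derivative. By `derivative-Fib` it would then divide a nonzero constant times
    -- `Fib (suc (suc n))`, to which it is coprime.
    Ψ-squarefree : ∀ {q} → Monic q → Irreducible q → ¬ q *ₚ q ∣≋ Ψ (suc n)
    Ψ-squarefree {q} mq irr q²∣Ψ = coprime-∤ (monic⇒monicOf mq) irr
      (comax-* (comax-const {c = ℤ.+ suc n} λ ()) (comax-* (comax-const {c = ℤ.+ 2} λ ())
        (comax-cong (≋-sym (U≋Fib (suc (suc n)))) (comax-sym (comax-factor q∣Ψ (comax-sym (comax-U-suc n<N)))))))
      (∣≋-cong (≋-trans (+-cong (derivative-Fib (suc n)) ≋-refl) (lem (ℤ.+ suc n ∷ []) two F₁ X F₀))
        (∣≋-+ (∣≋-+ (∣≋-*ˡ (X *ₚ X +ₚ four) q∣F′) (∣≋-*ˡ X q∣F)) (∣≋-*ˡ ((ℤ.+ suc n ∷ []) *ₚ X) q∣F)))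
      where
      F₀ = Fib (suc n)
      F₁ = Fib (suc (suc n))
      q∣Ψ : q ∣≋ Ψ (suc n)
      q∣Ψ = ∣≋-trans (q , ≋-refl) q²∣Ψ
      q∣F : q ∣≋ F₀
      q∣F = ∣≋-cong (U≋Fib (suc n)) (∣≋-trans q∣Ψ (Ψ∣U n n<N))
      q∣F′ : q ∣≋ derivative F₀
      q∣F′ = square-∣⇒∣-derivative (∣≋-cong (U≋Fib (suc n)) (∣≋-trans q²∣Ψ (Ψ∣U n n<N)))
      lem : ∀ k t f₁ x f₀ → k *ₚ (t *ₚ f₁ -ₚ x *ₚ f₀) +ₚ k *ₚ x *ₚ f₀ ≋ k *ₚ (t *ₚ f₁)
      lem = Ring.solve-∀ polyACR

    fibotomic-unique : ∀ {P} → IsFibotomic (suc n) P → ¬ ¬ (P ≋ Ψ (suc n))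
    fibotomic-unique {P} (mP , spec) k = squarefree-divides (suc (deg P)) (Ψ (suc n)) ℕ.≤-refl (monic⇒monicOf mP)
      (λ q mq irr d → proj₂ (proj₂ (spec q mq irr)) (∣≋⇒∣ₚ d)) P-factors
      λ P∣Ψ → squarefree-divides (suc (e (suc n))) P ℕ.≤-refl (monic n n<N)
        (λ q → Ψ-squarefree {q}) Ψ-factors
        λ Ψ∣P → k (monic-∣-antisym (monic⇒monicOf mP) (monic n n<N) P∣Ψ Ψ∣P)
      where
      P-factors : ∀ q → Monic q → Irreducible q → q ∣≋ P → q ∣≋ Ψ (suc n)
      P-factors q mq irr q∣P with proj₁ (spec q mq irr) (∣≋⇒∣ₚ q∣P)
      -- If `q` does not divide `Ψ (suc n)`, it is coprime to it. Dividing no earlier `Fib`, it is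
      -- coprime to all earlier factors too, hence to their product `Fib (suc n)`, a contradiction.
      ... | q∣F , q∤F with irreducible-dichotomy (monic⇒monicOf mq) irr (Ψ (suc n))
      ...   | inj₁ d = d
      ...   | inj₂ c = ⊥-elim (coprime-∤ (monic⇒monicOf mq) irr
                (comax-cong (≋-sym (U≋Fib (suc n))) (comax-cong (product n n<N) (comax-* c
                  (∏-closed (Comax q) (comax-const 1≢0) comax-* {Ψ} {_∣ᵇ suc n} n earlier)))) (∣ₚ⇒∣≋ q∣F))
        where
        earlier : ∀ d → d ℕ.< n → (suc d ∣ᵇ suc n) ≡ true → Comax q (Ψ (suc d))
        earlier d d<n _ with irreducible-dichotomy (monic⇒monicOf mq) irr (Ψ (suc d))
        ... | inj₂ c = c
        ... | inj₁ q∣Ψd = ⊥-elim (q∤F (suc d) (s≤s z≤n) (s≤s d<n)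
                (∣≋⇒∣ₚ (∣≋-cong (U≋Fib (suc d)) (∣≋-trans q∣Ψd (Ψ∣U d (ℕ.<-trans d<n n<N))))))
      Ψ-factors : ∀ q → Monic q → Irreducible q → q ∣≋ Ψ (suc n) → q ∣≋ P
      Ψ-factors q mq irr q∣Ψ = ∣ₚ⇒∣≋ (proj₁ (proj₂ (spec q mq irr))
        (∣≋⇒∣ₚ (∣≋-cong (U≋Fib (suc n)) (∣≋-trans q∣Ψ (Ψ∣U n n<N)))) new)
        where
        new : ∀ k → 1 ℕ.≤ k → k ℕ.< suc n → ¬ q ∣ₚ Fib k
        new (suc k) _ (s≤s k<n) q∣Fk = coprime-∤ (monic⇒monicOf mq) irr
          (comax-cong (≋-sym (U≋Fib (suc k))) (comax-sym (comax-factor q∣Ψ (comax-sym (comax-U-< k<n n<N))))) (∣ₚ⇒∣≋ q∣Fk)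

-- Cyclotomic polynomials

++-≋ : ∀ f g → f ++ g ≋ f +ₚ Xpow (length f) *ₚ g
++-≋ [] g = ≋-sym (*-identityˡ g)
++-≋ (a ∷ f) g = ≋-trans (∷-cong (sym (ℤ.+-identityʳ a)) (++-≋ f g))
  (+-cong (≋-refl {a ∷ f}) (≋-sym (shift-* (Xpow (length f)) g)))

reverse-∷ : ∀ c r → reverse (c ∷ r) ≋ reverse r +ₚ (c ∷ []) *ₚ Xpow (length r)
reverse-∷ c r rewrite List.unfold-reverse c r = ≋-trans (++-≋ (reverse r) (c ∷ []))
  (+-cong (≋-refl {reverse r}) (≋-trans (*-comm (Xpow (length (reverse r))) (c ∷ []))
    (*-congʳ (c ∷ []) (subst (λ n → Xpow n ≋ Xpow (length r)) (sym (List.length-reverse r)) ≋-refl))))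

Xpow-+ : ∀ m n → Xpow (m ℕ.+ n) ≋ Xpow m *ₚ Xpow n
Xpow-+ zero n = ≋-sym (*-identityˡ (Xpow n))
Xpow-+ (suc m) n = ≋-trans (∷-cong refl (Xpow-+ m n)) (≋-sym (shift-* (Xpow m) (Xpow n)))

length-subtract : ∀ xs ys δ → length ys ≡ δ ℕ.+ length xs → length (subtractPrefix xs ys) ≡ length ys
length-subtract [] ys δ e = refl
length-subtract (x ∷ xs) [] δ e with () ← trans e (ℕ.+-suc δ (length xs))
length-subtract (x ∷ xs) (y ∷ ys) δ e = cong suc (length-subtract xs ys δ (ℕ.suc-injective (trans e (ℕ.+-suc δ (length xs)))))

-- `subtractPrefix` aligns the two lists at their leading coefficients; read lowest degree first,
-- this is a shift by the difference `δ` of the lengths.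
reverse-subtract : ∀ xs ys δ → length ys ≡ δ ℕ.+ length xs → reverse (subtractPrefix xs ys) ≋ reverse ys -ₚ Xpow δ *ₚ reverse xs
reverse-subtract [] ys δ e = ≋-sym (≋-trans (+-cong (≋-refl {reverse ys}) (neg-cong (*-zeroʳ (Xpow δ)))) (+-identityʳ (reverse ys)))
reverse-subtract (x ∷ xs) [] δ e with () ← trans e (ℕ.+-suc δ (length xs))
reverse-subtract (x ∷ xs) (y ∷ ys) δ e = begin
  reverse (y - x ∷ subtractPrefix xs ys) ≈⟨ reverse-∷ (y - x) (subtractPrefix xs ys) ⟩
  reverse (subtractPrefix xs ys) +ₚ ((y ∷ []) -ₚ (x ∷ [])) *ₚ Xpow (length (subtractPrefix xs ys))
    ≈⟨ +-cong (reverse-subtract xs ys δ e′) (*-congʳ ((y ∷ []) -ₚ (x ∷ [])) powers) ⟩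
  reverse ys -ₚ Xpow δ *ₚ reverse xs +ₚ ((y ∷ []) -ₚ (x ∷ [])) *ₚ (Xpow δ *ₚ Xpow (length xs))
    ≈⟨ lem (reverse ys) (Xpow δ) (reverse xs) (y ∷ []) (x ∷ []) (Xpow (length xs)) ⟩
  reverse ys +ₚ (y ∷ []) *ₚ (Xpow δ *ₚ Xpow (length xs)) -ₚ Xpow δ *ₚ (reverse xs +ₚ (x ∷ []) *ₚ Xpow (length xs))
    ≈⟨ +-cong (+-cong (≋-refl {reverse ys}) (*-congʳ (y ∷ []) (≋-trans (≋-sym (Xpow-+ δ (length xs))) (≋-reflexive (cong Xpow (sym e′))))))
         (neg-cong (*-congʳ (Xpow δ) (≋-sym (reverse-∷ x xs)))) ⟩
  reverse ys +ₚ (y ∷ []) *ₚ Xpow (length ys) -ₚ Xpow δ *ₚ reverse (x ∷ xs)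
    ≈⟨ +-cong (reverse-∷ y ys) ≋-refl ⟨
  reverse (y ∷ ys) -ₚ Xpow δ *ₚ reverse (x ∷ xs) ∎
  where
  open ≋-Reasoning
  e′ : length ys ≡ δ ℕ.+ length xs
  e′ = ℕ.suc-injective (trans e (ℕ.+-suc δ (length xs)))
  powers : Xpow (length (subtractPrefix xs ys)) ≋ Xpow δ *ₚ Xpow (length xs)
  powers = ≋-trans (≋-reflexive (cong Xpow (trans (length-subtract xs ys δ e′) e′))) (Xpow-+ δ (length xs))
  lem : ∀ r d s y x l → r -ₚ d *ₚ s +ₚ (y -ₚ x) *ₚ (d *ₚ l) ≋ r +ₚ y *ₚ (d *ₚ l) -ₚ d *ₚ (s +ₚ x *ₚ l)
  lem = Ring.solve-∀ polyACR

length-longDiv : ∀ gs k r → length r ≡ k ℕ.+ length gs → length (longDivision gs k r) ≡ k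
length-longDiv gs zero r e = refl
length-longDiv gs (suc k) (c ∷ r) e = cong suc (length-longDiv gs k _
  (trans (length-subtract (c • gs) r k (trans (ℕ.suc-injective e) (cong (k ℕ.+_) (sym (length-map (c *_) gs))))) (ℕ.suc-injective e)))

-- The invariant of the loop, where `k` quotient coefficients are still to come. The divisor is
-- monic of degree `length gs`, so the leading `c` of a list with `suc k` steps left contributes `c`
-- times `Xpow k` to the quotient.
longDiv-spec : ∀ gs k r → length r ≡ k ℕ.+ length gs →
  Σ Poly λ t → reverse r ≋ reverse (longDivision gs k r) *ₚ reverse (1ℤ ∷ gs) +ₚ t × Deg< (length gs) t
longDiv-spec gs zero r e = reverse r , ≋-refl ,
  subst (λ n → Deg< n (reverse r)) (trans (List.length-reverse r) e) (coeff-beyond (reverse r))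
longDiv-spec gs (suc k) (c ∷ r) e with longDiv-spec gs k (subtractPrefix (c • gs) r)
  (trans (length-subtract (c • gs) r k (trans (ℕ.suc-injective e) (cong (k ℕ.+_) (sym (length-map (c *_) gs))))) (ℕ.suc-injective e))
... | t , eq , small = t , identity , small
  where
  open ≋-Reasoning
  C = c ∷ []
  r′ = subtractPrefix (c • gs) r
  q = reverse (longDivision gs k r′)
  G = reverse gs
  length-r : length r ≡ k ℕ.+ length gs
  length-r = ℕ.suc-injective e
  length-r′ : length r ≡ k ℕ.+ length (c • gs)
  length-r′ = trans length-r (cong (k ℕ.+_) (sym (length-map (c *_) gs)))
  lem₁ : ∀ r C x G l → r +ₚ C *ₚ (x *ₚ l) ≋ (r -ₚ x *ₚ (C *ₚ G)) +ₚ C *ₚ x *ₚ (G +ₚ oneₚ *ₚ l)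
  lem₁ = Ring.solve-∀ polyACR
  lem₂ : ∀ q B t C x → q *ₚ B +ₚ t +ₚ C *ₚ x *ₚ B ≋ (q +ₚ C *ₚ x) *ₚ B +ₚ t
  lem₂ = Ring.solve-∀ polyACR
  identity : reverse (c ∷ r) ≋ reverse (c ∷ longDivision gs k r′) *ₚ reverse (1ℤ ∷ gs) +ₚ t
  identity = begin
    reverse (c ∷ r) ≈⟨ reverse-∷ c r ⟩
    reverse r +ₚ C *ₚ Xpow (length r) ≈⟨ +-cong (≋-refl {reverse r}) (*-congʳ C (≋-trans (≋-reflexive (cong Xpow length-r)) (Xpow-+ k (length gs)))) ⟩
    reverse r +ₚ C *ₚ (Xpow k *ₚ Xpow (length gs)) ≈⟨ lem₁ (reverse r) C (Xpow k) G (Xpow (length gs)) ⟩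
    (reverse r -ₚ Xpow k *ₚ (C *ₚ G)) +ₚ C *ₚ Xpow k *ₚ (G +ₚ oneₚ *ₚ Xpow (length gs))
      ≈⟨ +-cong (+-cong (≋-refl {reverse r}) (neg-cong (*-congʳ (Xpow k)
           (≋-trans (const-* c G) (≋-reflexive (List.reverse-map (c *_) gs)))))) (*-congʳ (C *ₚ Xpow k) (≋-sym (reverse-∷ 1ℤ gs))) ⟩
    (reverse r -ₚ Xpow k *ₚ reverse (c • gs)) +ₚ C *ₚ Xpow k *ₚ reverse (1ℤ ∷ gs)
      ≈⟨ +-cong (≋-trans (≋-sym (reverse-subtract (c • gs) r k length-r′)) eq) ≋-refl ⟩
    q *ₚ reverse (1ℤ ∷ gs) +ₚ t +ₚ C *ₚ Xpow k *ₚ reverse (1ℤ ∷ gs) ≈⟨ lem₂ q (reverse (1ℤ ∷ gs)) t C (Xpow k) ⟩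
    (q +ₚ C *ₚ Xpow k) *ₚ reverse (1ℤ ∷ gs) +ₚ t
      ≈⟨ +-cong (*-congˡ (reverse (1ℤ ∷ gs)) (≋-trans (+-cong (≋-refl {q}) (*-congʳ C (≋-reflexive (cong Xpow (sym (length-longDiv gs k r′
           (trans (length-subtract (c • gs) r k length-r′) length-r)))))))
             (≋-sym (reverse-∷ c (longDivision gs k r′))))) ≋-refl ⟩
    reverse (c ∷ longDivision gs k r′) *ₚ reverse (1ℤ ∷ gs) +ₚ t ∎

coeff-last : ∀ xs (x : ℤ) → coeff (xs ∷ʳ x) (length xs) ≡ x
coeff-last [] x = refl
coeff-last (_ ∷ xs) x = coeff-last xs x

reverse-monic : ∀ {q g} → MonicOf q g → Σ (List ℤ) λ gs → reverse (norm g) ≡ 1ℤ ∷ gs × length gs ≡ q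
reverse-monic {q} {g} m with norm g | norm-sound g | length-norm {suc q} {g} (m .above)
... | ys | ys≋g | short with initLast ys
... | [] = ⊥-elim (1≢0 (trans (sym (m .leading)) (sym (ys≋g .at q))))
... | xs ∷ʳ′ x = reverse xs , trans (List.reverse-++ xs (x ∷ [])) (cong (_∷ reverse xs) x≡1) ,
    trans (List.length-reverse xs) length-xs
  where
  length-xs : length xs ≡ q
  length-xs = ℕ.≤-antisym (ℕ.s≤s⁻¹ (subst (ℕ._≤ suc q) (trans (List.length-++ xs) (ℕ.+-comm (length xs) 1)) short))
    (ℕ.≮⇒≥ λ l → 1≢0 (trans (sym (m .leading)) (trans (sym (ys≋g .at q))
      (coeff-beyond (xs ∷ʳ x) q (subst (ℕ._≤ q) (trans (ℕ.+-comm 1 (length xs)) (sym (List.length-++ xs))) l)))))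
  x≡1 : x ≡ 1ℤ
  x≡1 = trans (sym (coeff-last xs x)) (trans (cong (coeff (xs ∷ʳ x)) length-xs) (trans (ys≋g .at q) (m .leading)))

divMonic-exact : ∀ {q f g h} → MonicOf q g → f ≋ h *ₚ g → divMonic f g ≋ h
divMonic-exact {q} {f} {g} {h} m e with reverse-monic m
... | gs , rev≡ , length≡ = subst (_≋ h) (sym (divMonic-unfold f g 1ℤ gs rev≡)) quotient≋
  where
  fr = reverse (norm f)
  f≋fr : f ≋ reverse fr
  f≋fr = subst (f ≋_) (sym (List.reverse-involutive (norm f))) (≋-sym (norm-sound f))
  g≋ : reverse (1ℤ ∷ gs) ≋ g
  g≋ = subst (λ r → reverse r ≋ g) rev≡ (subst (_≋ g) (sym (List.reverse-involutive (norm g))) (norm-sound g))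
  quotient≋ : reverse (longDivision gs (length fr ℕ.∸ length gs) fr) ≋ h
  quotient≋ with ℕ.≤-total (length gs) (length fr)
  ... | inj₁ l with longDiv-spec gs (length fr ℕ.∸ length gs) fr (sym (ℕ.m∸n+n≡m l))
  ...   | t , eq , small = monic-cancel m (begin
    s *ₚ g ≈⟨ +-identityʳ (s *ₚ g) ⟨
    s *ₚ g +ₚ [] ≈⟨ +-cong (≋-refl {s *ₚ g}) t≋0 ⟨
    s *ₚ g +ₚ t ≈⟨ f≋ ⟨
    f ≈⟨ e ⟩
    h *ₚ g ∎)
    where
    open ≋-Reasoning
    s = reverse (longDivision gs (length fr ℕ.∸ length gs) fr)
    f≋ : f ≋ s *ₚ g +ₚ t
    f≋ = ≋-trans f≋fr (≋-trans eq (+-cong (*-congʳ s g≋) ≋-refl))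
    t≋0 : t ≋ []
    t≋0 = ≋-trans (≋-sym (remainder-unique m s (subst (λ n → Deg< n t) length≡ small) f≋))
      (remainder-unique m h {[]} (λ _ _ → refl) (≋-trans e (≋-sym (+-identityʳ (h *ₚ g)))))
  -- The truncated difference is 0 and the computed quotient empty; `h` is zero as well, because
  -- `h *ₚ g` has degree below `q`.
  quotient≋ | inj₂ l rewrite ℕ.m≤n⇒m∸n≡0 l = ≋-sym (monic-small⇒zero m h (Deg<-≋ {f = f} e
    λ i q≤i → trans (f≋fr .at i) (coeff-beyond (reverse fr) i (ℕ.≤-trans
      (subst (ℕ._≤ q) (sym (List.length-reverse fr)) (subst (length fr ℕ.≤_) length≡ l)) q≤i))))

coeff-0-* : ∀ f g → coeff (f *ₚ g) 0 ≡ coeff f 0 * coeff g 0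
coeff-0-* [] g = refl
coeff-0-* (c ∷ f) g = coeff-*-0 c f g

constant-term-mod-X : ∀ f → f ≡ coeff f 0 ∷ [] mod X
constant-term-mod-X [] = mod-reflexive X (≋-sym 0∷[])
constant-term-mod-X (c ∷ f) = f , ≋-trans (∷-cong (sym (ℤ.+-identityˡ c)) (≋-sym (+-identityʳ f)))
  (+-cong {g = c ∷ []} (≋-trans (≋-sym (≋-trans (shift-* oneₚ f) (∷-cong refl (*-identityˡ f)))) (*-comm X f)) ≋-refl)

monicOf-X : MonicOf 1 X
monicOf-X = monicOf refl λ { (suc (suc i)) _ → refl ; (suc zero) (s≤s ()) }

sign-square : ∀ p → -1ℤ ℤ.^ p * -1ℤ ℤ.^ p ≡ 1ℤ
sign-square zero = refl
sign-square (suc p) = trans (lem (-1ℤ ℤ.^ p)) (sign-square p)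
  where
  lem : ∀ x → -1ℤ * x * (-1ℤ * x) ≡ x * x
  lem = solve-∀

-- By symmetry the norm of `X` modulo `f` is (-1)^p times the norm of `f` modulo `X`, its constant
-- term 1. The sign cancels against the norm of -1.
Norm-neg-X : ∀ {p f} → MonicOf p f → coeff f 0 ≡ 1ℤ → Norm p f (negₚ X) ≡ 1ℤ
Norm-neg-X {p} {f} m c = begin
  Norm p f (negₚ X) ≡⟨ Norm-cong m (≋-sym (const-* -1ℤ X)) ⟩
  Norm p f ((-1ℤ ∷ []) *ₚ X) ≡⟨ Norm-* m (-1ℤ ∷ []) X ⟩
  Norm p f (-1ℤ ∷ []) * Norm p f X ≡⟨ cong₂ _*_ (Norm-const m -1ℤ) (Norm-symmetric m monicOf-X) ⟩
  -1ℤ ℤ.^ p * (-1ℤ ℤ.^ (1 ℕ.* p) * Norm 1 X f)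
    ≡⟨ cong₂ (λ n u → -1ℤ ℤ.^ p * (-1ℤ ℤ.^ n * u)) (ℕ.*-identityˡ p)
         (trans (Norm-mod monicOf-X (subst (λ u → f ≡ u ∷ [] mod X) c (constant-term-mod-X f))) (Norm-one monicOf-X)) ⟩
  -1ℤ ℤ.^ p * (-1ℤ ℤ.^ p * 1ℤ) ≡⟨ cong (-1ℤ ℤ.^ p *_) (ℤ.*-identityʳ (-1ℤ ℤ.^ p)) ⟩
  -1ℤ ℤ.^ p * -1ℤ ℤ.^ p ≡⟨ sign-square p ⟩
  1ℤ ∎
  where open ≡-Reasoning

constant-term-one⇒comax : ∀ {f} → coeff f 0 ≡ 1ℤ → Comax f X
constant-term-one⇒comax {f} c with constant-term-mod-X f
... | q , e = 1ℤ , 1≢0 , oneₚ , negₚ q , ≋-trans (+-cong (*-congʳ oneₚ e) ≋-refl)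
  (≋-trans (lem q X (coeff f 0 ∷ [])) (∷-cong c ≋-refl))
  where
  lem : ∀ q x c → oneₚ *ₚ (q *ₚ x +ₚ c) +ₚ negₚ q *ₚ x ≋ c
  lem = Ring.solve-∀ polyACR

-- The characteristic polynomial t² - (x + 1)t + x has the roots x and 1. The sequence is opened
-- ahead of `cyclotomic`, whose field `Q-coprime` already rests on the constant terms of `U`.
module CyclotomicSequence = LucasSequence (1ℤ ∷ 1ℤ ∷ []) X

constant-term-U : ∀ n → coeff (CyclotomicSequence.U (suc n)) 0 ≡ 1ℤ
constant-term-U zero = refl
constant-term-U (suc n) = begin
  coeff (P *ₚ U (suc n) -ₚ X *ₚ U n) 0 ≡⟨ coeff-- (P *ₚ U (suc n)) (X *ₚ U n) 0 ⟩
  coeff (P *ₚ U (suc n)) 0 - coeff (X *ₚ U n) 0 ≡⟨ cong₂ _-_ (coeff-0-* P (U (suc n))) (coeff-0-* X (U n)) ⟩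
  1ℤ * coeff (U (suc n)) 0 - 0ℤ * coeff (U n) 0 ≡⟨ cong (λ u → 1ℤ * u - 0ℤ * coeff (U n) 0) (constant-term-U n) ⟩
  1ℤ * 1ℤ - 0ℤ * coeff (U n) 0 ≡⟨ lem (coeff (U n) 0) ⟩
  1ℤ ∎
  where
  open ≡-Reasoning
  open CyclotomicSequence
  P = 1ℤ ∷ 1ℤ ∷ []
  lem : ∀ x → 1ℤ * 1ℤ - 0ℤ * x ≡ 1ℤ
  lem = solve-∀

cyclotomic : LucasParameters
cyclotomic = record
  { P = 1ℤ ∷ 1ℤ ∷ [] ; Q = X
  ; P-monic = monicOf refl λ { (suc (suc i)) _ → refl ; (suc zero) (s≤s ()) }
  ; Q-small = monicOf-X .above
  ; Q-coprime = λ n → constant-term-one⇒comax (constant-term-U n) }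

Xpow-1 : ℕ → Poly
Xpow-1 n = Xpow n -ₚ oneₚ

X-1 : Poly
X-1 = X -ₚ oneₚ

Xpow-suc : ∀ n → Xpow (suc n) ≋ X *ₚ Xpow n
Xpow-suc n = ≋-sym (≋-trans (shift-* oneₚ (Xpow n)) (∷-cong refl (*-identityˡ (Xpow n))))

module Cyclotomic where
  open LucasParameters cyclotomic

  X^n-1 : ∀ n → Xpow-1 n ≋ X-1 *ₚ U n
  X^n-1 zero = ≋-trans (neg-inverseʳ oneₚ) (≋-sym (*-zeroʳ X-1))
  X^n-1 (suc zero) = ≋-trans (+-cong {g′ = negₚ oneₚ} (≋-trans (Xpow-suc 0) (≋-trans (*-comm X oneₚ) (*-identityˡ X))) (≋-refl {negₚ oneₚ}))
    (≋-sym (≋-trans (*-comm X-1 oneₚ) (*-identityˡ X-1)))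
  X^n-1 (suc (suc n)) = begin
    Xpow (suc (suc n)) -ₚ oneₚ ≈⟨ +-cong (≋-trans (Xpow-suc (suc n)) (*-congʳ X (Xpow-suc n))) ≋-refl ⟩
    X *ₚ (X *ₚ Y) -ₚ oneₚ ≈⟨ lem₁ X Y ⟩
    (oneₚ +ₚ X) *ₚ (X *ₚ Y -ₚ oneₚ) -ₚ X *ₚ (Y -ₚ oneₚ)
      ≈⟨ +-cong (*-congʳ (oneₚ +ₚ X) (≋-trans (+-cong (≋-sym (Xpow-suc n)) ≋-refl) (X^n-1 (suc n))))
           (neg-cong (*-congʳ X (X^n-1 n))) ⟩
    (oneₚ +ₚ X) *ₚ (X-1 *ₚ U (suc n)) -ₚ X *ₚ (X-1 *ₚ U n) ≈⟨ lem₂ X X-1 (U (suc n)) (U n) ⟩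
    X-1 *ₚ ((oneₚ +ₚ X) *ₚ U (suc n) -ₚ X *ₚ U n) ∎
    where
    open ≋-Reasoning
    Y = Xpow n
    lem₁ : ∀ x y → x *ₚ (x *ₚ y) -ₚ oneₚ ≋ (oneₚ +ₚ x) *ₚ (x *ₚ y -ₚ oneₚ) -ₚ x *ₚ (y -ₚ oneₚ)
    lem₁ = Ring.solve-∀ polyACR
    lem₂ : ∀ x z u v → (oneₚ +ₚ x) *ₚ (z *ₚ u) -ₚ x *ₚ (z *ₚ v) ≋ z *ₚ ((oneₚ +ₚ x) *ₚ u -ₚ x *ₚ v)
    lem₂ = Ring.solve-∀ polyACR

  module _ {N : ℕ} (T : Factorization N) where
    open Factorization T

    constant-terms-below : ∀ b → b ℕ.≤ N → ∀ d → d ℕ.< b → coeff (Ψ (suc d)) 0 ≡ 1ℤ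
    constant-terms-below zero _ d ()
    constant-terms-below (suc b) l = below-suc _ b IH (begin
      coeff (Ψ (suc b)) 0 ≡⟨ ℤ.*-identityʳ (coeff (Ψ (suc b)) 0) ⟨
      coeff (Ψ (suc b)) 0 * 1ℤ ≡⟨ cong (coeff (Ψ (suc b)) 0 *_) (∏-closed (λ f → coeff f 0 ≡ 1ℤ) refl
        (λ {f} {g} p q → trans (coeff-0-* f g) (cong₂ _*_ p q)) {Ψ} {_∣ᵇ suc b} b (λ d k _ → IH d k)) ⟨
      coeff (Ψ (suc b)) 0 * coeff (∏ Ψ b (_∣ᵇ suc b)) 0 ≡⟨ coeff-0-* (Ψ (suc b)) (∏ Ψ b (_∣ᵇ suc b)) ⟨
      coeff (Ψ (suc b) *ₚ ∏ Ψ b (_∣ᵇ suc b)) 0 ≡⟨ product b l .at 0 ⟨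
      coeff (U (suc b)) 0 ≡⟨ constant-term-U b ⟩
      1ℤ ∎)
      where
      open ≡-Reasoning
      IH = constant-terms-below b (ℕ.<⇒≤ l)

    Ψ-Norm-neg-X : ∀ m → m ℕ.< N → Norm (e (suc m)) (Ψ (suc m)) (negₚ X) ≡ 1ℤ
    Ψ-Norm-neg-X m l = Norm-neg-X (monic m l) (constant-terms-below N ℕ.≤-refl m l)

    -- The Lucas factorization omits the factor Φ₁ = x − 1 of xⁿ − 1.
    Φ̂ : ℕ → Poly
    Φ̂ (suc zero) = X-1
    Φ̂ d = Ψ d

    -- At the selected index 1 the factor `X-1` replaces `Ψ 1`, which is 1 by `product 0`; all other
    -- factors agree.
    ∏Φ̂ : ∀ b s → s 1 ≡ true → suc b ℕ.≤ N → ∏ Φ̂ (suc b) s ≋ X-1 *ₚ ∏ Ψ (suc b) s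
    ∏Φ̂ zero s p l rewrite p = *-congʳ X-1 (≋-sym (≋-trans (≋-sym (product 0 l)) ≋-refl))
    ∏Φ̂ (suc b) s p l = ≋-trans (*-congʳ h (∏Φ̂ b s p (ℕ.<⇒≤ l))) (lem h X-1 (∏ Ψ (suc b) s))
      where
      h = if s (suc (suc b)) then Ψ (suc (suc b)) else oneₚ
      lem : ∀ h x y → h *ₚ (x *ₚ y) ≋ x *ₚ (h *ₚ y)
      lem = Ring.solve-∀ polyACR

    Φ̂-product : ∀ n → n ℕ.< N → Xpow-1 (suc n) ≋ Φ̂ (suc n) *ₚ ∏ Φ̂ n (_∣ᵇ suc n)
    Φ̂-product zero l = X^n-1 1
    Φ̂-product (suc n) l = begin
      Xpow-1 (suc (suc n)) ≈⟨ X^n-1 (suc (suc n)) ⟩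
      X-1 *ₚ U (suc (suc n)) ≈⟨ *-congʳ X-1 (product (suc n) l) ⟩
      X-1 *ₚ (Ψ (suc (suc n)) *ₚ W) ≈⟨ lem X-1 (Ψ (suc (suc n))) W ⟩
      Ψ (suc (suc n)) *ₚ (X-1 *ₚ W)
        ≈⟨ *-congʳ (Ψ (suc (suc n))) (∏Φ̂ n (_∣ᵇ suc (suc n)) (∣ᵇ-true (ℕ∣.1∣ suc (suc n))) (ℕ.<⇒≤ l)) ⟨
      Ψ (suc (suc n)) *ₚ ∏ Φ̂ (suc n) (_∣ᵇ suc (suc n)) ∎
      where
      open ≋-Reasoning
      W = ∏ Ψ (suc n) (_∣ᵇ suc (suc n))
      lem : ∀ x y z → x *ₚ (y *ₚ z) ≋ y *ₚ (x *ₚ z)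
      lem = Ring.solve-∀ polyACR

    ê : ℕ → ℕ
    ê (suc zero) = 1
    ê d = e d

    Φ̂-monic : ∀ d → d ℕ.< N → MonicOf (ê (suc d)) (Φ̂ (suc d))
    Φ̂-monic zero _ = monic-- {g = oneₚ} monicOf-X λ { (suc i) _ → refl }
    Φ̂-monic (suc d) l = monic (suc d) l

    select : ℕ → ℕ → List Poly → List Poly
    select k d [] = []
    select k d (p ∷ ps) = if d ∣ᵇ suc k then p ∷ select k (suc d) ps else select k (suc d) ps

    filterΦ≡select : ∀ k p ps d qs → filterΦ k p ps d qs ≡ select k d qs
    filterΦ≡select k p ps d [] = refl
    filterΦ≡select k p ps d (q ∷ qs) rewrite filterΦ≡select k p ps (suc d) qs = refl

    filter₀≡select : ∀ k d qs → filter₀ k d qs ≡ select k d qs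
    filter₀≡select k d [] = refl
    filter₀≡select k d (q ∷ qs) = filterΦ≡select k q qs d (q ∷ qs)

    -- `cycloList` grows at its end, as `∏` does at its largest index. Numbering starts at `d`, so
    -- the appended polynomial has number `length qs + d`.
    select-∷ʳ : ∀ k d qs q → prodₚ (select k d (qs ∷ʳ q)) ≋
      (if (length qs ℕ.+ d) ∣ᵇ suc k then q else oneₚ) *ₚ prodₚ (select k d qs)
    select-∷ʳ k d [] q with d ∣ᵇ suc k
    ... | true = ≋-refl
    ... | false = ≋-sym (*-identityˡ oneₚ)
    select-∷ʳ k d (p ∷ qs) q with d ∣ᵇ suc k | select-∷ʳ k (suc d) qs q
    ... | true | IH rewrite ℕ.+-suc (length qs) d = ≋-trans (*-congʳ p IH) 
        (lem p (if suc (length qs ℕ.+ d) ∣ᵇ suc k then q else oneₚ) (prodₚ (select k (suc d) qs)))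
      where
      lem : ∀ x y z → x *ₚ (y *ₚ z) ≋ y *ₚ (x *ₚ z)
      lem = Ring.solve-∀ polyACR
    ... | false | IH rewrite ℕ.+-suc (length qs) d = IH

    -- The claim covers every filter index `j`, since the same initial list is filtered anew at each
    -- later stage; `newest≋` uses it at `j = k`.
    cycloList≋ : ∀ k → k ℕ.≤ N → length (cycloList k) ≡ k ×
      (∀ j → prodₚ (select j 1 (cycloList k)) ≋ ∏ Φ̂ k (_∣ᵇ suc j))

    newest : ℕ → Poly
    newest k = divMonic (Xpow-1 (suc k)) (prodₚ (filter₀ k 1 (cycloList k)))

    newest≋ : ∀ k → k ℕ.< N → newest k ≋ Φ̂ (suc k)
    newest≋ k l rewrite filter₀≡select k 1 (cycloList k) = divMonic-exact {h = Φ̂ (suc k)}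
      (monicOf-≋ (≋-sym p) (∏-monic {Φ̂} {ê} {_∣ᵇ suc k} k (λ d d<k → Φ̂-monic d (ℕ.<-trans d<k l))))
      (≋-trans (Φ̂-product k l) (*-congʳ (Φ̂ (suc k)) (≋-sym p)))
      where
      p : prodₚ (select k 1 (cycloList k)) ≋ ∏ Φ̂ k (_∣ᵇ suc k)
      p = proj₂ (cycloList≋ k (ℕ.<⇒≤ l)) k

    cycloList≋ zero _ = refl , λ j → ≋-refl
    cycloList≋ (suc k) l with cycloList≋ k (ℕ.<⇒≤ l)
    ... | length≡ , products = trans (cong length (cycloList-suc k))
        (trans (List.length-++ (cycloList k)) (trans (ℕ.+-comm (length (cycloList k)) 1) (cong suc length≡))) ,
      λ j → ≋-trans (≋-reflexive (cong (λ ps → prodₚ (select j 1 ps)) (cycloList-suc k)))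
        (≋-trans (select-∷ʳ j 1 (cycloList k) (newest k)) (*-cong (head j) (products j)))
      where
      head : ∀ j → (if (length (cycloList k) ℕ.+ 1) ∣ᵇ suc j then newest k else oneₚ) ≋ (if suc k ∣ᵇ suc j then Φ̂ (suc k) else oneₚ)
      head j rewrite trans (ℕ.+-comm (length (cycloList k)) 1) (cong suc length≡) with suc k ∣ᵇ suc j
      ... | true = newest≋ k l
      ... | false = ≋-refl

    last-∷ʳ : ∀ k ps p → lastΦ k (ps ∷ʳ p) ≡ p
    last-∷ʳ k [] p = refl
    last-∷ʳ k (_ ∷ []) p = refl
    last-∷ʳ k (_ ∷ q ∷ ps) p = last-∷ʳ k (q ∷ ps) p

    Φ≋ : ∀ k → suc k ℕ.< N → Φ (suc (suc k)) ≋ Ψ (suc (suc k))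
    Φ≋ k l = subst (_≋ Ψ (suc (suc k))) (sym (begin
      Φ (suc (suc k)) ≡⟨ Φ-suc (suc k) ⟩
      lastΦ (suc k) (cycloList (suc (suc k))) ≡⟨ cong (lastΦ (suc k)) (cycloList-suc (suc k)) ⟩
      lastΦ (suc k) (cycloList (suc k) ∷ʳ newest (suc k)) ≡⟨ last-∷ʳ (suc k) (cycloList (suc k)) (newest (suc k)) ⟩
      newest (suc k) ∎)) (newest≋ (suc k) l)
      where open ≡-Reasoning

-- The resultants of the two families

res≡Norm-of : ∀ {p f f′ g g′} → MonicOf p f → f′ ≋ f → g′ ≋ g → res f′ g′ ≡ Norm p f g
res≡Norm-of {p} {f} {f′} {g} {g′} m e e′ = begin
  res f′ g′ ≡⟨ res≡Norm {f′} {g′} (monicOf⇒monic m′) ⟩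
  Norm (deg f′) f′ g′ ≡⟨ cong (λ n → Norm n f′ g′) (monicOf⇒deg m′) ⟩
  Norm p f′ g′ ≡⟨ Norm-cong m′ e′ ⟩
  Norm p f′ g ≡⟨ Norm-congˡ m′ e g ⟩
  Norm p f g ∎
  where
  open ≡-Reasoning
  m′ = monicOf-≋ (≋-sym e) m

theorem4p3 : (m n : ℕ) → 2 ≤ m → m < n → (P Q : Poly) →
    IsFibotomic m P → IsFibotomic n Q → res P Q ≡ res (Φ m) (Φ n)
theorem4p3 (suc zero) _ (s≤s ())
theorem4p3 (suc (suc m)) (suc (suc n)) _ (s≤s m<n) P Q isP isQ =
  -- `P` and `Q` are identified with the new factors only under double negation; equality of
  -- integers is decidable, hence stable.
  decidable-stable (res P Q ℤ.≟ res (Φ (suc (suc m))) (Φ (suc (suc n)))) λ contra →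
    Fibonacci.fibotomic-unique T m<N {P} isP λ P≋Ψ → Fibonacci.fibotomic-unique T n<N {Q} isQ λ Q≋Ψ → contra (begin
      res P Q ≡⟨ res≡Norm-of (Fac.monic (suc m) m<N) P≋Ψ Q≋Ψ ⟩
      Norm (Fac.e (suc (suc m))) (Fac.Ψ (suc (suc m))) (Fac.Ψ (suc (suc n)))
        -- For `fibonacci`, `negₚ Q` computes to `oneₚ`; for `cyclotomic` it is `negₚ X`, of norm 1
        -- because the constant terms are 1.
        ≡⟨ Comparison.norms fibonacci cyclotomic T T′ (λ k l → Norm-one (Fac.monic (suc k) l))
             (λ k l → Cyclotomic.Ψ-Norm-neg-X T′ (suc k) l) (suc m) (suc n) m<n n<N ⟩
      Norm (Fac′.e (suc (suc m))) (Fac′.Ψ (suc (suc m))) (Fac′.Ψ (suc (suc n)))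
        ≡⟨ res≡Norm-of (Fac′.monic (suc m) m<N) (Cyclotomic.Φ≋ T′ m m<N) (Cyclotomic.Φ≋ T′ n n<N) ⟨
      res (Φ (suc (suc m))) (Φ (suc (suc n))) ∎)
  where
  open ≡-Reasoning
  T = LucasParameters.factorization fibonacci (suc (suc n))
  T′ = LucasParameters.factorization cyclotomic (suc (suc n))
  module Fac = LucasParameters.Factorization T
  module Fac′ = LucasParameters.Factorization T′
  n<N : suc n ℕ.< suc (suc n)
  n<N = ℕ.≤-refl
  m<N : suc m ℕ.< suc (suc n)
  m<N = ℕ.<-trans m<n n<N
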